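{- Let $G$ be an $\{\mathrm{ISK}_4, \text{diamond}, \text{bowtie}, \text{prism}, K_{3,3}\}$-free graph, and let $x$ be the center of a proper wheel in $G$. Let $W=(C,x)$ be a proper wheel in $G$ with center $x$ having the minimum number of spokes among all proper wheels with center $x$. Then (i) every connected component of $G\setminus N[x]$ contains the interior of at most one sector of $W$; and (ii) for every $u\in N(x)$, the component $D$ of $G\setminus (N[x]\setminus\{u\})$ containing $u$ contains the interiors of at most two sectors of $W$, and if $S_1,S_2$ are sectors with $S_1^*\subseteq V(D)$ and $S_2^*\subseteq V(D)$, then $V(S_1)\cap V(S_2)\neq\emptyset$.
   Context: "$H$-free" means no induced subgraph isomorphic to $H$; $\mathrm{ISK}_4$-free means no induced subdivision of $K_4$. Diamond: $K_4$ minus an edge. Bowtie: two triangles sharing one vertex. Prism: three vertex-disjoint paths $a_i\ldots b_i$ ($i=1,2,3$) of length $\ge1$ with $a_1a_2a_3$ and $b_1b_2b_3$ triangles and no other edges between the paths. $N[x]$ is the closed neighborhood. For a path $S$, $S^*$ is its set of internal vertices (its interior). A hole is an induced cycle of length at least four. A wheel $W=(C,x)$ (center $x$) consists of a hole $C$ and a vertex $x\notin V(C)$ with at least three neighbors in $V(C)$; $V(W)=V(C)\cup\{x\}$; spokes are the neighbors of $x$ in $C$; a sector is a subpath of $C$ whose ends are spokes and whose interior contains no spoke. A vertex $v$ is proper for $W$ if $v\in V(W)$, or all neighbors of $v$ in $V(C)$ lie in one sector and, if $v$ has more than two neighbors in $V(C)$, then $vx\in E(G)$. $W$ is proper in $G$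 if every vertex of $G$ is proper for $W$; $x$ is the center of a proper wheel in $G$ if some proper wheel in $G$ has center $x$.
   Formalization: In (i) and (ii) only sectors with nonempty interior (length at least two) are considered; a sector of length one has empty interior, which lies in every component, so the literal statement fails for a four-spoke wheel with one such sector. -}

module Defs where

open import Data.Nat using (ℕ; zero; suc; _+_; _≤_; _<_)
open import Data.Nat.DivMod using (_mod_)
open import Data.Fin as Fin using (Fin; toℕ; inject₁; fromℕ)
open import Data.Bool using (Bool; true; false; if_then_else_)
open import Data.List using (List; map; allFin)
open import Data.Nat.ListAction using (sum)
open import Data.Product using (Σ; ∃; ∃-syntax; _×_; _,_)
open import Data.Sum using (_⊎_)
open import Relation.Nullary using (¬_)
open import Relation.Binary.PropositionalEquality using (_≡_; _≢_)
open import Function.Definitions using (Injective)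

record Graph : Set where
  field
    n     : ℕ
    adj   : Fin n → Fin n → Bool
    sym   : ∀ u v → adj u v ≡ adj v u
    irrfl : ∀ v → adj v v ≡ false

_⊕_ : ∀ {k} → Fin (suc k) → ℕ → Fin (suc k)
_⊕_ {k} i t = (toℕ i + t) mod (suc k)

module _ (G : Graph) where
  open Graph G

  V : Set
  V = Fin n

  _~_ : V → V → Set
  u ~ v = adj u v ≡ true

  record PathIn (a b : V) : Set where
    field
      len   : ℕ
      p     : Fin (suc len) → V
      p-inj : Injective _≡_ _≡_ p
      start : p Fin.zero ≡ a
      end   : p (fromℕ len) ≡ b
      edges : ∀ (i : Fin len) → p (inject₁ i) ~ p (Fin.suc i)

  module _ {a b : V} (P : PathIn a b) where
    open PathIn P
    OnPath : V → Set
    OnPath v = ∃[ i ] p i ≡ v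
    InteriorOf : V → Set
    InteriorOf v = ∃[ i ] (p i ≡ v × i ≢ Fin.zero × i ≢ fromℕ len)
    Consec : V → V → Set
    Consec u v = ∃[ i ] ((p (inject₁ i) ≡ u × p (Fin.suc i) ≡ v)
                         ⊎ (p (inject₁ i) ≡ v × p (Fin.suc i) ≡ u))

  record ISK4 : Set where
    field
      br     : Fin 4 → V
      br-inj : Injective _≡_ _≡_ br
      P      : (i j : Fin 4) → i Fin.< j → PathIn (br i) (br j)
      disj   : ∀ i j (h : i Fin.< j) i' j' (h' : i' Fin.< j') →
               ¬ (i ≡ i' × j ≡ j') → ∀ v →
               InteriorOf (P i j h) v → ¬ OnPath (P i' j' h') v
      induced : ∀ u v →
               (∃[ i ] ∃[ j ] ∃[ h ] OnPath (P i j h) u) →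
               (∃[ i ] ∃[ j ] ∃[ h ] OnPath (P i j h) v) →
               u ~ v → ∃[ i ] ∃[ j ] ∃[ h ] Consec (P i j h) u v

  ISK4-free : Set
  ISK4-free = ¬ ISK4

  record Prism : Set where
    field
      a b    : Fin 3 → V
      P      : (i : Fin 3) → PathIn (a i) (b i)
      len≥1  : ∀ i → 1 ≤ PathIn.len (P i)
      triA   : ∀ i j → i ≢ j → a i ~ a j
      triB   : ∀ i j → i ≢ j → b i ~ b j
      disj   : ∀ i j → i ≢ j → ∀ v → OnPath (P i) v → ¬ OnPath (P j) v
      induced : ∀ u v → (∃[ i ] OnPath (P i) u) → (∃[ i ] OnPath (P i) v) →
               u ~ v →
               (∃[ i ] Consec (P i) u v)
               ⊎ (∃[ i ] ∃[ j ] (u ≡ a i × v ≡ a j))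
               ⊎ (∃[ i ] ∃[ j ] (u ≡ b i × v ≡ b j))

  Prism-free : Set
  Prism-free = ¬ Prism

  record Diamond : Set where
    field
      u v c d : V
      c≢d : c ≢ d
      uv : u ~ v
      uc : u ~ c
      ud : u ~ d
      vc : v ~ c
      vd : v ~ d
      ¬cd : ¬ c ~ d

  Diamond-free : Set
  Diamond-free = ¬ Diamond

  record Bowtie : Set where
    field
      w : V
      a b : Fin 2 → V
      a-inj : Injective _≡_ _≡_ a
      b-inj : Injective _≡_ _≡_ b
      ab-dist : ∀ i j → a i ≢ b j
      wa : ∀ i → w ~ a i
      wb : ∀ i → w ~ b i
      aa : a Fin.zero ~ a (Fin.suc Fin.zero)
      bb : b Fin.zero ~ b (Fin.suc Fin.zero)
      ¬ab : ∀ i j → ¬ a i ~ b j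

  Bowtie-free : Set
  Bowtie-free = ¬ Bowtie

  record K33 : Set where
    field
      a b : Fin 3 → V
      a-inj : Injective _≡_ _≡_ a
      b-inj : Injective _≡_ _≡_ b
      ab : ∀ i j → a i ~ b j
      ¬aa : ∀ i j → ¬ a i ~ a j
      ¬bb : ∀ i j → ¬ b i ~ b j

  K33-free : Set
  K33-free = ¬ K33

  nbrCount : ∀ {k} → V → (Fin (suc k) → V) → ℕ
  nbrCount {k} v c = sum (map (λ t → if adj v (c t) then 1 else 0) (allFin (suc k)))

  record Hole : Set where
    field
      k     : ℕ
      3≤k   : 3 ≤ k
      cyc   : Fin (suc k) → V
      cyc-inj : Injective _≡_ _≡_ cyc
      chordless : ∀ i j → cyc i ~ cyc j → (j ≡ i ⊕ 1 ⊎ i ≡ j ⊕ 1)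
      cycle     : ∀ i → cyc i ~ cyc (i ⊕ 1)

  record Wheel : Set where
    field
      hole   : Hole
      center : V
    open Hole hole public
    field
      center∉C : ∀ t → cyc t ≢ center
      3spokes  : 3 ≤ nbrCount center cyc

  numSpokes : Wheel → ℕ
  numSpokes W = nbrCount center cyc where open Wheel W

  module _ (W : Wheel) where
    open Wheel W

    Spoke : Fin (suc k) → Set
    Spoke t = center ~ cyc t

    record Sector : Set where
      field
        start : Fin (suc k)
        d     : ℕ
        1≤d   : 1 ≤ d
        d≤k   : d ≤ k
        spoke-start : Spoke start
        spoke-end   : Spoke (start ⊕ d)
        no-spoke    : ∀ s → 1 ≤ s → s < d → ¬ Spoke (start ⊕ s)

    InSecIdx : Sector → Fin (suc k) → Set
    InSecIdx S t = ∃[ s ] (s ≤ Sector.d S × t ≡ Sector.start S ⊕ s)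

    InSec : Sector → V → Set
    InSec S v = ∃[ s ] (s ≤ Sector.d S × v ≡ cyc (Sector.start S ⊕ s))

    InInterior : Sector → V → Set
    InInterior S v = ∃[ s ] (1 ≤ s × s < Sector.d S × v ≡ cyc (Sector.start S ⊕ s))

    HasInterior : Sector → Set
    HasInterior S = 2 ≤ Sector.d S

    InWheel : V → Set
    InWheel v = v ≡ center ⊎ ∃[ t ] v ≡ cyc t

    ProperVertex : V → Set
    ProperVertex v = InWheel v
      ⊎ ((∃[ S ] ∀ t → v ~ cyc t → InSecIdx S t)
         × (3 ≤ nbrCount v cyc → v ~ center))

    Proper : Set
    Proper = ∀ v → ProperVertex v

  IsCenterOfProperWheel : V → Set
  IsCenterOfProperWheel x = ∃[ W ] (Wheel.center W ≡ x × Proper W)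

  -- Connectivity in G ∖ X: Reach X r v iff r, v ∉ X and there is a walk
  -- from r to v in G avoiding X.  The connected component of G ∖ X
  -- containing r (r ∉ X) is { v ∣ Reach X r v }.
  data Reach (X : V → Set) : V → V → Set where
    here : ∀ {v} → ¬ X v → Reach X v v
    step : ∀ {u w v} → ¬ X u → u ~ w → Reach X w v → Reach X u v

  N[_] : V → V → Set
  N[ x ] v = v ≡ x ⊎ x ~ v

  module _ (W : Wheel) where
    open Wheel W

    PartI : Set
    PartI = ∀ r → ¬ N[ center ] r →
      ∀ (S₁ S₂ : Sector W) → HasInterior W S₁ → HasInterior W S₂ →
      (∀ v → InInterior W S₁ v → Reach N[ center ] r v) →
      (∀ v → InInterior W S₂ v → Reach N[ center ] r v) →
      Sector.start S₁ ≡ Sector.start S₂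

    PartII : Set
    PartII = ∀ u → center ~ u →
      let X : V → Set
          X v = N[ center ] v × v ≢ u
          InD : Sector W → Set
          InD S = ∀ v → InInterior W S v → Reach X u v
      in (∀ (S₁ S₂ S₃ : Sector W) →
            HasInterior W S₁ → HasInterior W S₂ → HasInterior W S₃ →
            InD S₁ → InD S₂ → InD S₃ →
            Sector.start S₁ ≡ Sector.start S₂
            ⊎ Sector.start S₁ ≡ Sector.start S₃
            ⊎ Sector.start S₂ ≡ Sector.start S₃)
         × (∀ (S₁ S₂ : Sector W) →
            HasInterior W S₁ → HasInterior W S₂ →
            InD S₁ → InD S₂ →
            ∃[ v ] (InSec W S₁ v × InSec W S₂ v))

{-# OPTIONS --safe #-}
module Submission where

-- Rings are induced cycles, written as lists up to rotation; the neighbours of x on a ring are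
-- its spokes.  If x has exactly two neighbours on a ring besides e₀, and a leg from x to e₀ is
-- otherwise apart from the ring, then there is an ISK4; so every wheel has at least four spokes.
--
-- Let C be the rim of W, with m spokes.  The heart of the proof is that no ring A ++ O, with A an
-- arc of C and at most one spoke inside the path O, has at least 3 and fewer than m spokes.  Of
-- such rings take one with the fewest spokes, then the shortest.  Since W is proper, a vertex v
-- sees A in one sector, and the gaps between the neighbours of v, closed up through v, are rings
-- of the same kind; minimality, together with the absence of ISK4, diamond and bowtie, makes v
-- proper for the ring.  So the ring is the rim of a proper wheel, against the choice of W.
--
-- Consequently a walk off C and N[x] attaches to C within one sector: a shortest bad walk closes
-- up with both arcs of C to rings with at most two spokes each, hence m = 4, and then there is an
-- ISK4 or a prism.  This gives (i).  For (ii), two disjoint sectors reached from u ∉ C yield a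
-- ring through u, whose only spoke off C is u, with at least 3 and fewer than m spokes.

open import Defs
open import Data.Nat using (ℕ; zero; suc; _+_; _*_; _∸_; _≤_; _<_; z≤n; s≤s)
open import Data.Nat.Properties
open import Data.Nat.DivMod using (_%_; _/_; _mod_; m<n⇒m%n≡m; m≡m%n+[m/n]*n; [m+n]%n≡m%n; m%n<n; %-distribˡ-+; m%n%n≡m%n)
open import Data.Nat.ListAction using (sum)
open import Data.Fin as Fin using (Fin; toℕ; inject₁; fromℕ; fromℕ<)
open import Data.Fin.Patterns using (0F; 1F; 2F; 3F)
import Data.Fin.Properties as Finₚ
open import Data.Bool as Bool using (true; false; if_then_else_)
open import Data.List using (List; []; _∷_; _++_; length; reverse; tabulate)
open import Data.List.Properties using (++-assoc; ++-identityʳ; length-++; unfold-reverse; reverse-++; reverse-involutive; ∷-injectiveˡ; ∷-injectiveʳ; ∷ʳ-injectiveˡ; ∷ʳ-injectiveʳ; ++-cancelʳ; ++-conicalˡ; ++-conicalʳ; map-tabulate; tabulate-cong)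
open import Data.List.Membership.Propositional using (_∈_; _∉_)
open import Data.List.Membership.Propositional.Properties using (∈-++⁺ˡ; ∈-++⁺ʳ; ∈-++⁻; ∈-∃++)
open import Data.List.Relation.Unary.Any using (here; there)
open import Data.List.Relation.Unary.Any.Properties using (reverse⁺; reverse⁻)
open import Data.Product using (∃-syntax; _×_; _,_; proj₁; proj₂)
open import Data.Sum using (_⊎_; inj₁; inj₂; [_,_]′; swap)
open import Data.Empty using (⊥; ⊥-elim)
open import Function using (_∘_; id; case_of_)
open import Function.Definitions using (Injective)
open import Relation.Nullary using (¬_; Dec; yes; no)
open import Relation.Binary.PropositionalEquality using (_≡_; _≢_; refl; sym; trans; cong; cong₂; subst; subst₂)
open import Relation.Binary.Definitions using (tri<; tri≈; tri>)
open import Data.Nat.Tactic.RingSolver using (solve-∀)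

-- The obstacle is to argue by minimality and still use that `W` is proper, which controls a vertex
-- only along `C`. Hence the rings keep an arc `A` of `C`, and everything foreign sits in `O`. A gap
-- of `v` closes up to a ring of this kind if it runs from `A` into `O` or contains all of `A`,
-- except for trouble with a spoke at an end of `O`. Between the extreme neighbours of `v` on `A`
-- properness of `W` takes over, and between those on `O` thinness does. Unless `v` is proper
-- already, minimality leaves at most one spoke on such a gap when `x` is adjacent to `v`, since the
-- new ring gains `v` as a spoke, and at most two otherwise. The first bound contradicts the
-- existence of four spokes. Under the second, a gap with exactly two spokes gives a ring through
-- `v` with two spokes, and the next spoke beyond the gap starts a third leg of a subdivided `K_4`,
-- unless `x` sees the end of the gap or `v` has a triangle there. The one spoke allowed inside `O`
-- serves (ii), where it is `u`; the attachment of walks in (i) uses paths `O` without spokes.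

-- Concatenations of blocks and their right-nested normal form; `same t u refl` reassociates.
module Flatten {A : Set} where
  infixr 5 _⊹_ _◂_

  data Tm : Set where
    ⟨_⟩ : List A → Tm
    _◂_ : A → Tm → Tm
    _⊹_ : Tm → Tm → Tm

  ⟦_⟧ : Tm → List A
  ⟦ ⟨ l ⟩ ⟧ = l
  ⟦ a ◂ t ⟧ = a ∷ ⟦ t ⟧
  ⟦ t ⊹ u ⟧ = ⟦ t ⟧ ++ ⟦ u ⟧

  glue : Tm → List A → List A
  glue ⟨ l ⟩ k = l ++ k
  glue (a ◂ t) k = a ∷ glue t k
  glue (t ⊹ u) k = glue t (glue u k)

  nf : Tm → List A
  nf ⟨ l ⟩ = l
  nf (a ◂ t) = a ∷ nf t
  nf (t ⊹ u) = glue t (nf u)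

  glue-≡ : ∀ t k → ⟦ t ⟧ ++ k ≡ glue t k
  glue-≡ ⟨ l ⟩ k = refl
  glue-≡ (a ◂ t) k = cong (a ∷_) (glue-≡ t k)
  glue-≡ (t ⊹ u) k = trans (++-assoc ⟦ t ⟧ ⟦ u ⟧ k) (trans (cong (⟦ t ⟧ ++_) (glue-≡ u k)) (glue-≡ t (glue u k)))

  flat : ∀ t → ⟦ t ⟧ ≡ nf t
  flat ⟨ l ⟩ = refl
  flat (a ◂ t) = cong (a ∷_) (flat t)
  flat (t ⊹ u) = trans (cong (⟦ t ⟧ ++_) (flat u)) (glue-≡ t (nf u))

  same : ∀ t u → nf t ≡ nf u → ⟦ t ⟧ ≡ ⟦ u ⟧
  same t u e = trans (flat t) (trans e (sym (flat u)))

  rv : Tm → Tm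
  rv ⟨ l ⟩ = ⟨ reverse l ⟩
  rv (a ◂ t) = rv t ⊹ a ◂ ⟨ [] ⟩
  rv (t ⊹ u) = rv u ⊹ rv t

  rev-⟦⟧ : ∀ t → reverse ⟦ t ⟧ ≡ ⟦ rv t ⟧
  rev-⟦⟧ ⟨ l ⟩ = refl
  rev-⟦⟧ (a ◂ t) = trans (unfold-reverse a ⟦ t ⟧) (cong (_++ a ∷ []) (rev-⟦⟧ t))
  rev-⟦⟧ (t ⊹ u) = trans (reverse-++ ⟦ t ⟧ ⟦ u ⟧) (cong₂ _++_ (rev-⟦⟧ u) (rev-⟦⟧ t))

  rev-nf : ∀ t → reverse (nf t) ≡ nf (rv t)
  rev-nf t = trans (cong reverse (sym (flat t))) (trans (rev-⟦⟧ t) (flat (rv t)))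

open Flatten

-- Induced paths and induced cycles as lists; counting neighbours along them.

module Paths (G : Graph) where
  open Graph G using (n; adj; irrfl) renaming (sym to adj-sym)

  infix 4 _∼_ _#_

  _∼_ : V G → V G → Set
  u ∼ v = adj u v ≡ true

  ∼-sym : ∀ {u v} → u ∼ v → v ∼ u
  ∼-sym {u} {v} p = trans (adj-sym v u) p

  ∼-irrefl : ∀ {u v} → u ∼ v → u ≢ v
  ∼-irrefl {u} p refl with trans (sym p) (irrfl u)
  ... | ()

  _∼?_ : ∀ u v → Dec (u ∼ v)
  u ∼? v = adj u v Bool.≟ true

  _∈?_ : ∀ (v : V G) l → Dec (v ∈ l)
  v ∈? [] = no λ ()
  v ∈? (w ∷ l) with v Finₚ.≟ w | v ∈? l
  ... | yes refl | _      = yes (here refl)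
  ... | no _     | yes v∈ = yes (there v∈)
  ... | no v≢w   | no v∉  = no λ { (here e) → v≢w e ; (there v∈) → v∉ v∈ }

  _#_ : V G → V G → Set
  u # v = u ≢ v × ¬ u ∼ v

  #-sym : ∀ {u v} → u # v → v # u
  #-sym (p , q) = (λ e → p (sym e)) , (λ e → q (∼-sym e))

  Off : V G → List (V G) → Set
  Off v l = ∀ {w} → w ∈ l → v # w

  NoN : V G → List (V G) → Set
  NoN v l = ∀ {w} → w ∈ l → ¬ v ∼ w

  NoN-++ : ∀ {v} A {B} → NoN v A → NoN v B → NoN v (A ++ B)
  NoN-++ A p q w∈ with ∈-++⁻ A w∈
  ... | inj₁ i = p i
  ... | inj₂ i = q i

  NoN-∷ : ∀ {v a B} → ¬ v ∼ a → NoN v B → NoN v (a ∷ B)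
  NoN-∷ p q (here refl) = p
  NoN-∷ p q (there i) = q i

  NoN-[] : ∀ {v} → NoN v []
  NoN-[] ()

  Off-++ : ∀ {v} A {B} → Off v A → Off v B → Off v (A ++ B)
  Off-++ A p q w∈ with ∈-++⁻ A w∈
  ... | inj₁ i = p i
  ... | inj₂ i = q i

  Off-∷ : ∀ {v a B} → v # a → Off v B → Off v (a ∷ B)
  Off-∷ p q (here refl) = p
  Off-∷ p q (there i) = q i

  ∈-cast : ∀ {w : V G} {l l′} → l ≡ l′ → w ∈ l → w ∈ l′
  ∈-cast refl i = i

  ∈-rev : ∀ {w : V G} {l} → w ∈ reverse l → w ∈ l
  ∈-rev = reverse⁻

  rev-∷ : ∀ (a : V G) l → reverse (a ∷ l) ≡ reverse l ++ a ∷ []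
  rev-∷ = unfold-reverse

  rev-snoc : ∀ (l : List (V G)) a → reverse (l ++ a ∷ []) ≡ a ∷ reverse l
  rev-snoc l a = reverse-++ l (a ∷ [])

  rev-mid : ∀ (A : List (V G)) a B → reverse (A ++ a ∷ B) ≡ reverse B ++ a ∷ reverse A
  rev-mid A a B = trans (reverse-++ A (a ∷ B))
    (trans (cong (_++ reverse A) (rev-∷ a B)) (++-assoc (reverse B) (a ∷ []) (reverse A)))

  snoc-view : ∀ (a : V G) l → ∃[ i ] ∃[ b ] (a ∷ l ≡ i ++ b ∷ [])
  snoc-view a [] = [] , a , refl
  snoc-view a (b ∷ l) with snoc-view b l
  ... | i , c , e = a ∷ i , c , cong (a ∷_) e

  data IPath : List (V G) → Set where
    []   : IPath []
    [-]  : ∀ {a} → IPath (a ∷ [])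
    link : ∀ {a b p} → a ∼ b → Off a p → IPath (b ∷ p) → IPath (a ∷ b ∷ p)

  ip-tail : ∀ {a p} → IPath (a ∷ p) → IPath p
  ip-tail [-] = []
  ip-tail (link _ _ q) = q

  ip-++ʳ : ∀ A {B} → IPath (A ++ B) → IPath B
  ip-++ʳ [] q = q
  ip-++ʳ (a ∷ A) q = ip-++ʳ A (ip-tail q)

  ip-++ˡ : ∀ A {B} → IPath (A ++ B) → IPath A
  ip-++ˡ [] q = []
  ip-++ˡ (a ∷ []) q = [-]
  ip-++ˡ (a ∷ b ∷ A) (link e o q) = link e (λ i → o (∈-++⁺ˡ i)) (ip-++ˡ (b ∷ A) q)

  ip-join : ∀ A {a b B} → IPath (A ++ a ∷ []) → IPath (b ∷ B) → a ∼ b →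
    (∀ {u} → u ∈ A → Off u (b ∷ B)) → Off a B → IPath (A ++ a ∷ b ∷ B)
  ip-join [] p q e _ o = link e o q
  ip-join (c ∷ []) (link e' _ p) q e f o = link e' (f (here refl)) (link e o q)
  ip-join (c ∷ d ∷ A) {a} {b} {B} (link e' o' p) q e f o =
    link e' off (ip-join (d ∷ A) p q e (λ i → f (there i)) o)
    where
    off : Off c (A ++ a ∷ b ∷ B)
    off i with ∈-++⁻ A i
    ... | inj₁ j = o' (∈-++⁺ˡ j)
    ... | inj₂ (here refl) = o' (∈-++⁺ʳ A (here refl))
    ... | inj₂ (there j) = f (here refl) j

  ip-cross : ∀ A {a B u w} → IPath (A ++ a ∷ B) → u ∈ A → w ∈ B → u # w
  ip-cross (c ∷ []) (link _ o _) (here refl) j = o j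
  ip-cross (c ∷ d ∷ A) (link _ o _) (here refl) j = o (∈-++⁺ʳ A (there j))
  ip-cross (c ∷ d ∷ A) (link _ _ q) (there i) j = ip-cross (d ∷ A) q i j

  ip-adj : ∀ A {a b B} → IPath (A ++ a ∷ b ∷ B) → a ∼ b
  ip-adj A q with ip-++ʳ A q
  ... | link e _ _ = e

  ip-fresh : ∀ {a p} → IPath (a ∷ p) → a ∉ p
  ip-fresh (link e o q) (here refl) = ∼-irrefl e refl
  ip-fresh (link e o q) (there i) = proj₁ (o i) refl

  ip-reverse : ∀ {p} → IPath p → IPath (reverse p)
  ip-reverse [] = []
  ip-reverse [-] = [-]
  ip-reverse (link {a} {b} {p} e o q) =
    subst IPath (sym (trans (rev-∷ a (b ∷ p))
      (trans (cong (_++ a ∷ []) (rev-∷ b p)) (++-assoc (reverse p) _ _))))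
      (ip-join (reverse p) (subst IPath (rev-∷ b p) (ip-reverse q)) [-] (∼-sym e)
        (λ { i (here refl) → #-sym (o (∈-rev i)) }) (λ ()))

  -- Triangles are included (`M` empty), because a gap between adjacent neighbours of a vertex
  -- closes up to one. A ring with four spokes is a hole automatically.
  data Cyc : List (V G) → Set where
    mkCyc : ∀ {v a} M {b} → IPath (a ∷ M ++ b ∷ []) → v ∼ a → v ∼ b → Off v M →
          Cyc (v ∷ a ∷ M ++ b ∷ [])

  cyc-rot₁ : ∀ {v p} → Cyc (v ∷ p) → Cyc (p ++ v ∷ [])
  cyc-rot₁ (mkCyc {v} {a} [] {b} (link e _ q) va vb o) =
    mkCyc [] (link (∼-sym vb) (λ ()) [-]) e (∼-sym va) (λ ())
  cyc-rot₁ (mkCyc {v} {a} (c ∷ M) {b} (link e of q) va vb o) =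
    mkCyc (M ++ b ∷ [])
      (subst (λ l → IPath (c ∷ l)) (sym (++-assoc M (b ∷ []) (v ∷ [])))
        (ip-join (c ∷ M) q [-] (∼-sym vb) (λ { i (here refl) → #-sym (o i) }) (λ ())))
      e (∼-sym va) of

  cyc-rot : ∀ A {B} → Cyc (A ++ B) → Cyc (B ++ A)
  cyc-rot [] {B} c = subst Cyc (sym (++-identityʳ B)) c
  cyc-rot (a ∷ A) {B} c = subst Cyc (++-assoc B (a ∷ []) A)
    (cyc-rot A (subst Cyc (++-assoc A B (a ∷ [])) (cyc-rot₁ c)))

  cyc-tail : ∀ {v p} → Cyc (v ∷ p) → IPath p
  cyc-tail (mkCyc M q _ _ _) = q

  cyc-arc : ∀ A {B w} → w ∈ B → Cyc (A ++ B) → IPath A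
  cyc-arc A {b ∷ B} _ c = ip-++ʳ B (cyc-tail (cyc-rot A c))

  cyc-fresh : ∀ {v p} → Cyc (v ∷ p) → v ∉ p
  cyc-fresh (mkCyc M q va vb o) (here refl) = ∼-irrefl va refl
  cyc-fresh (mkCyc M q va vb o) (there i) with ∈-++⁻ M i
  ... | inj₁ j = proj₁ (o j) refl
  ... | inj₂ (here refl) = ∼-irrefl vb refl

  cyc-reverse : ∀ {p} → Cyc p → Cyc (reverse p)
  cyc-reverse (mkCyc {v} {a} M {b} q va vb o) =
    subst Cyc (sym (rev-∷ v (a ∷ M ++ b ∷ [])))
      (cyc-rot₁ (subst (λ l → Cyc (v ∷ l)) (sym eq)
        (mkCyc (reverse M) (subst IPath eq (ip-reverse q)) vb va (λ i → o (∈-rev i)))))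
    where
    eq : reverse (a ∷ M ++ b ∷ []) ≡ b ∷ reverse M ++ a ∷ []
    eq = trans (rev-∷ a (M ++ b ∷ [])) (cong (_++ a ∷ []) (rev-snoc M b))

  cyc-adj : ∀ {a b B} → Cyc (a ∷ b ∷ B) → a ∼ b
  cyc-adj (mkCyc M _ va _ _) = va

  cyc-adj-at : ∀ A {a b B} → Cyc (A ++ a ∷ b ∷ B) → a ∼ b
  cyc-adj-at A c = cyc-adj (cyc-rot A c)

  cyc-close : ∀ {a} A {b} → Cyc (a ∷ A ++ b ∷ []) → a ∼ b
  cyc-close {a} A {b} c = ∼-sym (cyc-adj (cyc-rot (a ∷ A) c))

  cyc-apart : ∀ {a c} A {b d B} → Cyc (a ∷ c ∷ A ++ b ∷ d ∷ B) → a # b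
  cyc-apart {a} {c} A {b} {d} {B} k with snoc-view d B
  ... | i , z , e = off (subst (λ l → Cyc (a ∷ c ∷ l))
                      (trans (cong (λ l → A ++ b ∷ l) e) (sym (++-assoc A (b ∷ i) (z ∷ [])))) k)
    where
    off′ : ∀ {l} → Cyc (a ∷ c ∷ l) → l ≡ (A ++ b ∷ i) ++ z ∷ [] → a # b
    off′ (mkCyc M _ _ _ o) e' = o (subst (b ∈_) (sym (∷ʳ-injectiveˡ M (A ++ b ∷ i) e')) (∈-++⁺ʳ A (here refl)))
    off : Cyc (a ∷ c ∷ (A ++ b ∷ i) ++ z ∷ []) → a # b
    off k = off′ k refl

  cyc-nbr : ∀ {v} L {y T} → Cyc (v ∷ L ++ y ∷ T) → v ∼ y → L ≡ [] ⊎ T ≡ []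
  cyc-nbr [] k e = inj₁ refl
  cyc-nbr (c ∷ L) {T = []} k e = inj₂ refl
  cyc-nbr (c ∷ L) {T = d ∷ T} k e = ⊥-elim (proj₂ (cyc-apart L k) e)

  -- A chain of single turns, so that inducedness, membership, counts and length are carried along
  -- by induction on it.
  data Rot : List (V G) → List (V G) → Set where
    done : ∀ {l} → Rot l l
    turn : ∀ {v p l} → Rot (p ++ v ∷ []) l → Rot (v ∷ p) l

  rot-trans : ∀ {a b c} → Rot a b → Rot b c → Rot a c
  rot-trans done q = q
  rot-trans (turn p) q = turn (rot-trans p q)

  rot-swap : ∀ A {B} → Rot (A ++ B) (B ++ A)
  rot-swap [] {B} = subst (Rot B) (sym (++-identityʳ B)) done
  rot-swap (a ∷ A) {B} = turn (subst₂ Rot (sym (++-assoc A B (a ∷ []))) (++-assoc B (a ∷ []) A)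
    (rot-swap A))

  -- Both ends are normal forms, so they compute to right-nested concatenations and most uses need
  -- no reassociation.
  rot-turn : ∀ s t → Rot (nf (s ⊹ t)) (nf (t ⊹ s))
  rot-turn s t = subst₂ Rot (flat (s ⊹ t)) (flat (t ⊹ s)) (rot-swap ⟦ s ⟧)

  rot-cyc : ∀ {a b} → Rot a b → Cyc a → Cyc b
  rot-cyc done c = c
  rot-cyc (turn r) c = rot-cyc r (cyc-rot₁ c)

  rot-∈ : ∀ {a b w} → Rot a b → w ∈ a → w ∈ b
  rot-∈ done i = i
  rot-∈ (turn {v} {p} r) (here refl) = rot-∈ r (∈-++⁺ʳ p (here refl))
  rot-∈ (turn r) (there i) = rot-∈ r (∈-++⁺ˡ i)

  rot-∈⁻ : ∀ {a b w} → Rot a b → w ∈ b → w ∈ a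
  rot-∈⁻ done i = i
  rot-∈⁻ (turn {v} {p} r) i with ∈-++⁻ p (rot-∈⁻ r i)
  ... | inj₁ j = there j
  ... | inj₂ (here refl) = here refl

  cnt : V G → List (V G) → ℕ
  cnt v [] = 0
  cnt v (w ∷ l) = (if adj v w then 1 else 0) + cnt v l

  cnt-++ : ∀ v A {B} → cnt v (A ++ B) ≡ cnt v A + cnt v B
  cnt-++ v [] = refl
  cnt-++ v (a ∷ A) {B} = trans (cong (_ +_) (cnt-++ v A)) (sym (+-assoc (if adj v a then 1 else 0) (cnt v A) (cnt v B)))

  cnt-yes : ∀ {v w} l → v ∼ w → cnt v (w ∷ l) ≡ suc (cnt v l)
  cnt-yes l e rewrite e = refl

  cnt-no : ∀ {v w} l → ¬ v ∼ w → cnt v (w ∷ l) ≡ cnt v l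
  cnt-no {v} {w} l e with adj v w
  ... | true = ⊥-elim (e refl)
  ... | false = refl

  cnt-∷≤ : ∀ v w l → cnt v (w ∷ l) ≤ suc (cnt v l)
  cnt-∷≤ v w l with adj v w
  ... | true = ≤-refl
  ... | false = n≤1+n _

  cnt-∷≥ : ∀ v w l → cnt v l ≤ cnt v (w ∷ l)
  cnt-∷≥ v w l = m≤n+m _ _

  cnt-none : ∀ {v} l → NoN v l → cnt v l ≡ 0
  cnt-none [] f = refl
  cnt-none (w ∷ l) f = trans (cnt-no l (f (here refl))) (cnt-none l (λ i → f (there i)))

  cnt-zero : ∀ {v} l → cnt v l ≡ 0 → NoN v l
  cnt-zero {v} (w ∷ l) e (here refl) p with trans (sym (cnt-yes l p)) e
  ... | ()
  cnt-zero {v} (w ∷ l) e (there i) p = cnt-zero l (m+n≡0⇒n≡0 (if adj v w then 1 else 0) e) i p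

  cnt-∷ : ∀ v w l → cnt v (w ∷ l) ≡ cnt v (w ∷ []) + cnt v l
  cnt-∷ v w l = cnt-++ v (w ∷ []) {l}

  cnt-skip : ∀ {v} A {B} → NoN v A → cnt v (A ++ B) ≡ cnt v B
  cnt-skip {v} A {B} f = trans (cnt-++ v A) (cong (_+ cnt v B) (cnt-none A f))

  cnt-≤length : ∀ v l → cnt v l ≤ length l
  cnt-≤length v [] = z≤n
  cnt-≤length v (w ∷ l) = ≤-trans (cnt-∷≤ v w l) (s≤s (cnt-≤length v l))

  cnt-swap : ∀ v A {B} → cnt v (A ++ B) ≡ cnt v (B ++ A)
  cnt-swap v A {B} = trans (cnt-++ v A) (trans (+-comm (cnt v A) (cnt v B)) (sym (cnt-++ v B)))

  cnt-rot : ∀ {a b} v → Rot a b → cnt v a ≡ cnt v b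
  cnt-rot v done = refl
  cnt-rot v (turn {w} {p} r) = trans (cnt-swap v (w ∷ []) {p}) (cnt-rot v r)

  length-rot : ∀ {a b} → Rot a b → length a ≡ length b
  length-rot done = refl
  length-rot (turn {w} {p} r) = trans (trans (+-comm 1 (length p)) (sym (length-++ p))) (length-rot r)

  cnt-reverse : ∀ v l → cnt v (reverse l) ≡ cnt v l
  cnt-reverse v [] = refl
  cnt-reverse v (w ∷ l) = trans (cong (cnt v) (rev-∷ w l))
    (trans (cnt-swap v (reverse l)) (cong (_ +_) (cnt-reverse v l)))

  first : ∀ v l → NoN v l ⊎ ∃[ A ] ∃[ w ] ∃[ B ] (l ≡ A ++ w ∷ B × NoN v A × v ∼ w)
  first v [] = inj₁ λ ()
  first v (w ∷ l) with v ∼? w | first v l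
  ... | yes p | _ = inj₂ ([] , w , l , refl , (λ ()) , p)
  ... | no p | inj₁ q = inj₁ (NoN-∷ p q)
  ... | no p | inj₂ (A , u , B , e , f , a) = inj₂ (w ∷ A , u , B , cong (w ∷_) e , NoN-∷ p f , a)

  last : ∀ v l → NoN v l ⊎ ∃[ A ] ∃[ w ] ∃[ B ] (l ≡ A ++ w ∷ B × NoN v B × v ∼ w)
  last v [] = inj₁ λ ()
  last v (w ∷ l) with last v l
  ... | inj₂ (A , u , B , e , f , a) = inj₂ (w ∷ A , u , B , cong (w ∷_) e , f , a)
  ... | inj₁ q with v ∼? w
  ... | yes p = inj₂ ([] , w , l , refl , q , p)
  ... | no p = inj₁ (NoN-∷ p q)

  first-of : ∀ v l {k} → cnt v l ≡ suc k →
    ∃[ A ] ∃[ w ] ∃[ B ] (l ≡ A ++ w ∷ B × NoN v A × v ∼ w × cnt v B ≡ k)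
  first-of v l e with first v l
  ... | inj₁ f with trans (sym (cnt-none l f)) e
  ... | ()
  first-of v l {k} e | inj₂ (A , w , B , refl , f , a) =
    A , w , B , refl , f , a , suc-injective (trans (sym (cnt-yes B a))
      (trans (sym (cong (_+ cnt v (w ∷ B)) (cnt-none A f))) (trans (sym (cnt-++ v A)) e)))

  -- `M` is everything but the last entry, and the nonempty rest `e ∷ D` keeps `X` away from that
  -- entry.
  ∈-front : ∀ X {e} {D : List (V G)} M {g w} → X ++ e ∷ D ≡ M ++ g ∷ [] → w ∈ X → w ∈ M
  ∈-front (c ∷ []) [] () _
  ∈-front (c ∷ _ ∷ _) [] () _
  ∈-front (c ∷ X) (m ∷ M) eq (here refl) = here (∷-injectiveˡ eq)
  ∈-front (c ∷ X) (m ∷ M) eq (there i) = there (∈-front X M (∷-injectiveʳ eq) i)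

  ∈-inner : ∀ A {s} B {e D g} M {g′ w} → A ++ s ∷ B ++ e ∷ D ≡ g ∷ M ++ g′ ∷ [] → w ∈ B → w ∈ M
  ∈-inner [] B M eq i = ∈-front B M (∷-injectiveʳ eq) i
  ∈-inner (a ∷ A) {s} B M eq i =
    ∈-front (A ++ s ∷ B) M (trans (++-assoc A (s ∷ B) _) (∷-injectiveʳ eq)) (∈-++⁺ʳ A (there i))

  -- Two marked positions of one list are compared without indices; this is how two spokes or
  -- neighbours on an arc get ordered.
  ∈-tails : ∀ X {y : V G} {α} B {s A} → X ++ y ∷ α ≡ B ++ s ∷ A → s ∈ α ⊎ y ∈ s ∷ A
  ∈-tails [] [] e = inj₂ (here (∷-injectiveˡ e))
  ∈-tails [] (b ∷ B) refl = inj₁ (∈-++⁺ʳ B (here refl))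
  ∈-tails (c ∷ X) {y} {α} [] e = inj₂ (∈-cast e (there (∈-++⁺ʳ X (here refl))))
  ∈-tails (c ∷ X) (b ∷ B) e = ∈-tails X B (∷-injectiveʳ e)

  split-before : ∀ O {q : V G} {β} A {s B} → O ++ q ∷ β ≡ A ++ s ∷ B → q ∉ A ++ s ∷ [] →
    ∃[ O₂ ] (O ≡ A ++ s ∷ O₂ × B ≡ O₂ ++ q ∷ β)
  split-before [] [] e q∉ = ⊥-elim (q∉ (here (∷-injectiveˡ e)))
  split-before [] (a ∷ A) e q∉ = ⊥-elim (q∉ (here (∷-injectiveˡ e)))
  split-before (o ∷ O) [] refl q∉ = O , refl , refl
  split-before (o ∷ O) (a ∷ A) e q∉ with split-before O A (∷-injectiveʳ e) (λ i → q∉ (there i))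
  ... | O₂ , e₁ , e₂ = O₂ , cong₂ _∷_ (∷-injectiveˡ e) e₁ , e₂

  cnt-1 : ∀ {v w} → v ∼ w → cnt v (w ∷ []) ≡ 1
  cnt-1 e = cnt-yes [] e

  cnt-0 : ∀ {v w} → ¬ v ∼ w → cnt v (w ∷ []) ≡ 0
  cnt-0 e = cnt-no [] e

  -- All neighbours of v on the ring l lie in the arc g′ U g, which has no spoke of x inside.
  Good : V G → List (V G) → V G → Set
  Good x l v = ∃[ g ] ∃[ M ] ∃[ g′ ] ∃[ U ]
    (Rot l (g ∷ M ++ g′ ∷ U) × NoN v M × NoN x U × (x ∼ v ⊎ NoN v U))

-- Subdivisions of `K_4` formed by a ring and a vertex with three legs to it.

module Hub (G : Graph) where
  open Paths G

  nth : (a : V G) (I : List (V G)) (b : V G) → Fin (suc (suc (length I))) → V G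
  nth a I b Fin.zero = a
  nth a [] b (Fin.suc i) = b
  nth a (c ∷ I) b (Fin.suc i) = nth c I b i

  nth-∈ : ∀ a I b i → nth a I b i ∈ a ∷ I ++ b ∷ []
  nth-∈ a I b Fin.zero = here refl
  nth-∈ a [] b (Fin.suc i) = there (here refl)
  nth-∈ a (c ∷ I) b (Fin.suc i) = there (nth-∈ c I b i)

  nth-end : ∀ a I b → nth a I b (fromℕ (suc (length I))) ≡ b
  nth-end a [] b = refl
  nth-end a (c ∷ I) b = nth-end c I b

  nth-edge : ∀ a I b → IPath (a ∷ I ++ b ∷ []) → ∀ (i : Fin (suc (length I))) →
    nth a I b (inject₁ i) ∼ nth a I b (Fin.suc i)
  nth-edge a [] b (link e _ _) Fin.zero = e
  nth-edge a (c ∷ I) b (link e _ _) Fin.zero = e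
  nth-edge a (c ∷ I) b (link _ _ q) (Fin.suc i) = nth-edge c I b q i

  nth-inj : ∀ a I b → IPath (a ∷ I ++ b ∷ []) → Injective _≡_ _≡_ (nth a I b)
  nth-inj a I b q {Fin.zero} {Fin.zero} e = refl
  nth-inj a [] b q {Fin.zero} {Fin.suc j} e = ⊥-elim (ip-fresh q (here e))
  nth-inj a (c ∷ I) b q {Fin.zero} {Fin.suc j} e = ⊥-elim (ip-fresh q (subst (_∈ _) (sym e) (nth-∈ c I b j)))
  nth-inj a [] b q {Fin.suc i} {Fin.zero} e = ⊥-elim (ip-fresh q (here (sym e)))
  nth-inj a (c ∷ I) b q {Fin.suc i} {Fin.zero} e = ⊥-elim (ip-fresh q (subst (_∈ _) e (nth-∈ c I b i)))
  nth-inj a [] b q {Fin.suc Fin.zero} {Fin.suc Fin.zero} e = refl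
  nth-inj a (c ∷ I) b (link _ _ q) {Fin.suc i} {Fin.suc j} e = cong Fin.suc (nth-inj c I b q e)

  toPath : ∀ a I b → IPath (a ∷ I ++ b ∷ []) → PathIn G a b
  toPath a I b q = record
    { len = suc (length I) ; p = nth a I b ; p-inj = nth-inj a I b q
    ; start = refl ; end = nth-end a I b ; edges = nth-edge a I b q }

  onPath : ∀ a I b q {v} → OnPath G (toPath a I b q) v → v ∈ a ∷ I ++ b ∷ []
  onPath a I b q (i , refl) = nth-∈ a I b i

  nth-interior : ∀ a I b i → i ≢ Fin.zero → i ≢ fromℕ (suc (length I)) → nth a I b i ∈ I
  nth-interior a I b Fin.zero z l = ⊥-elim (z refl)
  nth-interior a [] b (Fin.suc Fin.zero) z l = ⊥-elim (l refl)
  nth-interior a (c ∷ I) b (Fin.suc Fin.zero) z l = here refl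
  nth-interior a (c ∷ I) b (Fin.suc (Fin.suc i)) z l =
    there (nth-interior c I b (Fin.suc i) (λ ()) (λ e → l (cong Fin.suc e)))

  interiorOf : ∀ a I b q {v} → InteriorOf G (toPath a I b q) v → v ∈ I
  interiorOf a I b q (i , refl , z , l) = nth-interior a I b i z l

  data Next : List (V G) → V G → V G → Set where
    now   : ∀ {u v l} → Next (u ∷ v ∷ l) u v
    later : ∀ {a u v l} → Next l u v → Next (a ∷ l) u v

  Near : List (V G) → V G → V G → Set
  Near l u v = Next l u v ⊎ Next l v u

  next-nth : ∀ a I b {u v} → Next (a ∷ I ++ b ∷ []) u v →
    ∃[ i ] (nth a I b (inject₁ i) ≡ u × nth a I b (Fin.suc i) ≡ v)
  next-nth a [] b now = Fin.zero , refl , refl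
  next-nth a [] b (later (later ()))
  next-nth a (c ∷ I) b now = Fin.zero , refl , refl
  next-nth a (c ∷ I) b (later k) with next-nth c I b k
  ... | i , p , q = Fin.suc i , p , q

  near-consec : ∀ a I b q {u v} → Near (a ∷ I ++ b ∷ []) u v → Consec G (toPath a I b q) u v
  near-consec a I b q (inj₁ k) with next-nth a I b k
  ... | i , e = i , inj₁ e
  near-consec a I b q (inj₂ k) with next-nth a I b k
  ... | i , e = i , inj₂ e

  near-sym : ∀ {l u v} → Near l u v → Near l v u
  near-sym (inj₁ k) = inj₂ k
  near-sym (inj₂ k) = inj₁ k

  near-later : ∀ {a l u v} → Near l u v → Near (a ∷ l) u v
  near-later (inj₁ k) = inj₁ (later k)
  near-later (inj₂ k) = inj₂ (later k)

  next-++ˡ : ∀ {A B u v} → Next A u v → Next (A ++ B) u v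
  next-++ˡ now = now
  next-++ˡ (later k) = later (next-++ˡ k)

  next-++ʳ : ∀ A {B u v} → Next B u v → Next (A ++ B) u v
  next-++ʳ [] k = k
  next-++ʳ (a ∷ A) k = later (next-++ʳ A k)

  near-++ˡ : ∀ {A B u v} → Near A u v → Near (A ++ B) u v
  near-++ˡ (inj₁ k) = inj₁ (next-++ˡ k)
  near-++ˡ (inj₂ k) = inj₂ (next-++ˡ k)

  next-split : ∀ A {e B u v} → Next (A ++ e ∷ B) u v → Next (A ++ e ∷ []) u v ⊎ Next (e ∷ B) u v
  next-split [] k = inj₂ k
  next-split (a ∷ []) now = inj₁ now
  next-split (a ∷ b ∷ A) now = inj₁ now
  next-split (a ∷ A) (later k) with next-split A k
  ... | inj₁ j = inj₁ (later j)
  ... | inj₂ j = inj₂ j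

  near-split : ∀ A {e B u v} → Near (A ++ e ∷ B) u v → Near (A ++ e ∷ []) u v ⊎ Near (e ∷ B) u v
  near-split A (inj₁ k) with next-split A k
  ... | inj₁ j = inj₁ (inj₁ j)
  ... | inj₂ j = inj₂ (inj₁ j)
  near-split A (inj₂ k) with next-split A k
  ... | inj₁ j = inj₁ (inj₂ j)
  ... | inj₂ j = inj₂ (inj₂ j)

  next-reverse : ∀ {l u v} → Next l u v → Next (reverse l) v u
  next-reverse {u ∷ v ∷ l} now =
    subst (λ t → Next t v u) (sym (trans (rev-∷ u (v ∷ l)) (trans (cong (_++ u ∷ []) (rev-∷ v l))
      (++-assoc (reverse l) _ _)))) (next-++ʳ (reverse l) now)
  next-reverse {a ∷ l} {u} {v} (later k) =
    subst (λ t → Next t v u) (sym (rev-∷ a l)) (next-++ˡ (next-reverse k))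

  near-reverse : ∀ {l u v} → Near l u v → Near (reverse l) u v
  near-reverse (inj₁ k) = inj₂ (next-reverse k)
  near-reverse (inj₂ k) = inj₁ (next-reverse k)

  ip-near : ∀ {p u v} → IPath p → u ∈ p → v ∈ p → u ∼ v → Near p u v
  ip-near q (here refl) (here refl) e = ⊥-elim (∼-irrefl e refl)
  ip-near (link _ o q) (here refl) (there (here refl)) e = inj₁ now
  ip-near (link _ o q) (here refl) (there (there j)) e = ⊥-elim (proj₂ (o j) e)
  ip-near (link _ o q) (there (here refl)) (here refl) e = inj₂ now
  ip-near (link _ o q) (there (there i)) (here refl) e = ⊥-elim (proj₂ (o i) (∼-sym e))
  ip-near q (there i) (there j) e = near-later (ip-near (ip-tail q) i j e)

  next-snoc : ∀ A {b v : V G} → Next (A ++ b ∷ v ∷ []) b v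
  next-snoc A = next-++ʳ A now

  cyc-near-head : ∀ {v p w} → Cyc (v ∷ p) → w ∈ p → v ∼ w → Near (v ∷ p ++ v ∷ []) v w
  cyc-near-head (mkCyc M q va vb o) (here refl) e = inj₁ now
  cyc-near-head (mkCyc {v} {a} M {b} q va vb o) (there i) e with ∈-++⁻ M i
  ... | inj₁ j = ⊥-elim (proj₂ (o j) e)
  ... | inj₂ (here refl) = inj₂ (subst (λ t → Next (v ∷ a ∷ t) b v) (sym (++-assoc M (b ∷ []) (v ∷ [])))
                                 (later (later (next-snoc M))))

  cyc-near : ∀ {v p u w} → Cyc (v ∷ p) → u ∈ v ∷ p → w ∈ v ∷ p → u ∼ w → Near (v ∷ p ++ v ∷ []) u w
  cyc-near c (here refl) (here refl) e = ⊥-elim (∼-irrefl e refl)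
  cyc-near c (here refl) (there j) e = cyc-near-head c j e
  cyc-near c (there i) (here refl) e = near-sym (cyc-near-head c i (∼-sym e))
  cyc-near c (there i) (there j) e = near-later (near-++ˡ (ip-near (cyc-tail c) i j e))

  ip-disjoint : ∀ A {B w} → IPath (A ++ B) → w ∈ A → w ∉ B
  ip-disjoint (a ∷ A) q (here refl) j = ip-fresh q (∈-++⁺ʳ A j)
  ip-disjoint (a ∷ A) q (there i) j = ip-disjoint A (ip-tail q) i j

  module _ {x e₀ e₁ e₂ : V G} {D A E L : List (V G)}
    (ring : Cyc (e₀ ∷ D ++ e₁ ∷ A ++ e₂ ∷ E))
    (x∉ : x ∉ D ++ e₁ ∷ A ++ e₂ ∷ E)
    (x₁ : x ∼ e₁) (x₂ : x ∼ e₂) (nD : NoN x D) (nA : NoN x A) (nE : NoN x E)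
    (leg : IPath (x ∷ L ++ e₀ ∷ []))
    (legOff : ∀ {l} → l ∈ L → Off l (D ++ e₁ ∷ A ++ e₂ ∷ E))
    where

    private
      p : List (V G)
      p = D ++ e₁ ∷ A ++ e₂ ∷ E

      ipp : IPath p
      ipp = cyc-tail ring

      inD : ∀ {w} → w ∈ D → w ∈ p
      inD i = ∈-++⁺ˡ i
      in₁ : e₁ ∈ p
      in₁ = ∈-++⁺ʳ D (here refl)
      inA : ∀ {w} → w ∈ A → w ∈ p
      inA i = ∈-++⁺ʳ D (there (∈-++⁺ˡ i))
      in₂ : e₂ ∈ p
      in₂ = ∈-++⁺ʳ D (there (∈-++⁺ʳ A (here refl)))
      inE : ∀ {w} → w ∈ E → w ∈ p
      inE i = ∈-++⁺ʳ D (there (∈-++⁺ʳ A (there i)))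

      x≢p : ∀ {w} → w ∈ p → w ≢ x
      x≢p i refl = x∉ i

      e₀≢p : ∀ {w} → w ∈ p → w ≢ e₀
      e₀≢p i refl = cyc-fresh ring i

      x≢e₀ : x ≢ e₀
      x≢e₀ refl = ip-fresh leg (∈-++⁺ʳ L (here refl))

      L≢x : ∀ {w} → w ∈ L → w ≢ x
      L≢x i refl = ip-fresh leg (∈-++⁺ˡ i)

      L≢e₀ : ∀ {w} → w ∈ L → w ≢ e₀
      L≢e₀ i refl = ip-disjoint L (ip-tail leg) i (here refl)

      L≢p : ∀ {w u} → w ∈ L → u ∈ p → w ≢ u
      L≢p i j = proj₁ (legOff i j)

      D≢ : ∀ {w} → w ∈ D → w ∉ e₁ ∷ A ++ e₂ ∷ E
      D≢ = ip-disjoint D ipp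
      ipA : IPath (e₁ ∷ A ++ e₂ ∷ E)
      ipA = ip-++ʳ D ipp
      ₁≢ : e₁ ∉ A ++ e₂ ∷ E
      ₁≢ = ip-fresh ipA
      A≢ : ∀ {w} → w ∈ A → w ∉ e₂ ∷ E
      A≢ = ip-disjoint A (ip-tail ipA)
      ipE : IPath (e₂ ∷ E)
      ipE = ip-++ʳ A (ip-tail ipA)
      E≢ : ∀ {w} → w ∈ E → w ≢ e₂
      E≢ i refl = ip-fresh ipE i
      ₂≢₁ : e₁ ≢ e₂
      ₂≢₁ refl = ₁≢ (∈-++⁺ʳ A (here refl))

      -- The branch vertices: `D`, `A` and `E` join the three ring vertices pairwise, and the leg
      -- and two edges join `x` to them.
      br : Fin 4 → V G
      br 0F = x
      br 1F = e₀
      br 2F = e₁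
      br 3F = e₂

      br-inj : Injective _≡_ _≡_ br
      br-inj {0F} {0F} e = refl
      br-inj {0F} {1F} e = ⊥-elim (x≢e₀ e)
      br-inj {0F} {2F} e = ⊥-elim (∼-irrefl x₁ e)
      br-inj {0F} {3F} e = ⊥-elim (∼-irrefl x₂ e)
      br-inj {1F} {0F} e = ⊥-elim (x≢e₀ (sym e))
      br-inj {1F} {1F} e = refl
      br-inj {1F} {2F} e = ⊥-elim (e₀≢p in₁ (sym e))
      br-inj {1F} {3F} e = ⊥-elim (e₀≢p in₂ (sym e))
      br-inj {2F} {0F} e = ⊥-elim (∼-irrefl x₁ (sym e))
      br-inj {2F} {1F} e = ⊥-elim (e₀≢p in₁ e)
      br-inj {2F} {2F} e = refl
      br-inj {2F} {3F} e = ⊥-elim (₂≢₁ e)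
      br-inj {3F} {0F} e = ⊥-elim (∼-irrefl x₂ (sym e))
      br-inj {3F} {1F} e = ⊥-elim (e₀≢p in₂ e)
      br-inj {3F} {2F} e = ⊥-elim (₂≢₁ (sym e))
      br-inj {3F} {3F} e = refl

      -- The six pairs as a datatype, so that the case analyses below do not meet the impossible
      -- instances of `i Fin.< j`.
      data Edge : Fin 4 → Fin 4 → Set where
        x-0 : Edge 0F 1F
        x-1 : Edge 0F 2F
        x-2 : Edge 0F 3F
        0-1 : Edge 1F 2F
        0-2 : Edge 1F 3F
        1-2 : Edge 2F 3F

      edge : ∀ i j → i Fin.< j → Edge i j
      edge 0F 1F h = x-0
      edge 0F 2F h = x-1
      edge 0F 3F h = x-2
      edge 1F 1F (s≤s ())
      edge 1F 2F h = 0-1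
      edge 1F 3F h = 0-2
      edge 2F 1F (s≤s ())
      edge 2F 2F (s≤s (s≤s ()))
      edge 2F 3F h = 1-2
      edge 3F 1F (s≤s ())
      edge 3F 2F (s≤s (s≤s ()))
      edge 3F 3F (s≤s (s≤s (s≤s ())))

      int : ∀ {i j} → Edge i j → List (V G)
      int x-0 = L
      int x-1 = []
      int x-2 = []
      int 0-1 = D
      int 0-2 = reverse E
      int 1-2 = A

      tailArc : reverse (e₂ ∷ E ++ e₀ ∷ []) ≡ e₀ ∷ reverse E ++ e₂ ∷ []
      tailArc = trans (rev-∷ e₂ (E ++ e₀ ∷ [])) (cong (_++ e₂ ∷ []) (rev-snoc E e₀))

      ipath : ∀ {i j} (e : Edge i j) → IPath (br i ∷ int e ++ br j ∷ [])
      ipath x-0 = leg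
      ipath x-1 = link x₁ (λ ()) [-]
      ipath x-2 = link x₂ (λ ()) [-]
      ipath 0-1 = cyc-arc (e₀ ∷ D ++ e₁ ∷ []) (∈-++⁺ʳ A (here refl))
        (subst Cyc (cong (e₀ ∷_) (sym (++-assoc D (e₁ ∷ []) _))) ring)
      ipath 0-2 = subst IPath tailArc (ip-reverse (cyc-arc (e₂ ∷ E ++ e₀ ∷ []) (∈-++⁺ʳ D (here refl))
        (subst Cyc (cong (e₂ ∷_) (sym (++-assoc E (e₀ ∷ []) _)))
          (cyc-rot (e₀ ∷ D ++ e₁ ∷ A) (subst Cyc (cong (e₀ ∷_) (sym (++-assoc D (e₁ ∷ A) _))) ring)))))
      ipath 1-2 = ip-++ˡ (e₁ ∷ A ++ e₂ ∷ []) {E} (subst IPath (cong (e₁ ∷_) (sym (++-assoc A (e₂ ∷ []) E))) ipA)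

      int-br : ∀ {i j} (e : Edge i j) k {w} → w ∈ int e → w ≢ br k
      int-br x-0 0F i = L≢x i
      int-br x-0 1F i = L≢e₀ i
      int-br x-0 2F i = L≢p i in₁
      int-br x-0 3F i = L≢p i in₂
      int-br 0-1 0F i = x≢p (inD i)
      int-br 0-1 1F i = e₀≢p (inD i)
      int-br 0-1 2F i refl = D≢ i (here refl)
      int-br 0-1 3F i refl = D≢ i (there (∈-++⁺ʳ A (here refl)))
      int-br 0-2 0F i = x≢p (inE (∈-rev i))
      int-br 0-2 1F i = e₀≢p (inE (∈-rev i))
      int-br 0-2 2F i refl = ₁≢ (∈-++⁺ʳ A (there (∈-rev i)))
      int-br 0-2 3F i = E≢ (∈-rev i)
      int-br 1-2 0F i = x≢p (inA i)
      int-br 1-2 1F i = e₀≢p (inA i)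
      int-br 1-2 2F i refl = ₁≢ (∈-++⁺ˡ i)
      int-br 1-2 3F i refl = A≢ i (here refl)

      int-int : ∀ {i j i' j'} (e : Edge i j) (e' : Edge i' j') {w} → w ∈ int e → w ∈ int e' → i ≡ i' × j ≡ j'
      int-int x-0 x-0 i k = refl , refl
      int-int x-0 0-1 i k = ⊥-elim (L≢p i (inD k) refl)
      int-int x-0 0-2 i k = ⊥-elim (L≢p i (inE (∈-rev k)) refl)
      int-int x-0 1-2 i k = ⊥-elim (L≢p i (inA k) refl)
      int-int 0-1 x-0 i k = ⊥-elim (L≢p k (inD i) refl)
      int-int 0-1 0-1 i k = refl , refl
      int-int 0-1 0-2 i k = ⊥-elim (D≢ i (there (∈-++⁺ʳ A (there (∈-rev k)))))
      int-int 0-1 1-2 i k = ⊥-elim (D≢ i (there (∈-++⁺ˡ k)))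
      int-int 0-2 x-0 i k = ⊥-elim (L≢p k (inE (∈-rev i)) refl)
      int-int 0-2 0-1 i k = ⊥-elim (D≢ k (there (∈-++⁺ʳ A (there (∈-rev i)))))
      int-int 0-2 0-2 i k = refl , refl
      int-int 0-2 1-2 i k = ⊥-elim (A≢ k (there (∈-rev i)))
      int-int 1-2 x-0 i k = ⊥-elim (L≢p k (inA i) refl)
      int-int 1-2 0-1 i k = ⊥-elim (D≢ k (there (∈-++⁺ˡ i)))
      int-int 1-2 0-2 i k = ⊥-elim (A≢ i (there (∈-rev k)))
      int-int 1-2 1-2 i k = refl , refl

      P : ∀ i j → i Fin.< j → PathIn G (br i) (br j)
      P i j h = toPath (br i) (int (edge i j h)) (br j) (ipath (edge i j h))

      on-split : ∀ {i j} (e : Edge i j) {w} → w ∈ br i ∷ int e ++ br j ∷ [] → (∃[ k ] w ≡ br k) ⊎ w ∈ int e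
      on-split {i} e (here refl) = inj₁ (i , refl)
      on-split {i} {j} e (there m) with ∈-++⁻ (int e) m
      ... | inj₁ m' = inj₂ m'
      ... | inj₂ (here refl) = inj₁ (j , refl)

      rimBr : ∀ k → br k ∈ x ∷ L ⊎ br k ∈ e₀ ∷ p
      rimBr 0F = inj₁ (here refl)
      rimBr 1F = inj₂ (here refl)
      rimBr 2F = inj₂ (there in₁)
      rimBr 3F = inj₂ (there in₂)

      rimInt : ∀ {i j} (e : Edge i j) {w} → w ∈ int e → w ∈ x ∷ L ⊎ w ∈ e₀ ∷ p
      rimInt x-0 m = inj₁ (there m)
      rimInt 0-1 m = inj₂ (there (inD m))
      rimInt 0-2 m = inj₂ (there (inE (∈-rev m)))
      rimInt 1-2 m = inj₂ (there (inA m))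

      sides : ∀ {w} → (∃[ i ] ∃[ j ] ∃[ h ] OnPath G (P i j h) w) → w ∈ x ∷ L ⊎ w ∈ e₀ ∷ p
      sides (i , j , h , o) with on-split (edge i j h) (onPath _ (int (edge i j h)) _ (ipath (edge i j h)) o)
      ... | inj₁ (k , refl) = rimBr k
      ... | inj₂ m = rimInt (edge i j h) m

      Linked : V G → V G → Set
      Linked u v = ∃[ i ] ∃[ j ] ∃[ h ] Consec G (P i j h) u v

      linked : ∀ i j (h : i Fin.< j) {u v} → Near (br i ∷ int (edge i j h) ++ br j ∷ []) u v → Linked u v
      linked i j h k = i , j , h , near-consec (br i) (int (edge i j h)) (br j) (ipath (edge i j h)) k

      leg-linked : ∀ {u v} → u ∈ x ∷ L ++ e₀ ∷ [] → v ∈ x ∷ L ++ e₀ ∷ [] → u ∼ v → Linked u v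
      leg-linked i j e = linked 0F 1F (s≤s z≤n) (ip-near leg i j e)

      mixed : ∀ {u v} → u ∈ x ∷ L → v ∈ e₀ ∷ p → u ∼ v → Linked u v
      mixed (here refl) (here refl) e = leg-linked (here refl) (there (∈-++⁺ʳ L (here refl))) e
      mixed (there i) (here refl) e = leg-linked (there (∈-++⁺ˡ i)) (there (∈-++⁺ʳ L (here refl))) e
      mixed (there i) (there j) e = ⊥-elim (proj₂ (legOff i j) e)
      mixed (here refl) (there j) e with ∈-++⁻ D j
      ... | inj₁ k = ⊥-elim (nD k e)
      ... | inj₂ (here refl) = linked 0F 2F (s≤s z≤n) (inj₁ now)
      ... | inj₂ (there j') with ∈-++⁻ A j'
      ... | inj₁ k = ⊥-elim (nA k e)
      ... | inj₂ (here refl) = linked 0F 3F (s≤s z≤n) (inj₁ now)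
      ... | inj₂ (there k) = ⊥-elim (nE k e)

      linked-sym : ∀ {u v} → Linked u v → Linked v u
      linked-sym (i , j , h , k , inj₁ q) = i , j , h , k , inj₂ q
      linked-sym (i , j , h , k , inj₂ q) = i , j , h , k , inj₁ q

      rim-linked : ∀ {u v} → u ∈ e₀ ∷ p → v ∈ e₀ ∷ p → u ∼ v → Linked u v
      rim-linked {u} {v} i j e with near-split (e₀ ∷ D) (subst (λ l → Near (e₀ ∷ l) u v)
          (trans (++-assoc D _ _) (cong (λ l → D ++ e₁ ∷ l) (++-assoc A _ _))) (cyc-near ring i j e))
      ... | inj₁ k = linked 1F 2F (s≤s (s≤s z≤n)) k
      ... | inj₂ k with near-split (e₁ ∷ A) k
      ... | inj₁ k' = linked 2F 3F (s≤s (s≤s (s≤s z≤n))) k'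
      ... | inj₂ k' = linked 1F 3F (s≤s (s≤s z≤n)) (subst (λ l → Near l u v) tailArc (near-reverse k'))

    hub-ISK4 : ISK4 G
    hub-ISK4 = record
      { br = br
      ; br-inj = br-inj
      ; P = P
      ; disj = λ i j h i' j' h' ne v a b →
          let m = interiorOf _ (int (edge i j h)) _ (ipath (edge i j h)) a in
          case on-split (edge i' j' h') (onPath _ (int (edge i' j' h')) _ (ipath (edge i' j' h')) b) of λ
          { (inj₁ (k , e)) → int-br (edge i j h) k m e
          ; (inj₂ m') → ne (int-int (edge i j h) (edge i' j' h') m m') }
      ; induced = λ u v a b e → case (sides a , sides b) of λ
          { (inj₁ i , inj₁ j) → leg-linked (∈-++⁺ˡ i) (∈-++⁺ˡ j) e
          ; (inj₁ i , inj₂ j) → mixed i j e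
          ; (inj₂ i , inj₁ j) → linked-sym (mixed j i (∼-sym e))
          ; (inj₂ i , inj₂ j) → rim-linked i j e }
      }

  -- The remaining branch vertices are the two neighbours of `x` on `p`. As the leg is induced, `x`
  -- sees `e₀` only if `L` is empty.
  hub : ISK4-free G → ∀ {x e₀ p} L → Cyc (e₀ ∷ p) → x ∉ p → cnt x p ≡ 2 →
    IPath (x ∷ L ++ e₀ ∷ []) → (∀ {l} → l ∈ L → Off l p) → ⊥
  hub free {x} {e₀} {p} L ring x∉ two leg off with first-of x p two
  ... | D , e₁ , B , refl , nD , x₁ , one with first-of x B one
  ... | A , e₂ , E , refl , nA , x₂ , none =
    free (hub-ISK4 {L = L} ring x∉ x₁ x₂ nD nA (cnt-zero E none) leg off)

  -- One of the three neighbours serves as `e₀`, with a single edge as its leg.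
  three-spokes : ISK4-free G → ∀ {x c} → Cyc c → x ∉ c → cnt x c ≢ 3
  three-spokes free {x} {c} k x∉ three with first-of x c three
  ... | D , e , B , refl , nD , xe , two =
    hub free [] (cyc-rot D k) (λ i → x∉ (case ∈-++⁻ B i of λ
        { (inj₁ j) → ∈-++⁺ʳ D (there j) ; (inj₂ j) → ∈-++⁺ˡ j }))
      (trans (cnt-swap x B) (trans (cnt-++ x D) (trans (cong (_+ cnt x B) (cnt-none D nD)) two)))
      (link xe (λ ()) [-]) (λ ())

-- Prisms formed by a ring and a path whose ends each see an edge of the ring.

module Prisms (G : Graph) where
  open Paths G
  open Hub G

  module _ {p q y z y′ z′ : V G} {I N N′ : List (V G)}
    (path : IPath (p ∷ I ++ q ∷ []))
    (ring : Cyc ((y ∷ N ++ z ∷ []) ++ (z′ ∷ N′ ++ y′ ∷ [])))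
    (py : p ∼ y) (py′ : p ∼ y′) (qz : q ∼ z) (qz′ : q ∼ z′)
    (apart : ∀ {u w} → u ∈ p ∷ I ++ q ∷ [] → w ∈ (y ∷ N ++ z ∷ []) ++ (z′ ∷ N′ ++ y′ ∷ []) → u ≢ w)
    (cross : ∀ {u w} → u ∈ p ∷ I ++ q ∷ [] → w ∈ (y ∷ N ++ z ∷ []) ++ (z′ ∷ N′ ++ y′ ∷ []) → u ∼ w →
      (u ≡ p × (w ≡ y ⊎ w ≡ y′)) ⊎ (u ≡ q × (w ≡ z ⊎ w ≡ z′)))
    where

    private
      a b : Fin 3 → V G
      a 0F = p
      a 1F = y
      a 2F = y′
      b 0F = q
      b 1F = z
      b 2F = z′

      int : Fin 3 → List (V G)
      int 0F = I
      int 1F = N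
      int 2F = reverse N′

      arc arc′ : List (V G)
      arc = y ∷ N ++ z ∷ []
      arc′ = z′ ∷ N′ ++ y′ ∷ []

      rev-arc : reverse arc′ ≡ y′ ∷ reverse N′ ++ z′ ∷ []
      rev-arc = trans (rev-∷ z′ (N′ ++ y′ ∷ [])) (cong (_++ z′ ∷ []) (rev-snoc N′ y′))

      ip-arc : IPath arc
      ip-arc = cyc-arc arc (here refl) ring

      ip-arc′ : IPath arc′
      ip-arc′ = cyc-arc arc′ (here refl) (cyc-rot arc ring)

      ipath : ∀ i → IPath (a i ∷ int i ++ b i ∷ [])
      ipath 0F = path
      ipath 1F = ip-arc
      ipath 2F = subst IPath rev-arc (ip-reverse ip-arc′)

      in-arc : ∀ {w} → w ∈ y′ ∷ reverse N′ ++ z′ ∷ [] → w ∈ arc′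
      in-arc i = ∈-rev (subst (_ ∈_) (sym rev-arc) i)

      -- The two ring edges outside the arcs, `y y′` and `z z′`, complete the triangles at `p` and
      -- at `q`.
      yy′ : y ∼ y′
      yy′ = cyc-close (N ++ z ∷ z′ ∷ N′)
        (subst Cyc (cong (y ∷_) (trans (++-assoc N (z ∷ []) arc′) (sym (++-assoc N (z ∷ z′ ∷ N′) (y′ ∷ []))))) ring)

      zz′ : z ∼ z′
      zz′ = cyc-adj-at (y ∷ N) (subst Cyc (cong (y ∷_) (++-assoc N (z ∷ []) arc′)) ring)

      P : ∀ i → PathIn G (a i) (b i)
      P i = toPath (a i) (int i) (b i) (ipath i)

      on : ∀ i {w} → OnPath G (P i) w → w ∈ a i ∷ int i ++ b i ∷ []
      on i o = onPath (a i) (int i) (b i) (ipath i) o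

      arcs-disjoint : ∀ {w} → w ∈ arc → w ∈ arc′ → ⊥
      arcs-disjoint i j with ∈-∃++ i
      ... | A , B , e = cyc-fresh (cyc-rot A (subst Cyc (trans (cong (_++ arc′) e) (++-assoc A _ arc′)) ring))
                          (∈-++⁺ˡ (∈-++⁺ʳ B j))

      disj : ∀ i j → i ≢ j → ∀ v → OnPath G (P i) v → ¬ OnPath G (P j) v
      disj 0F 0F ne v k l = ne refl
      disj 0F 1F ne v k l = apart (on 0F k) (∈-++⁺ˡ (on 1F l)) refl
      disj 0F 2F ne v k l = apart (on 0F k) (∈-++⁺ʳ arc (in-arc (on 2F l))) refl
      disj 1F 0F ne v k l = apart (on 0F l) (∈-++⁺ˡ (on 1F k)) refl
      disj 1F 1F ne v k l = ne refl
      disj 1F 2F ne v k l = arcs-disjoint (on 1F k) (in-arc (on 2F l))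
      disj 2F 0F ne v k l = apart (on 0F l) (∈-++⁺ʳ arc (in-arc (on 2F k))) refl
      disj 2F 1F ne v k l = arcs-disjoint (on 1F l) (in-arc (on 2F k))
      disj 2F 2F ne v k l = ne refl

      Linked : V G → V G → Set
      Linked u v = (∃[ i ] Consec G (P i) u v) ⊎ (∃[ i ] ∃[ j ] (u ≡ a i × v ≡ a j))
                   ⊎ (∃[ i ] ∃[ j ] (u ≡ b i × v ≡ b j))

      linked-sym : ∀ {u v} → Linked u v → Linked v u
      linked-sym (inj₁ (i , k , inj₁ e)) = inj₁ (i , k , inj₂ e)
      linked-sym (inj₁ (i , k , inj₂ e)) = inj₁ (i , k , inj₁ e)
      linked-sym (inj₂ (inj₁ (i , j , e , f))) = inj₂ (inj₁ (j , i , f , e))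
      linked-sym (inj₂ (inj₂ (i , j , e , f))) = inj₂ (inj₂ (j , i , f , e))

      along : ∀ i {u v} → Near (a i ∷ int i ++ b i ∷ []) u v → Linked u v
      along i k = inj₁ (i , near-consec (a i) (int i) (b i) (ipath i) k)

      spread : ∀ {w} → (∃[ i ] OnPath G (P i) w) → w ∈ p ∷ I ++ q ∷ [] ⊎ w ∈ arc ++ arc′
      spread (0F , o) = inj₁ (on 0F o)
      spread (1F , o) = inj₂ (∈-++⁺ˡ (on 1F o))
      spread (2F , o) = inj₂ (∈-++⁺ʳ arc (in-arc (on 2F o)))

      mixed : ∀ {u w} → u ∈ p ∷ I ++ q ∷ [] → w ∈ arc ++ arc′ → u ∼ w → Linked u w
      mixed i j e with cross i j e
      ... | inj₁ (refl , inj₁ refl) = inj₂ (inj₁ (0F , 1F , refl , refl))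
      ... | inj₁ (refl , inj₂ refl) = inj₂ (inj₁ (0F , 2F , refl , refl))
      ... | inj₂ (refl , inj₁ refl) = inj₂ (inj₂ (0F , 1F , refl , refl))
      ... | inj₂ (refl , inj₂ refl) = inj₂ (inj₂ (0F , 2F , refl , refl))

      back : ∀ {u w} → Near (arc′ ++ y ∷ []) u w → Linked u w
      back {u} {w} k with near-split (z′ ∷ N′) (subst (λ l → Near (z′ ∷ l) u w) (++-assoc N′ (y′ ∷ []) (y ∷ [])) k)
      ... | inj₁ k' = along 2F (subst (λ l → Near l u w) rev-arc (near-reverse k'))
      ... | inj₂ (inj₁ now) = inj₂ (inj₁ (2F , 1F , refl , refl))
      ... | inj₂ (inj₂ now) = inj₂ (inj₁ (1F , 2F , refl , refl))
      ... | inj₂ (inj₁ (later (later ())))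
      ... | inj₂ (inj₂ (later (later ())))

      ring-linked : ∀ {u w} → u ∈ arc ++ arc′ → w ∈ arc ++ arc′ → u ∼ w → Linked u w
      ring-linked {u} {w} i j e
        with near-split (y ∷ N) (subst (λ l → Near (y ∷ l) u w)
               (trans (++-assoc (N ++ z ∷ []) arc′ _) (++-assoc N (z ∷ []) _)) (cyc-near ring i j e))
      ... | inj₁ k = along 1F k
      ... | inj₂ (inj₁ now) = inj₂ (inj₂ (1F , 2F , refl , refl))
      ... | inj₂ (inj₂ now) = inj₂ (inj₂ (2F , 1F , refl , refl))
      ... | inj₂ (inj₁ (later k)) = back (inj₁ k)
      ... | inj₂ (inj₂ (later k)) = back (inj₂ k)

    prism : Prism G
    prism = record
      { a = a ; b = b ; P = P
      ; len≥1 = λ i → s≤s z≤n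
      ; triA = triA ; triB = triB ; disj = disj
      ; induced = λ u v i j e → case (spread i , spread j) of λ
          { (inj₁ k , inj₁ l) → along 0F (ip-near path k l e)
          ; (inj₁ k , inj₂ l) → mixed k l e
          ; (inj₂ k , inj₁ l) → linked-sym (mixed l k (∼-sym e))
          ; (inj₂ k , inj₂ l) → ring-linked k l e } }
      where
      triA : ∀ i j → i ≢ j → a i ∼ a j
      triA 0F 0F ne = ⊥-elim (ne refl)
      triA 0F 1F ne = py
      triA 0F 2F ne = py′
      triA 1F 0F ne = ∼-sym py
      triA 1F 1F ne = ⊥-elim (ne refl)
      triA 1F 2F ne = yy′
      triA 2F 0F ne = ∼-sym py′
      triA 2F 1F ne = ∼-sym yy′
      triA 2F 2F ne = ⊥-elim (ne refl)
      triB : ∀ i j → i ≢ j → b i ∼ b j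
      triB 0F 0F ne = ⊥-elim (ne refl)
      triB 0F 1F ne = qz
      triB 0F 2F ne = qz′
      triB 1F 0F ne = ∼-sym qz
      triB 1F 1F ne = ⊥-elim (ne refl)
      triB 1F 2F ne = zz′
      triB 2F 0F ne = ∼-sym qz′
      triB 2F 1F ne = ∼-sym zz′
      triB 2F 2F ne = ⊥-elim (ne refl)

-- Residues, and segments of sequences indexed by natural numbers.

%-inj : ∀ a b k → a ≤ b → b < a + suc k → a % suc k ≡ b % suc k → a ≡ b
%-inj a b k a≤b b<a+K e = trans ea (trans (cong₂ (λ r q → r + q * suc k) e q≡) (sym eb))
  where
  ea : a ≡ a % suc k + (a / suc k) * suc k
  ea = m≡m%n+[m/n]*n a (suc k)
  eb : b ≡ b % suc k + (b / suc k) * suc k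
  eb = m≡m%n+[m/n]*n b (suc k)
  eb′ : b ≡ a % suc k + (b / suc k) * suc k
  eb′ = trans eb (cong (_+ (b / suc k) * suc k) (sym e))
  q≤ : a / suc k ≤ b / suc k
  q≤ = *-cancelʳ-≤ _ _ (suc k) (+-cancelˡ-≤ (a % suc k) _ _ (subst₂ _≤_ ea eb′ a≤b))
  q< : b / suc k < suc (a / suc k)
  q< = *-cancelʳ-< (suc k) _ _ (+-cancelˡ-< (a % suc k) _ _ (subst₂ _<_ eb′
        (trans (cong (_+ suc k) ea) (trans (+-assoc (a % suc k) _ _)
          (cong (a % suc k +_) (+-comm _ (suc k))))) b<a+K))
  q≡ : a / suc k ≡ b / suc k
  q≡ = ≤-antisym q≤ (≤-pred q<)

%-suc : ∀ s k → (s % suc k + 1) % suc k ≡ suc s % suc k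
%-suc s k = trans (%-distribˡ-+ (s % suc k) 1 (suc k))
  (trans (cong (λ r → (r + 1 % suc k) % suc k) (m%n%n≡m%n s (suc k)))
    (trans (sym (%-distribˡ-+ s 1 (suc k))) (cong (_% suc k) (+-comm s 1))))

+-suc-∸ : ∀ {s t} → s < t → s + suc (t ∸ suc s) ≡ t
+-suc-∸ {s} l = trans (+-suc s _) (m+[n∸m]≡n l)

module Segments {A : Set} (F : ℕ → A) where
  seg : ℕ → ℕ → List A
  seg i zero = []
  seg i (suc l) = F i ∷ seg (suc i) l

  seg-++ : ∀ i a {b} → seg i (a + b) ≡ seg i a ++ seg (i + a) b
  seg-++ i zero {b} = cong (λ j → seg j b) (sym (+-identityʳ i))
  seg-++ i (suc a) {b} = cong (F i ∷_) (trans (seg-++ (suc i) a)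
    (cong (λ j → seg (suc i) a ++ seg j b) (sym (+-suc i a))))

  ∈-seg : ∀ i l {w} → w ∈ seg i l → ∃[ t ] (i ≤ t × t < i + l × w ≡ F t)
  ∈-seg i (suc l) (here refl) = i , ≤-refl , m<m+n i (s≤s z≤n) , refl
  ∈-seg i (suc l) (there w∈) with ∈-seg (suc i) l w∈
  ... | t , p , q , e = t , <⇒≤ p , subst (t <_) (sym (+-suc i l)) q , e

  seg-∈ : ∀ i l t → i ≤ t → t < i + l → F t ∈ seg i l
  seg-∈ i zero t p q = ⊥-elim (<⇒≱ (subst (t <_) (+-identityʳ i) q) p)
  seg-∈ i (suc l) t p q with i ≟ t
  ... | yes refl = here refl
  ... | no i≢t = there (seg-∈ (suc i) l t (≤∧≢⇒< p i≢t) (subst (t <_) (+-suc i l) q))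

  seg-tabulate : ∀ i l → seg i l ≡ tabulate {n = l} (λ t → F (i + toℕ t))
  seg-tabulate i zero = refl
  seg-tabulate i (suc l) = cong₂ _∷_ (cong F (sym (+-identityʳ i)))
    (trans (seg-tabulate (suc i) l) (tabulate-cong (λ t → cong F (sym (+-suc i (toℕ t))))))

  seg-cong : ∀ i j l → (∀ t → F (i + t) ≡ F (j + t)) → seg i l ≡ seg j l
  seg-cong i j zero f = refl
  seg-cong i j (suc l) f = cong₂ _∷_ (subst₂ (λ a b → F a ≡ F b) (+-identityʳ i) (+-identityʳ j) (f 0))
    (seg-cong (suc i) (suc j) l (λ t → subst₂ (λ a b → F a ≡ F b) (+-suc i t) (+-suc j t) (f (suc t))))

module Counting (G : Graph) where
  open Graph G using (adj)
  open Paths G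

  count-tabulate : ∀ v {k} (c : Fin k → V G) →
    sum (tabulate (λ t → if adj v (c t) then 1 else 0)) ≡ cnt v (tabulate c)
  count-tabulate v {zero} c = refl
  count-tabulate v {suc k} c = cong ((if adj v (c Fin.zero) then 1 else 0) +_) (count-tabulate v (c ∘ Fin.suc))

  nbrCount-cnt : ∀ v {k} (c : Fin (suc k) → V G) → nbrCount G v c ≡ cnt v (tabulate c)
  nbrCount-cnt v c = trans (cong sum (map-tabulate id (λ t → if adj v (c t) then 1 else 0))) (count-tabulate v c)

  uniq-split : ∀ A A′ {z : V G} {B B′} → A ++ z ∷ B ≡ A′ ++ z ∷ B′ → z ∉ A → z ∉ A′ → A ≡ A′
  uniq-split [] [] e p q = refl
  uniq-split [] (a ∷ A′) e p q = ⊥-elim (q (here (∷-injectiveˡ e)))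
  uniq-split (a ∷ A) [] e p q = ⊥-elim (p (here (sym (∷-injectiveˡ e))))
  uniq-split (a ∷ A) (a′ ∷ A′) e p q = cong₂ _∷_ (∷-injectiveˡ e)
    (uniq-split A A′ (∷-injectiveʳ e) (λ i → p (there i)) (λ i → q (there i)))

-- From the given wheel to its rim as a list.

module Unroll (G : Graph) (W : Wheel G) where
  open Paths G
  open Counting G
  open Wheel W

  K : ℕ
  K = suc k

  -- The rim unrolled over all natural numbers: an arc across index 0 is a segment like any other,
  -- and the rotations of the ring are the lists `seg i K`.
  F : ℕ → V G
  F s = cyc (s mod K)

  open Segments F public

  F-≡ : ∀ s t → s % K ≡ t % K → F s ≡ F t
  F-≡ s t e = cong cyc (Finₚ.toℕ-injective (trans (Finₚ.toℕ-fromℕ< (m%n<n s K))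
    (trans e (sym (Finₚ.toℕ-fromℕ< (m%n<n t K))))))

  toℕ-mod : ∀ s → toℕ (s mod K) ≡ s % K
  toℕ-mod s = Finₚ.toℕ-fromℕ< (m%n<n s K)

  F-toℕ : ∀ t → F (toℕ t) ≡ cyc t
  F-toℕ t = cong cyc (Finₚ.toℕ-injective (trans (toℕ-mod (toℕ t)) (m<n⇒m%n≡m (Finₚ.toℕ<n t))))

  F-period : ∀ s → F (s + K) ≡ F s
  F-period s = F-≡ (s + K) s ([m+n]%n≡m%n s K)

  F-shift : ∀ i j → F i ≡ F j → ∀ t → F (i + t) ≡ F (j + t)
  F-shift i j e t = F-≡ (i + t) (j + t) (trans (%-distribˡ-+ i t K) (trans (cong (λ r → (r + t % K) % K) i≡j)
      (sym (%-distribˡ-+ j t K))))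
    where
    i≡j : i % K ≡ j % K
    i≡j = trans (sym (toℕ-mod i)) (trans (cong toℕ (cyc-inj e)) (toℕ-mod j))

  F-step : ∀ s → F s ∼ F (suc s)
  F-step s = subst (F s ∼_) (F-≡ (toℕ (s mod K) + 1) (suc s) (trans (cong (λ r → (r + 1) % K) (toℕ-mod s)) (%-suc s k))) (cycle (s mod K))

  F-inj : ∀ {a b} → a < b → b < a + K → F a ≢ F b
  F-inj {a} {b} p q e = <⇒≢ p (%-inj a b k (<⇒≤ p) q
    (trans (sym (toℕ-mod a)) (trans (cong toℕ (cyc-inj e)) (toℕ-mod b))))

  ⊕-next : ∀ b a → b mod K ≡ (a mod K) ⊕ 1 → b % K ≡ suc a % K
  ⊕-next b a r = trans (sym (toℕ-mod b)) (trans (cong toℕ r) (trans (toℕ-mod (toℕ (a mod K) + 1))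
    (trans (cong (λ r → (r + 1) % K) (toℕ-mod a)) (%-suc a k))))

  F-chord : ∀ {a b} → a < b → b < a + K → F a ∼ F b → b ≡ suc a ⊎ suc b ≡ a + K
  F-chord {a} {b} p q e with chordless (a mod K) (b mod K) e
  ... | inj₁ r = inj₁ (sym (%-inj (suc a) b k p (≤-trans q (n≤1+n _)) (sym (⊕-next b a r))))
  ... | inj₂ r = inj₂ (%-inj (suc b) (a + K) k q (s≤s (≤-trans (+-monoˡ-≤ K (<⇒≤ p)) ≤-refl))
      (trans (sym (⊕-next a b r)) (sym ([m+n]%n≡m%n a K))))

  -- With at most `k` of the `suc k` rim vertices, the closing edge of the cycle never has both ends
  -- on the segment.
  seg-ipath : ∀ i l → l ≤ k → IPath (seg i l)
  seg-ipath i zero _ = []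
  seg-ipath i (suc zero) _ = [-]
  seg-ipath i (suc (suc l)) b = link (F-step i) off (seg-ipath (suc i) (suc l) (<⇒≤ b))
    where
    off : Off (F i) (seg (suc (suc i)) l)
    off w∈ with ∈-seg (suc (suc i)) l w∈
    ... | t , p , q , refl = F-inj (<⇒≤ p) t<′ , λ e → case F-chord (<⇒≤ p) t<′ e of λ
        { (inj₁ refl) → <-irrefl refl p
        ; (inj₂ r) → <-irrefl r (subst (suc t <_) (sym (+-suc i k)) (s≤s t<)) }
      where
      t< : t < i + k
      t< = <-≤-trans q (subst (_≤ i + k) (trans (+-suc i (suc l)) (cong suc (+-suc i l))) (+-monoʳ-≤ i b))
      t<′ : t < i + K
      t<′ = <-≤-trans t< (+-monoʳ-≤ i (n≤1+n k))

  ring : List (V G)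
  ring = seg 0 K

  seg-snoc : ∀ i l → seg i (suc l) ≡ seg i l ++ F (i + l) ∷ []
  seg-snoc i l = trans (cong (seg i) (+-comm 1 l)) (seg-++ i l)

  cyc-seg : ∀ i → Cyc (seg i K)
  cyc-seg i = go k 3≤k (λ l b → seg-ipath (suc i) l b) refl
    where
    -- The length is generalised to `k′` so that it can be split into successors while `F`, which
    -- depends on `k`, stays fixed.
    go : ∀ k′ → 3 ≤ k′ → (∀ l → l ≤ k′ → IPath (seg (suc i) l)) → k′ ≡ k → Cyc (F i ∷ seg (suc i) k′)
    go (suc zero) (s≤s ())
    go (suc (suc l)) _ f e = subst (λ t → Cyc (F i ∷ F (suc i) ∷ t)) (sym (seg-snoc (suc (suc i)) l))
      (mkCyc (seg (suc (suc i)) l)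
        (subst (λ t → IPath (F (suc i) ∷ t)) (seg-snoc (suc (suc i)) l) (f (suc (suc l)) ≤-refl))
        (F-step i)
        (∼-sym (subst (F (suc (suc i) + l) ∼_) (trans (cong F last≡) (F-period i)) (F-step (suc (suc i) + l))))
        off)
      where
      last≡ : suc (suc (suc i) + l) ≡ i + K
      last≡ = sym (trans (cong (λ t → i + suc t) (sym e))
        (trans (+-suc i _) (cong suc (trans (+-suc i _) (cong suc (+-suc i l))))))
      off : Off (F i) (seg (suc (suc i)) l)
      off w∈ with seg-ipath i (suc (suc l)) (≤-reflexive e)
      ... | link _ o _ = o w∈

  rot-seg : ∀ i → Rot ring (seg i K)
  rot-seg zero = done
  rot-seg (suc i) = rot-trans (rot-seg i) (turn (subst (λ t → Rot t (seg (suc i) K))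
    (trans (seg-snoc (suc i) k) (cong (λ v → seg (suc i) k ++ v ∷ [])
      (trans (cong F (sym (+-suc i k))) (F-period i)))) done))

  seg-rot : ∀ {c l} → Rot c l → ∀ i → c ≡ seg i K → ∃[ j ] l ≡ seg j K
  seg-rot done i e = i , e
  seg-rot (turn r) i refl = seg-rot r (suc i)
    (sym (trans (seg-snoc (suc i) k) (cong (λ v → seg (suc i) k ++ v ∷ [])
      (trans (cong F (sym (+-suc i k))) (F-period i)))))

  ring-tabulate : ring ≡ tabulate cyc
  ring-tabulate = trans (seg-tabulate 0 K) (tabulate-cong F-toℕ)

  count : ∀ v → nbrCount G v cyc ≡ cnt v ring
  count v = trans (nbrCount-cnt v cyc) (cong (cnt v) (sym ring-tabulate))

  ring-cyc : Cyc ring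
  ring-cyc = cyc-seg 0

  ∈-ring : ∀ t → cyc t ∈ ring
  ∈-ring t = subst (_∈ ring) (F-toℕ t) (seg-∈ 0 K (toℕ t) z≤n (Finₚ.toℕ<n t))

  ring-∈ : ∀ {w} → w ∈ ring → ∃[ t ] w ≡ cyc t
  ring-∈ w∈ with ∈-seg 0 K w∈
  ... | t , _ , _ , e = t mod K , e

  -- A rotation starting at `y` is the segment starting there, and `z` occurs in it only once; so
  -- the ends determine the arc `M`.
  arc-between : ∀ a s r {y M z M′} → s + suc r ≤ k → Rot ring (y ∷ M ++ z ∷ M′) →
    y ≡ F (a + s) → z ≡ F (a + (s + suc r)) → M ≡ seg (suc (a + s)) r
  arc-between a s r {y} {M} {z} {M′} b rt ey ez with seg-rot rt 0 refl
  ... | j , e = uniq-split M (seg (suc (a + s)) r) (∷-injectiveʳ eq) z∉M z∉seg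
    where
    c : Cyc (y ∷ M ++ z ∷ M′)
    c = rot-cyc rt ring-cyc
    Fj : F j ≡ F (a + s)
    Fj = trans (sym (∷-injectiveˡ e)) ey
    i = a + s
    r≤ : suc r ≤ k
    r≤ = ≤-trans (m≤n+m (suc r) s) b
    K≡ : suc r + (K ∸ suc r) ≡ K
    K≡ = m+[n∸m]≡n (≤-trans r≤ (n≤1+n k))
    z′ : z ≡ F (i + suc r)
    z′ = trans ez (cong F (sym (+-assoc a s (suc r))))
    tl : seg (i + suc r) (K ∸ suc r) ≡ z ∷ seg (suc (i + suc r)) (k ∸ suc r)
    tl = trans (cong (seg (i + suc r)) (+-∸-assoc 1 r≤)) (cong (_∷ seg (suc (i + suc r)) (k ∸ suc r)) (sym z′))
    eq : y ∷ M ++ z ∷ M′ ≡ F i ∷ seg (suc i) r ++ z ∷ seg (suc (i + suc r)) (k ∸ suc r)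
    eq = trans e (trans (seg-cong j i K (F-shift j i Fj))
      (trans (cong (seg i) (sym K≡)) (trans (seg-++ i (suc r)) (cong (seg i (suc r) ++_) tl))))
    z∉M : z ∉ M
    z∉M i∈ = cyc-fresh (cyc-rot (y ∷ M) c) (∈-++⁺ʳ M′ (there i∈))
    z∉seg : z ∉ seg (suc i) r
    z∉seg i∈ with ∈-seg (suc i) r i∈
    ... | t , p , q , e′ = F-inj (subst (t <_) (sym (+-suc i r)) q)
        (+-mono-≤ {suc i} {t} p (≤-trans r≤ (n≤1+n k))) (trans (sym e′) z′)

  module _ (proper : Proper G W) where

    sector-between : ∀ (S : Sector G W) s r {y M z M′} → s + suc r ≤ Sector.d S → Rot ring (y ∷ M ++ z ∷ M′) →
      y ≡ F (toℕ (Sector.start S) + s) → z ≡ F (toℕ (Sector.start S) + (s + suc r)) → NoN center M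
    sector-between S s r b rt ey ez w∈ e
      with arc-between (toℕ (Sector.start S)) s r (≤-trans b (Sector.d≤k S)) rt ey ez
    ... | refl with ∈-seg (suc (toℕ (Sector.start S) + s)) r w∈
    ... | t , p , q , refl = Sector.no-spoke S (s + suc c) (≤-trans (s≤s z≤n) (m≤n+m (suc c) s))
          (<-≤-trans (+-monoʳ-< s (s≤s c<r)) b) (subst (λ t → center ∼ F t) t≡′ e)
      where
      a = toℕ (Sector.start S)
      c = t ∸ suc (a + s)
      t≡ : t ≡ suc (a + s) + c
      t≡ = sym (m+[n∸m]≡n p)
      t≡′ : t ≡ a + (s + suc c)
      t≡′ = trans t≡ (trans (sym (+-suc (a + s) c)) (+-assoc a s (suc c)))
      c<r : c < r
      c<r = +-cancelˡ-< (suc (a + s)) c r (subst (_< suc (a + s) + r) t≡ q)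

    -- Both neighbours have offsets in one sector, and the arc from the smaller offset to the larger
    -- runs inside that sector. Which offset is smaller decides between `M` and `M′`.
    proper-pair : ∀ {v y M z M′} → v ∉ ring → v ≢ center → Rot ring (y ∷ M ++ z ∷ M′) →
      v ∼ y → v ∼ z → NoN center M ⊎ NoN center M′
    proper-pair {v} {y} {M} {z} {M′} v∉ v≢ rt vy vz with proper v
    ... | inj₁ (inj₁ e) = ⊥-elim (v≢ e)
    ... | inj₁ (inj₂ (t , refl)) = ⊥-elim (v∉ (∈-ring t))
    ... | inj₂ ((S , f) , _)
      with ring-∈ (rot-∈⁻ rt (here refl)) | ring-∈ (rot-∈⁻ rt (there (∈-++⁺ʳ M (here refl))))
    ... | t , refl | t′ , refl with f t vy | f t′ vz
    ... | s , s≤ , refl | s′ , s′≤ , refl with <-cmp s s′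
    ... | tri< l _ _ = inj₁ (sector-between S s (s′ ∸ suc s)
            (subst (_≤ _) (sym (+-suc-∸ l)) s′≤) rt refl (cong (λ u → F (toℕ (Sector.start S) + u)) (sym (+-suc-∸ l))))
    ... | tri≈ _ refl _ = ⊥-elim (cyc-fresh (rot-cyc rt ring-cyc) (∈-++⁺ʳ M (here refl)))
    ... | tri> _ _ l = inj₂ (sector-between S s′ (s ∸ suc s′)
            (subst (_≤ _) (sym (+-suc-∸ l)) s≤) (rot-trans rt (rot-swap (cyc t ∷ M))) refl
            (cong (λ u → F (toℕ (Sector.start S) + u)) (sym (+-suc-∸ l))))

    proper-count : ∀ {v} → v ∉ ring → v ≢ center → ¬ center ∼ v → cnt v ring ≤ 2
    proper-count {v} v∉ v≢ nx with proper v
    ... | inj₁ (inj₁ e) = ⊥-elim (v≢ e)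
    ... | inj₁ (inj₂ (t , refl)) = ⊥-elim (v∉ (∈-ring t))
    ... | inj₂ (_ , f) with cnt v ring ≤? 2
    ... | yes p = p
    ... | no p = ⊥-elim (nx (∼-sym (f (subst (3 ≤_) (sym (count v)) (≰⇒> p)))))

-- From a ring back to a wheel; properness obtained from `Good`.

module Roll (G : Graph) where
  open Paths G
  open Counting G

  turn₁ : List (V G) → List (V G)
  turn₁ [] = []
  turn₁ (v ∷ p) = p ++ v ∷ []

  spin : ℕ → List (V G) → List (V G)
  spin zero l = l
  spin (suc s) l = spin s (turn₁ l)

  spin-+ : ∀ s t l → spin (s + t) l ≡ spin t (spin s l)
  spin-+ zero t l = refl
  spin-+ (suc s) t l = spin-+ s t (turn₁ l)

  spin-++ : ∀ A {B} → spin (length A) (A ++ B) ≡ B ++ A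
  spin-++ [] {B} = sym (++-identityʳ B)
  spin-++ (a ∷ A) {B} = trans (cong (spin (length A)) (++-assoc A B (a ∷ [])))
    (trans (spin-++ A) (++-assoc B (a ∷ []) A))

  spin-length : ∀ l → spin (length l) l ≡ l
  spin-length l = trans (cong (spin (length l)) (sym (++-identityʳ l))) (spin-++ l)

  spin-rot : ∀ s l → Rot l (spin s l)
  spin-rot zero l = done
  spin-rot (suc s) [] = spin-rot s []
  spin-rot (suc s) (v ∷ l) = turn (spin-rot s (l ++ v ∷ []))

  rot-spin : ∀ {l c} → Rot l c → ∃[ s ] c ≡ spin s l
  rot-spin done = 0 , refl
  rot-spin (turn r) with rot-spin r
  ... | s , e = suc s , e

  split-at : ∀ (l : List (V G)) t → t < length l → ∃[ A ] ∃[ w ] ∃[ B ] (l ≡ A ++ w ∷ B × length A ≡ t)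
  split-at (w ∷ l) zero p = [] , w , l , refl , refl
  split-at (v ∷ l) (suc t) (s≤s p) with split-at l t p
  ... | A , w , B , e , f = v ∷ A , w , B , cong (v ∷_) e , cong suc f

  hd : V G → List (V G) → V G
  hd d [] = d
  hd d (v ∷ _) = v

  module _ {x : V G} {h : V G} {p : List (V G)}
    (ring : Cyc (h ∷ p)) (4≤ : 3 ≤ length p) (x∉ : x ∉ h ∷ p) (3≤ : 3 ≤ cnt x (h ∷ p))
    where

    private
      k K : ℕ
      k = length p
      K = suc k

      H : List (V G)
      H = h ∷ p

      -- Reading off heads of rotations makes periodicity immediate. The default `h` is never
      -- reached, as no rotation of `H` is empty.
      F : ℕ → V G
      F s = hd h (spin s H)

      open Segments F

      length-spin : ∀ s → length (spin s H) ≡ K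
      length-spin s = sym (length-rot (spin-rot s H))

      cyc-spin : ∀ s → Cyc (spin s H)
      cyc-spin s = rot-cyc (spin-rot s H) ring

      F-at : ∀ s A {w B} → spin s H ≡ A ++ w ∷ B → F (s + length A) ≡ w
      F-at s A e = cong (hd h) (trans (spin-+ s (length A) H) (trans (cong (spin (length A)) e) (spin-++ A)))

      F-period : ∀ s → F (s + K) ≡ F s
      F-period s = cong (hd h) (trans (spin-+ s K H)
        (trans (cong (λ t → spin t (spin s H)) (sym (length-spin s))) (spin-length (spin s H))))

      F-periods : ∀ q s → F (s + q * K) ≡ F s
      F-periods zero s = cong F (+-identityʳ s)
      F-periods (suc q) s = trans (cong F (trans (cong (s +_) (+-comm K (q * K))) (sym (+-assoc s (q * K) K))))
        (trans (F-period (s + q * K)) (F-periods q s))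

      F-% : ∀ s → F (s % K) ≡ F s
      F-% s = trans (sym (F-periods (s / K) (s % K))) (cong F (sym (m≡m%n+[m/n]*n s K)))

      F-later : ∀ a t → t < k → ∃[ A ] ∃[ B ] (spin a H ≡ F a ∷ A ++ F (a + suc t) ∷ B × length A ≡ t × t + suc (length B) ≡ k)
      F-later a t t<k with spin a H in e | length-spin a
      ... | v ∷ l | len with split-at l t (subst (t <_) (sym (suc-injective len)) t<k)
      ... | A , w , B , refl , refl = A , B , cong (λ u → v ∷ A ++ u ∷ B) (sym (F-at a (v ∷ A) e)) , refl ,
              trans (sym (length-++ A)) (suc-injective len)

      F-step : ∀ a → F a ∼ F (suc a)
      F-step a with F-later a 0 (≤-trans (s≤s z≤n) 4≤)
      ... | [] , B , e , _ = subst (F a ∼_) (cong F (+-comm a 1)) (cyc-adj (subst Cyc e (cyc-spin a)))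

      F-fresh : ∀ a t → t < k → F a ≢ F (a + suc t)
      F-fresh a t t<k eq with F-later a t t<k
      ... | A , B , e , _ = cyc-fresh (subst Cyc e (cyc-spin a)) (subst (_∈ A ++ F (a + suc t) ∷ B) (sym eq) (∈-++⁺ʳ A (here refl)))

      F-chord : ∀ a t → t < k → F a ∼ F (a + suc t) → t ≡ 0 ⊎ suc t ≡ k
      F-chord a t t<k eq with F-later a t t<k
      ... | [] , B , e , l , _ = inj₁ (sym l)
      ... | A , [] , e , _ , l = inj₂ (trans (sym (+-comm t 1)) l)
      ... | c ∷ A , d ∷ B , e , _ = ⊥-elim (proj₂ (cyc-apart A (subst Cyc e (cyc-spin a))) eq)

      rim : Fin K → V G
      rim t = F (toℕ t)

      rim-mod : ∀ s → rim (s mod K) ≡ F s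
      rim-mod s = trans (cong F (Finₚ.toℕ-fromℕ< (m%n<n s K))) (F-% s)

      distinct : ∀ {i j : Fin K} → toℕ i < toℕ j → rim i ≢ rim j
      distinct {i} {j} l e = F-fresh (toℕ i) (toℕ j ∸ suc (toℕ i))
        (<-≤-trans (∸-monoʳ-< {toℕ j} {suc (toℕ i)} {0} (s≤s z≤n) l) (≤-pred (Finₚ.toℕ<n j)))
        (trans e (cong F (sym (+-suc-∸ l))))

      rim-inj : Injective _≡_ _≡_ rim
      rim-inj {i} {j} e with <-cmp (toℕ i) (toℕ j)
      ... | tri< l _ _ = ⊥-elim (distinct l e)
      ... | tri≈ _ q _ = Finₚ.toℕ-injective q
      ... | tri> _ _ l = ⊥-elim (distinct l (sym e))

      F-inj : ∀ {s t} → F s ≡ F t → s mod K ≡ t mod K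
      F-inj {s} {t} e = rim-inj (trans (rim-mod s) (trans e (sym (rim-mod t))))

      up : ∀ {i j : Fin K} → toℕ i < toℕ j → rim i ∼ rim j → j ≡ i ⊕ 1 ⊎ i ≡ j ⊕ 1
      up {i} {j} l e with F-chord (toℕ i) (toℕ j ∸ suc (toℕ i))
            (<-≤-trans (∸-monoʳ-< {toℕ j} {suc (toℕ i)} {0} (s≤s z≤n) l) (≤-pred (Finₚ.toℕ<n j)))
            (subst (λ t → rim i ∼ F t) (sym (+-suc-∸ l)) e)
      ... | inj₁ q = inj₁ (rim-inj (trans (cong F (trans (sym (+-suc-∸ l)) (cong (λ t → toℕ i + suc t) q)))
                       (sym (rim-mod (toℕ i + 1)))))
      ... | inj₂ q = inj₂ (rim-inj (trans (sym (F-period (toℕ i)))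
                       (trans (cong F wrap) (sym (rim-mod (toℕ j + 1))))))
        where
        wrap : toℕ i + K ≡ toℕ j + 1
        wrap = trans (+-suc (toℕ i) k) (trans (cong suc (trans (cong (toℕ i +_) (sym q)) (+-suc-∸ l))) (+-comm 1 (toℕ j)))

      hole : Hole G
      hole = record
        { k = k ; 3≤k = 4≤ ; cyc = rim ; cyc-inj = rim-inj
        ; chordless = λ i j e → case <-cmp (toℕ i) (toℕ j) of λ
            { (tri< l _ _) → up l e
            ; (tri≈ _ q _) → ⊥-elim (∼-irrefl e (cong F q))
            ; (tri> _ _ l) → swap (up l (∼-sym e)) }
        ; cycle = λ i → subst (rim i ∼_) (trans (cong F (+-comm 1 (toℕ i))) (sym (rim-mod (toℕ i + 1)))) (F-step (toℕ i)) }

      seg-list : ∀ A B → A ++ B ≡ H → seg (length A) (length B) ≡ B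
      seg-list A [] e = refl
      seg-list A (b ∷ B) e = cong₂ _∷_ (F-at 0 A (sym e))
        (trans (cong (λ t → seg t (length B)) (trans (+-comm 1 (length A)) (sym (length-++ A))))
          (seg-list (A ++ b ∷ []) B (trans (++-assoc A (b ∷ []) B) e)))

      rim-list : tabulate rim ≡ H
      rim-list = trans (sym (seg-tabulate 0 K)) (seg-list [] H refl)

      count : ∀ v → nbrCount G v rim ≡ cnt v H
      count v = trans (nbrCount-cnt v rim) (cong (cnt v) rim-list)

      rim-∈ : ∀ t → rim t ∈ H
      rim-∈ t = subst (rim t ∈_) (seg-list [] H refl) (seg-∈ 0 K (toℕ t) z≤n (Finₚ.toℕ<n t))

      ∈-rim : ∀ {w} → w ∈ H → ∃[ t ] w ≡ rim t
      ∈-rim {w} i with ∈-seg 0 K (subst (w ∈_) (sym (seg-list [] H refl)) i)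
      ... | t , _ , l , e = fromℕ< l , trans e (cong F (sym (Finₚ.toℕ-fromℕ< l)))

      wheel : Wheel G
      wheel = record { hole = hole ; center = x
        ; center∉C = λ t e → x∉ (subst (_∈ H) e (rim-∈ t))
        ; 3spokes = subst (3 ≤_) (sym (count x)) 3≤ }

      module _ {e I s R} (rt : Rot H (e ∷ I ++ s ∷ R)) (xe : x ∼ e) (xs : x ∼ s) (nI : NoN x I) where
        private
          j : ℕ
          j = proj₁ (rot-spin rt)
          spin-j : e ∷ I ++ s ∷ R ≡ spin j H
          spin-j = proj₂ (rot-spin rt)
          start : Fin K
          start = j mod K
          F-start : ∀ t → rim (start ⊕ t) ≡ F (j + t)
          F-start t = trans (rim-mod (toℕ start + t)) (trans (cong (λ u → F (u + t)) (Finₚ.toℕ-fromℕ< (m%n<n j K)))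
            (trans (sym (F-periods (j / K) (j % K + t))) (cong F (trans (+-assoc (j % K) t _)
              (trans (cong (j % K +_) (+-comm t _)) (trans (sym (+-assoc (j % K) _ t))
                (cong (_+ t) (sym (m≡m%n+[m/n]*n j K)))))))))
          at : ∀ A {w B} → A ++ w ∷ B ≡ e ∷ I ++ s ∷ R → rim (start ⊕ length A) ≡ w
          at A q = trans (F-start (length A)) (F-at j A (trans (sym spin-j) (sym q)))

        sector : Sector G wheel
        sector = record
          { start = start ; d = suc (length I) ; 1≤d = s≤s z≤n
          ; d≤k = subst (suc (length I) ≤_) len (subst (_≤ length I + suc (length R)) (+-comm (length I) 1) (+-monoʳ-≤ (length I) (s≤s z≤n)))
          ; spoke-start = subst (x ∼_) (sym start≡) xe
          ; spoke-end = subst (x ∼_) (sym (at (e ∷ I) refl)) xs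
          ; no-spoke = none }
          where
          len : length I + suc (length R) ≡ k
          len = trans (sym (length-++ I)) (suc-injective (sym (length-rot rt)))
          start≡ : rim start ≡ e
          start≡ = trans (rim-mod j) (cong (hd h) (sym spin-j))
          none : ∀ t → 1 ≤ t → t < suc (length I) → ¬ x ∼ rim (start ⊕ t)
          none (suc t) _ (s≤s l) q with split-at I t l
          ... | A , w , B , refl , refl = nI (∈-++⁺ʳ A (here refl)) (subst (x ∼_) (at (e ∷ A) (cong (e ∷_) (sym (++-assoc A (w ∷ B) (s ∷ R))))) q)

        in-sector : ∀ {v} → NoN v R → ∀ t → v ∼ rim t → InSecIdx G wheel sector t
        in-sector nR t vt with rot-∈ rt (rim-∈ t)
        ... | here q = 0 , z≤n , rim-inj (trans q (sym (at [] refl)))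
        ... | there i with ∈-++⁻ I i
        ... | inj₂ (here q) = suc (length I) , ≤-refl , rim-inj (trans q (sym (at (e ∷ I) refl)))
        ... | inj₂ (there i′) = ⊥-elim (nR i′ vt)
        ... | inj₁ i′ with ∈-∃++ i′
        ... | A , B , refl = suc (length A) , s≤s (subst (length A ≤_) (sym (length-++ A)) (m≤m+n (length A) _)) ,
                rim-inj (sym (at (e ∷ A) (cong (e ∷_) (sym (++-assoc A (rim t ∷ B) (s ∷ R))))))

    private
      few : ∀ {v} → Good x (h ∷ p) v → 3 ≤ nbrCount G v rim → v ∼ x
      few (_ , _ , _ , _ , _ , _ , _ , inj₁ e) _ = ∼-sym e
      few {v} (g , M , g′ , U , rt , nM , _ , inj₂ nU) l = ⊥-elim (<⇒≱ l (subst (_≤ 2) (sym (trans (count v) (cnt-rot v rt)))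
        (≤-trans (cnt-∷≤ v g (M ++ g′ ∷ U)) (s≤s (subst (_≤ 1) (sym (trans (cnt-++ v M) (cong (_+ cnt v (g′ ∷ U)) (cnt-none M nM))))
          (≤-trans (cnt-∷≤ v g′ U) (s≤s (≤-reflexive (cnt-none U nU)))))))))

      -- All spokes lie on `g M g′`. From the last of them, `e`, through `U` and round to the first,
      -- `s`, runs one sector; it contains `g′ U g` and hence all neighbours of `v`.
      one-sector : ∀ {v} → Good x (h ∷ p) v → ∃[ S ] (∀ t → v ∼ rim t → InSecIdx G wheel S t)
      one-sector {v} (g , M , g′ , U , rt , nM , nU , _) with first x (g ∷ M ++ g′ ∷ [])
      ... | inj₁ none = ⊥-elim (<⇒≱ 3≤ (subst (_≤ 2) (sym (spread (cnt-none (g ∷ M ++ g′ ∷ []) none))) z≤n))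
        where
        spread : ∀ {c} → cnt x (g ∷ M ++ g′ ∷ []) ≡ c → cnt x H ≡ c
        spread q = trans (cnt-rot x rt) (trans (cong (λ l → cnt x (g ∷ l)) (sym (++-assoc M (g′ ∷ []) U)))
          (trans (cnt-++ x (g ∷ M ++ g′ ∷ [])) (trans (cong₂ _+_ q (cnt-none U nU)) (+-identityʳ _))))
      ... | inj₂ (L , s , T , eq , nL , xs) with last x T
      ... | inj₁ none = ⊥-elim (<⇒≱ 3≤ (subst (_≤ 2) (sym (trans (cnt-rot x rt) total)) (s≤s z≤n)))
        where
        total : cnt x (g ∷ M ++ g′ ∷ U) ≡ 1
        total = trans (cong (λ l → cnt x (g ∷ l)) (sym (++-assoc M (g′ ∷ []) U)))
          (trans (cnt-++ x (g ∷ M ++ g′ ∷ [])) (cong₂ _+_ (trans (cong (cnt x) eq) (trans (cnt-++ x L)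
            (cong₂ _+_ (cnt-none L nL) (trans (cnt-yes T xs) (cong suc (cnt-none T none)))))) (cnt-none U nU)))
      ... | inj₂ (T₁ , e , T₂ , refl , nT , xe) =
        sector rt′ xe xs nI , in-sector rt′ xe xs nI (λ i → nM (∈-inner L T₁ M (sym eq) i))
        where
        rt′ : Rot H (e ∷ (T₂ ++ U ++ L) ++ s ∷ T₁)
        rt′ = rot-trans rt (subst₂ Rot
          (trans (same ((⟨ L ⟩ ⊹ s ◂ ⟨ T₁ ⟩) ⊹ e ◂ ⟨ T₂ ⟩ ⊹ ⟨ U ⟩) ((⟨ L ⟩ ⊹ s ◂ ⟨ T₁ ⟩ ⊹ e ◂ ⟨ T₂ ⟩) ⊹ ⟨ U ⟩) refl)
            (trans (cong (_++ U) (sym eq)) (flat ((g ◂ ⟨ M ⟩ ⊹ g′ ◂ ⟨ [] ⟩) ⊹ ⟨ U ⟩))))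
          (same ((e ◂ ⟨ T₂ ⟩ ⊹ ⟨ U ⟩) ⊹ ⟨ L ⟩ ⊹ s ◂ ⟨ T₁ ⟩) (e ◂ (⟨ T₂ ⟩ ⊹ ⟨ U ⟩ ⊹ ⟨ L ⟩) ⊹ s ◂ ⟨ T₁ ⟩) refl)
          (rot-swap (L ++ s ∷ T₁)))
        nI : NoN x (T₂ ++ U ++ L)
        nI = NoN-++ T₂ nT (NoN-++ U nU nL)

    proper-wheel : (∀ v → v ∉ h ∷ p → v ≢ x → Good x (h ∷ p) v) →
      ∃[ W ] (Wheel.center W ≡ x × Proper G W × numSpokes G W ≡ cnt x (h ∷ p))
    proper-wheel good = wheel , refl , proper , count x
      where
      proper : Proper G wheel
      proper v with v Finₚ.≟ x | v ∈? (h ∷ p)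
      ... | yes e | _ = inj₁ (inj₁ e)
      ... | no _ | yes i = inj₁ (inj₂ (∈-rim i))
      ... | no v≢ | no v∉ = inj₂ (one-sector (good v v∉ v≢) , few (good v v∉ v≢))

-- Small configurations at a vertex outside a ring, and legs starting at the next spoke.

module Local (G : Graph) (isk : ISK4-free G) (dia : Diamond-free G) (bow : Bowtie-free G) where
  open Paths G
  open Hub G

  diamond : ∀ {u v c d} → u ∼ v → u ∼ c → u ∼ d → v ∼ c → v ∼ d → c # d → ⊥
  diamond uv uc ud vc vd (c≢d , ¬cd) = dia (record
    { u = _ ; v = _ ; c = _ ; d = _ ; c≢d = c≢d ; uv = uv ; uc = uc ; ud = ud ; vc = vc ; vd = vd ; ¬cd = ¬cd })

  bowtie : ∀ {v a b c d} → v ∼ a → v ∼ b → v ∼ c → v ∼ d → a ∼ b → c ∼ d →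
    a # c → a # d → b # c → b # d → ⊥
  bowtie {v} {a} {b} {c} {d} va vb vc vd ab cd ac ad bc bd = bow (record
    { w = v
    ; a = λ { 0F → a ; 1F → b }
    ; b = λ { 0F → c ; 1F → d }
    ; a-inj = λ { {0F} {0F} _ → refl ; {0F} {1F} e → ⊥-elim (∼-irrefl ab e)
                ; {1F} {0F} e → ⊥-elim (∼-irrefl ab (sym e)) ; {1F} {1F} _ → refl }
    ; b-inj = λ { {0F} {0F} _ → refl ; {0F} {1F} e → ⊥-elim (∼-irrefl cd e)
                ; {1F} {0F} e → ⊥-elim (∼-irrefl cd (sym e)) ; {1F} {1F} _ → refl }
    ; ab-dist = λ { 0F 0F → proj₁ ac ; 0F 1F → proj₁ ad ; 1F 0F → proj₁ bc ; 1F 1F → proj₁ bd }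
    ; wa = λ { 0F → va ; 1F → vb }
    ; wb = λ { 0F → vc ; 1F → vd }
    ; aa = ab ; bb = cd
    ; ¬ab = λ { 0F 0F → proj₂ ac ; 0F 1F → proj₂ ad ; 1F 0F → proj₂ bc ; 1F 1F → proj₂ bd } })

  -- The fourth ring vertex `u` keeps `a` and `c` nonadjacent, so they form a diamond with the edge
  -- `v b`.
  three-in-row : ∀ {v a b c u Z} → Cyc (a ∷ b ∷ c ∷ Z) → u ∈ Z → v ∼ a → v ∼ b → v ∼ c → ⊥
  three-in-row {Z = d ∷ Y} k _ va vb vc =
    diamond vb va vc (∼-sym (cyc-adj k)) (cyc-adj-at (_ ∷ []) k) (cyc-apart [] k)

  -- The two triangles at `v` form a bowtie if no ring edge joins `a b` to `c d`; otherwise `v` has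
  -- three consecutive neighbours.
  two-edges : ∀ {v a b} X {c d} Y → Cyc (a ∷ b ∷ X ++ c ∷ d ∷ Y) → v ∼ a → v ∼ b → v ∼ c → v ∼ d → ⊥
  two-edges [] Y k va vb vc vd = three-in-row k (here refl) va vb vc
  two-edges {v} {a} {b} (x ∷ X) {c} {d} [] k va vb vc vd =
    three-in-row (cyc-rot (a ∷ b ∷ x ∷ X ++ c ∷ []) (subst Cyc (sym (flat ((a ◂ b ◂ x ◂ ⟨ X ⟩ ⊹ c ◂ ⟨ [] ⟩) ⊹ d ◂ ⟨ [] ⟩))) k)) (here refl) vd va vb
  two-edges {v} {a} {b} (x ∷ X) {c} {d} (y ∷ Y) k va vb vc vd =
    bowtie va vb vc vd (cyc-adj k) (cyc-adj-at (a ∷ b ∷ x ∷ X) k)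
      (cyc-apart (x ∷ X) k)
      (cyc-apart (x ∷ X ++ c ∷ []) (subst Cyc (sym (flat (a ◂ b ◂ x ◂ (⟨ X ⟩ ⊹ c ◂ ⟨ [] ⟩) ⊹ d ◂ y ◂ ⟨ Y ⟩))) k))
      (cyc-apart X k′)
      (cyc-apart (X ++ c ∷ []) (subst Cyc (same (b ◂ x ◂ ⟨ X ⟩ ⊹ c ◂ d ◂ y ◂ ⟨ Y ⟩ ⊹ a ◂ ⟨ [] ⟩)
        (b ◂ x ◂ (⟨ X ⟩ ⊹ c ◂ ⟨ [] ⟩) ⊹ d ◂ y ◂ ⟨ Y ⟩ ⊹ a ◂ ⟨ [] ⟩) refl) k′))
    where
    k′ : Cyc (b ∷ x ∷ X ++ c ∷ d ∷ y ∷ Y ++ a ∷ [])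
    k′ = subst Cyc (flat ((b ◂ x ◂ ⟨ X ⟩ ⊹ c ◂ d ◂ y ◂ ⟨ Y ⟩) ⊹ a ◂ ⟨ [] ⟩)) (cyc-rot₁ k)

  off-of : ∀ {v l} → v ∉ l → NoN v l → Off v l
  off-of v∉ f i = (λ { refl → v∉ i }) , f i

  -- The vertex `w` of `U` makes `g M g′` a proper arc and hence an induced path; with `U` empty,
  -- `g′ g` would be an edge of the ring.
  gap-ring : ∀ {v g} M {g′ U w} → Cyc (g ∷ M ++ g′ ∷ U) → w ∈ U → v ∉ g ∷ M ++ g′ ∷ U →
    v ∼ g → v ∼ g′ → NoN v M → Cyc (v ∷ g ∷ M ++ g′ ∷ [])
  gap-ring {v} {g} M {g′} {U} w∈ i v∉ vg vg′ nM = mkCyc M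
    (cyc-arc (g ∷ M ++ g′ ∷ []) i (subst Cyc (sym (flat ((g ◂ ⟨ M ⟩ ⊹ g′ ◂ ⟨ [] ⟩) ⊹ ⟨ U ⟩))) w∈))
    vg vg′ (off-of (λ j → v∉ (there (∈-++⁺ˡ j))) nM)

  leg : ∀ {x e} U {s} → IPath (e ∷ U ++ s ∷ []) → x ∼ s → x ∉ e ∷ U ++ s ∷ [] → NoN x (e ∷ U) →
    IPath (x ∷ (s ∷ reverse U) ++ e ∷ [])
  leg {x} {e} U {s} p xs x∉ nx = link xs off (subst IPath eq (ip-reverse p))
    where
    eq : reverse (e ∷ U ++ s ∷ []) ≡ s ∷ reverse U ++ e ∷ []
    eq = trans (rev-∷ e (U ++ s ∷ [])) (cong (_++ e ∷ []) (rev-snoc U s))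
    off : Off x (reverse U ++ e ∷ [])
    off i with ∈-++⁻ (reverse U) i
    ... | inj₁ j = (λ { refl → x∉ (there (∈-++⁺ˡ (∈-rev {l = U} j))) }) , nx (there (∈-rev j))
    ... | inj₂ (here refl) = (λ { refl → x∉ (here refl) }) , nx (here refl)

  ∈-leg : ∀ {s l : V G} U → l ∈ s ∷ reverse U → l ∈ U ++ s ∷ []
  ∈-leg U (here refl) = ∈-++⁺ʳ U (here refl)
  ∈-leg U (there i) = ∈-++⁺ˡ (∈-rev {l = U} i)

  -- Replacing `o` by `v` changes neither the spoke number nor the length, so minimality says
  -- nothing here. If `v` sees `o`, or `x` sees `g` or `g′`, there is a diamond. Otherwise `x` sees
  -- `o` and `v` on the square `g o g′ v`, and the first spoke on `M` starts a leg to `g`.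
  twin : ∀ {x v g} M {g′ o} → Cyc (g ∷ M ++ g′ ∷ o ∷ []) → x ∉ g ∷ M ++ g′ ∷ o ∷ [] → v ∉ g ∷ M ++ g′ ∷ o ∷ [] →
    v ∼ g → v ∼ g′ → NoN v M → x ∼ v → x ∼ o → 3 ≤ cnt x (g ∷ M ++ g′ ∷ []) → ⊥
  twin {x} {v} {g} M {g′} {o} k x∉ v∉ vg vg′ nM xv xo three
    with v ∼? o | x ∼? g | x ∼? g′ | first x M
  ... | yes vo | _ | _ | _ = diamond vo vg vg′ og og′ (g#g′ M refl)
    where
    og : o ∼ g
    og = ∼-sym (cyc-close (M ++ g′ ∷ []) (subst Cyc (sym (flat (g ◂ (⟨ M ⟩ ⊹ g′ ◂ ⟨ [] ⟩) ⊹ o ◂ ⟨ [] ⟩))) k))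
    og′ : o ∼ g′
    og′ = ∼-sym (cyc-adj-at (g ∷ M) k)
    g#g′ : ∀ N → N ≡ M → g # g′
    g#g′ [] refl = ⊥-elim (<⇒≱ three (≤-trans (cnt-≤length x (g ∷ g′ ∷ [])) ≤-refl))
    g#g′ (m ∷ N) refl = cyc-apart N k
  ... | no ¬vo | yes xg | _ | _ = diamond xg xo xv (cyc-close (M ++ g′ ∷ []) (subst Cyc (sym (flat (g ◂ (⟨ M ⟩ ⊹ g′ ◂ ⟨ [] ⟩) ⊹ o ◂ ⟨ [] ⟩))) k)) (∼-sym vg)
          ((λ { refl → v∉ (there (∈-++⁺ʳ M (there (here refl)))) }) , λ e → ¬vo (∼-sym e))
  ... | no ¬vo | no _ | yes xg′ | _ = diamond xg′ xo xv (cyc-adj-at (g ∷ M) k) (∼-sym vg′)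
          ((λ { refl → v∉ (there (∈-++⁺ʳ M (there (here refl)))) }) , λ e → ¬vo (∼-sym e))
  ... | no ¬vo | no ¬xg | no ¬xg′ | inj₁ none =
          <⇒≱ three (subst (_≤ 2) (sym (cnt-none (g ∷ M ++ g′ ∷ []) (NoN-∷ ¬xg (NoN-++ M none (NoN-∷ ¬xg′ λ ()))))) z≤n)
  ... | no ¬vo | no ¬xg | no ¬xg′ | inj₂ (W , s , [] , refl , nW , xs) =
          <⇒≱ three (subst (_≤ 2) (sym (trans (cnt-no ((W ++ s ∷ []) ++ g′ ∷ []) ¬xg) (trans (cong (cnt x) (flat ((⟨ W ⟩ ⊹ s ◂ ⟨ [] ⟩) ⊹ g′ ◂ ⟨ [] ⟩)))
            (trans (cnt-++ x W) (cong₂ _+_ (cnt-none W nW) (trans (cnt-yes (g′ ∷ []) xs) (cong suc (cnt-no [] ¬xg′)))))))) (s≤s z≤n))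
  -- All three spokes lie on `M`, so the first, `s`, is followed there by `t`, which keeps the leg
  -- away from `g′`.
  ... | no ¬vo | no ¬xg | no ¬xg′ | inj₂ (W , s , t ∷ R , refl , nW , xs) =
    hub isk {x} {g} {o ∷ g′ ∷ v ∷ []} (s ∷ reverse W) square
      (λ { (here refl) → x∉ (there (∈-++⁺ʳ (W ++ s ∷ t ∷ R) (there (here refl))))
         ; (there (here refl)) → x∉ (there (∈-++⁺ʳ (W ++ s ∷ t ∷ R) (here refl)))
         ; (there (there (here e))) → ∼-irrefl xv e })
      (trans (cnt-yes (g′ ∷ v ∷ []) xo) (cong suc (trans (cnt-no (v ∷ []) ¬xg′) (cnt-yes [] xv))))
      (leg W (ip-++ʳ (g′ ∷ o ∷ []) arc) xs (λ i → x∉ (sub (∈-++⁺ʳ (g′ ∷ o ∷ []) i))) (NoN-∷ ¬xg nW))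
      (λ l∈ → Off-∷ (#-sym (ip-cross (g′ ∷ o ∷ []) arc (there (here refl)) (∈-leg W l∈)))
             (Off-∷ (#-sym (ip-cross (g′ ∷ o ∷ []) arc (here refl) (∈-leg W l∈)))
             (Off-∷ (#-sym (v-off (∈-leg W l∈))) λ ())))
    where
    k′ : Cyc (g′ ∷ o ∷ g ∷ W ++ s ∷ t ∷ R)
    k′ = cyc-rot (g ∷ W ++ s ∷ t ∷ R) k
    arc : IPath (g′ ∷ o ∷ g ∷ W ++ s ∷ [])
    arc = cyc-arc (g′ ∷ o ∷ g ∷ W ++ s ∷ []) (here refl)
      (subst Cyc (sym (flat ((g′ ◂ o ◂ g ◂ ⟨ W ⟩ ⊹ s ◂ ⟨ [] ⟩) ⊹ t ◂ ⟨ R ⟩))) k′)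
    sub : ∀ {w} → w ∈ g′ ∷ o ∷ g ∷ W ++ s ∷ [] → w ∈ g ∷ (W ++ s ∷ t ∷ R) ++ g′ ∷ o ∷ []
    sub (here refl) = there (∈-++⁺ʳ (W ++ s ∷ t ∷ R) (here refl))
    sub (there (here refl)) = there (∈-++⁺ʳ (W ++ s ∷ t ∷ R) (there (here refl)))
    sub (there (there (here refl))) = here refl
    sub (there (there (there i))) with ∈-++⁻ W i
    ... | inj₁ j = there (∈-++⁺ˡ (∈-++⁺ˡ j))
    ... | inj₂ (here refl) = there (∈-++⁺ˡ (∈-++⁺ʳ W (here refl)))
    v-off : Off v (W ++ s ∷ [])
    v-off i = (λ { refl → v∉ (sub (∈-++⁺ʳ (g′ ∷ o ∷ g ∷ []) i)) }) ,
      nM (case ∈-++⁻ W i of λ { (inj₁ j) → ∈-++⁺ˡ j ; (inj₂ (here refl)) → ∈-++⁺ʳ W (here refl) })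
    square : Cyc (g ∷ o ∷ g′ ∷ v ∷ [])
    square = mkCyc (g′ ∷ [])
      (link (∼-sym (cyc-adj k′)) (λ { (here refl) → (λ { refl → v∉ (sub (there (here refl))) }) , λ e → ¬vo (∼-sym e) })
        (link (∼-sym vg′) (λ ()) [-]))
      (∼-sym (cyc-adj-at (g′ ∷ []) k′)) (∼-sym vg)
      (λ { (here refl) → #-sym (ip-cross (g′ ∷ []) arc (here refl) (here refl)) })

  -- The successor `t` matters: a leg that enters `U` at its first spoke stays clear of the far end
  -- of the gap.
  first₂ : ∀ x U → 2 ≤ cnt x U → ∃[ A ] ∃[ s ] ∃[ t ] ∃[ B ] (U ≡ A ++ s ∷ t ∷ B × NoN x A × x ∼ s)
  first₂ x U two with first x U
  ... | inj₁ none = ⊥-elim (<⇒≱ two (subst (_≤ 1) (sym (cnt-none U none)) z≤n))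
  ... | inj₂ (A , s , t ∷ B , e , nA , xs) = A , s , t , B , e , nA , xs
  ... | inj₂ (A , s , [] , refl , nA , xs) = ⊥-elim (<⇒≱ two (subst (_≤ 1)
        (sym (trans (cnt-++ x A) (trans (cong (_+ cnt x (s ∷ [])) (cnt-none A nA)) (cnt-yes [] xs)))) ≤-refl))

  -- Side of the gap g M g′ of v on which the ring continues with U: x is a hub of the ring
  -- closed through v, and the first spoke beyond g′ starts a leg ending at g′ or v.
  module _ {x v : V G} (¬xv : ¬ x ∼ v) (x≢v : x ≢ v) where

    Right Left : V G → List (V G) → Set
    Right g′ U =
      (x ∼ g′ × ∃[ A ] ∃[ s ] ∃[ B ] (U ≡ A ++ s ∷ B × NoN x A × x ∼ s × NoN v (A ++ s ∷ [])))
      ⊎ ∃[ w ] ∃[ B ] (U ≡ w ∷ B × v ∼ w)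
    Left g U =
      (x ∼ g × ∃[ B ] ∃[ s ] ∃[ A ] (U ≡ B ++ s ∷ A × NoN x A × x ∼ s × NoN v (s ∷ A)))
      ⊎ ∃[ B ] ∃[ w ] (U ≡ B ++ w ∷ [] × v ∼ w)

    side : ∀ {g} M {g′} U → Cyc (g ∷ M ++ g′ ∷ U) → x ∉ g ∷ M ++ g′ ∷ U → v ∉ g ∷ M ++ g′ ∷ U →
      v ∼ g → v ∼ g′ → NoN v M → cnt x (g ∷ M ++ g′ ∷ []) ≡ 2 → 2 ≤ cnt x U → Right g′ U
    side {g} M {g′} U k x∉ v∉ vg vg′ nM two twoU with first₂ x U twoU
    ... | A , s , t , B , refl , nA , xs with last v (A ++ s ∷ [])
    ... | inj₁ none with x ∼? g′
    ... | yes xg′ = inj₁ (xg′ , A , s , t ∷ B , refl , nA , xs , none)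
    -- With no neighbour of `v` up to `s`, the leg goes from `s` back to `g′`. As `g′` is no spoke,
    -- both spokes of the ring through `v` are elsewhere on it.
    ... | no ¬xg′ = ⊥-elim (hub isk {x} {g′} {v ∷ g ∷ M} (s ∷ reverse A)
          (cyc-rot (v ∷ g ∷ M) (gap-ring M k (∈-++⁺ʳ A (here refl)) v∉ vg vg′ nM))
          (λ { (here e) → x≢v e ; (there i) → x∉ (∈-++⁺ˡ i) })
          (trans (cnt-no (g ∷ M) ¬xv) (trans (sym (+-identityʳ _)) (trans (cong (cnt x (g ∷ M) +_) (sym (cnt-no [] ¬xg′)))
            (trans (sym (cnt-++ x (g ∷ M))) two))))
          (leg A (ip-++ʳ (g ∷ M) arc) xs (λ i → x∉ (sub (∈-++⁺ʳ (g ∷ M) i))) (NoN-∷ ¬xg′ nA))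
          (λ l∈ → Off-∷ (#-sym (v# (∈-leg A l∈))) (λ i → #-sym (ip-cross (g ∷ M) arc i (∈-leg A l∈)))))
      where
      arc : IPath ((g ∷ M) ++ g′ ∷ A ++ s ∷ [])
      arc = cyc-arc (g ∷ M ++ g′ ∷ A ++ s ∷ []) (here refl)
        (subst Cyc (sym (flat ((g ◂ ⟨ M ⟩ ⊹ g′ ◂ ⟨ A ⟩ ⊹ s ◂ ⟨ [] ⟩) ⊹ t ◂ ⟨ B ⟩))) k)
      sub : ∀ {w} → w ∈ (g ∷ M) ++ g′ ∷ A ++ s ∷ [] → w ∈ g ∷ M ++ g′ ∷ A ++ s ∷ t ∷ B
      sub i = ∈-cast (flat ((g ◂ ⟨ M ⟩ ⊹ g′ ◂ ⟨ A ⟩ ⊹ s ◂ ⟨ [] ⟩) ⊹ t ◂ ⟨ B ⟩)) (∈-++⁺ˡ i)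
      v# : Off v (A ++ s ∷ [])
      v# i = (λ { refl → v∉ (sub (there (∈-++⁺ʳ M (there i)))) }) , none i
    side {g} M {g′} U k x∉ v∉ vg vg′ nM two twoU
      | A , s , t , B , refl , nA , xs | inj₂ ([] , w , W , e , nW , vw) = inj₂ (w , W ++ t ∷ B ,
          trans (sym (++-assoc A (s ∷ []) (t ∷ B))) (cong (_++ t ∷ B) e) , vw)
    side {g} M {g′} U k x∉ v∉ vg vg′ nM two twoU
      | A , s , t , B , refl , nA , xs | inj₂ (c ∷ C , w , W , e , nW , vw) with snoc-view w W
    -- The last neighbour `w` of `v` up to `s` is separated from `g′` by `c`, so the leg goes from
    -- `s` back to `w` and on to `v` itself.
    ... | I , b , e′ = ⊥-elim (hub isk {x} {v} {g ∷ M ++ g′ ∷ []} (s ∷ reverse I)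
          (gap-ring M k (∈-++⁺ʳ A (here refl)) v∉ vg vg′ nM)
          (λ i → x∉ (sub (∈-cast (flat ((g ◂ ⟨ M ⟩ ⊹ g′ ◂ ⟨ [] ⟩) ⊹ ⟨ A ⟩ ⊹ s ◂ ⟨ [] ⟩)) (∈-++⁺ˡ i))))
          two
          (leg I ipv xs x∉v (NoN-∷ ¬xv (λ i → nA (∈-cast (sym A≡) (∈-++⁺ʳ (c ∷ C) i)))))
          (λ l∈ i → #-sym (ip-cross (g ∷ M ++ g′ ∷ []) arc′ i (∈-++⁺ʳ C (∈-leg I l∈)))))
      where
      eqs : A ++ s ∷ [] ≡ ((c ∷ C) ++ I) ++ b ∷ []
      eqs = trans e (trans (cong ((c ∷ C) ++_) e′) (sym (++-assoc (c ∷ C) I (b ∷ []))))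
      A≡ : A ≡ (c ∷ C) ++ I
      A≡ = ∷ʳ-injectiveˡ A ((c ∷ C) ++ I) eqs
      s≡ : b ≡ s
      s≡ = sym (∷ʳ-injectiveʳ A ((c ∷ C) ++ I) eqs)
      w≡ : w ∷ W ≡ I ++ s ∷ []
      w≡ = trans e′ (cong (λ u → I ++ u ∷ []) s≡)
      arc : IPath (g ∷ M ++ g′ ∷ A ++ s ∷ [])
      arc = cyc-arc (g ∷ M ++ g′ ∷ A ++ s ∷ []) (here refl)
        (subst Cyc (sym (flat ((g ◂ ⟨ M ⟩ ⊹ g′ ◂ ⟨ A ⟩ ⊹ s ◂ ⟨ [] ⟩) ⊹ t ◂ ⟨ B ⟩))) k)
      sub : ∀ {w} → w ∈ g ∷ M ++ g′ ∷ A ++ s ∷ [] → w ∈ g ∷ M ++ g′ ∷ A ++ s ∷ t ∷ B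
      sub i = ∈-cast (flat ((g ◂ ⟨ M ⟩ ⊹ g′ ◂ ⟨ A ⟩ ⊹ s ◂ ⟨ [] ⟩) ⊹ t ◂ ⟨ B ⟩)) (∈-++⁺ˡ i)
      arc′ : IPath ((g ∷ M ++ g′ ∷ []) ++ c ∷ C ++ I ++ s ∷ [])
      arc′ = subst IPath (trans (cong (λ l → g ∷ M ++ g′ ∷ l ++ s ∷ []) A≡)
        (same (g ◂ ⟨ M ⟩ ⊹ g′ ◂ (c ◂ ⟨ C ⟩ ⊹ ⟨ I ⟩) ⊹ s ◂ ⟨ [] ⟩) ((g ◂ ⟨ M ⟩ ⊹ g′ ◂ ⟨ [] ⟩) ⊹ c ◂ ⟨ C ⟩ ⊹ ⟨ I ⟩ ⊹ s ◂ ⟨ [] ⟩) refl)) arc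
      I∈ : ∀ {u} → u ∈ I ++ s ∷ [] → u ∈ A ++ s ∷ []
      I∈ i = ∈-cast (sym (trans e (cong ((c ∷ C) ++_) w≡))) (∈-++⁺ʳ (c ∷ C) i)
      in-ring : ∀ {u} → u ∈ I ++ s ∷ [] → u ∈ g ∷ M ++ g′ ∷ A ++ s ∷ t ∷ B
      in-ring i = sub (there (∈-++⁺ʳ M (there (I∈ i))))
      ipv : IPath (v ∷ I ++ s ∷ [])
      ipv = subst (λ l → IPath (v ∷ l)) w≡ (link vw
        (off-of (λ i → v∉ (in-ring (∈-cast w≡ (there i)))) nW)
        (subst IPath (sym w≡) (ip-++ʳ C (ip-tail (ip-++ʳ (g ∷ M ++ g′ ∷ []) arc′)))))
      x∉v : x ∉ v ∷ I ++ s ∷ []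
      x∉v (here q) = x≢v q
      x∉v (there i) = x∉ (in-ring i)

    side-left : ∀ {g} M {g′} U → Cyc (g ∷ M ++ g′ ∷ U) → x ∉ g ∷ M ++ g′ ∷ U → v ∉ g ∷ M ++ g′ ∷ U →
      v ∼ g → v ∼ g′ → NoN v M → cnt x (g ∷ M ++ g′ ∷ []) ≡ 2 → 2 ≤ cnt x U → Left g U
    side-left {g} M {g′} U k x∉ v∉ vg vg′ nM two twoU =
      mirror (side (reverse M) (reverse U) kr
        (λ i → x∉ (back i)) (λ i → v∉ (back i)) vg′ vg (λ i → nM (∈-rev i))
        (trans (cong (cnt x) (sym eq₂)) (trans (cnt-reverse x (g ∷ M ++ g′ ∷ [])) two))
        (subst (2 ≤_) (sym (cnt-reverse x U)) twoU))
      where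
      eq : reverse (g ∷ M ++ g′ ∷ U) ≡ reverse U ++ g′ ∷ reverse M ++ g ∷ []
      eq = trans (rev-∷ g (M ++ g′ ∷ U)) (trans (cong (_++ g ∷ []) (rev-mid M g′ U)) (++-assoc (reverse U) _ _))
      eq₂ : reverse (g ∷ M ++ g′ ∷ []) ≡ g′ ∷ reverse M ++ g ∷ []
      eq₂ = trans (rev-∷ g (M ++ g′ ∷ [])) (cong (_++ g ∷ []) (rev-snoc M g′))
      flat-r : (g′ ∷ reverse M ++ g ∷ []) ++ reverse U ≡ g′ ∷ reverse M ++ g ∷ reverse U
      flat-r = flat ((g′ ◂ ⟨ reverse M ⟩ ⊹ g ◂ ⟨ [] ⟩) ⊹ ⟨ reverse U ⟩)
      kr : Cyc (g′ ∷ reverse M ++ g ∷ reverse U)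
      kr = subst Cyc flat-r (cyc-rot (reverse U) (subst Cyc eq (cyc-reverse k)))
      back : ∀ {w} → w ∈ g′ ∷ (reverse M ++ g ∷ reverse U) → w ∈ g ∷ M ++ g′ ∷ U
      back {w} i = ∈-rev (subst (w ∈_) (sym eq) (rot-∈ (rot-swap (g′ ∷ reverse M ++ g ∷ []))
        (subst (w ∈_) (sym flat-r) i)))
      flip : ∀ {L} → reverse U ≡ L → U ≡ reverse L
      flip e = trans (sym (reverse-involutive U)) (cong reverse e)
      mirror : Right g (reverse U) → Left g U
      mirror (inj₁ (xg , A , s , B , e , nA , xs , nv)) = inj₁ (xg , reverse B , s , reverse A ,
        trans (flip e) (rev-mid A s B) , (λ i → nA (∈-rev i)) , xs ,
        λ i → nv (∈-leg A i))
      mirror (inj₂ (w , B , e , vw)) = inj₂ (reverse B , w , trans (flip e) (rev-∷ w B) , vw)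

-- Gaps with at most two spokes, for a vertex `v` not adjacent to `x`.

module TwoGaps (G : Graph) (isk : ISK4-free G) (dia : Diamond-free G) (bow : Bowtie-free G)
  {x v : V G} (¬xv : ¬ Paths._∼_ G x v) (x≢v : x ≢ v) where
  open Paths G
  open Hub G
  open Local G isk dia bow

  Env : List (V G) → Set
  Env l = Cyc l × x ∉ l × v ∉ l × 4 ≤ cnt x l

  env-rot : ∀ {l l′} → Rot l l′ → Env l → Env l′
  env-rot r (k , x∉ , v∉ , four) =
    rot-cyc r k , (λ i → x∉ (rot-∈⁻ r i)) , (λ i → v∉ (rot-∈⁻ r i)) , subst (4 ≤_) (cnt-rot x r) four

  env-reverse : ∀ {l} → Env l → Env (reverse l)
  env-reverse {l} (k , x∉ , v∉ , four) =
    cyc-reverse k , (λ i → x∉ (∈-rev i)) , (λ i → v∉ (∈-rev i)) , subst (4 ≤_) (sym (cnt-reverse x l)) four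

  cnt-gap : ∀ g M g′ U → cnt x (g ∷ M ++ g′ ∷ U) ≡ cnt x (g ∷ M ++ g′ ∷ []) + cnt x U
  cnt-gap g M g′ U = trans (cong (cnt x) (sym (flat ((g ◂ ⟨ M ⟩ ⊹ g′ ◂ ⟨ [] ⟩) ⊹ ⟨ U ⟩)))) (cnt-++ x (g ∷ M ++ g′ ∷ []))

  beyond : ∀ {g} M {g′ U} → Env (g ∷ M ++ g′ ∷ U) → cnt x (g ∷ M ++ g′ ∷ []) ≡ 2 → 2 ≤ cnt x U
  beyond {g} M {g′} {U} (_ , _ , _ , four) two =
    ≤-pred (≤-pred (subst (4 ≤_) (trans (cnt-gap g M g′ U) (cong (_+ cnt x U) two)) four))

  right : ∀ {g} M {g′ U} → Env (g ∷ M ++ g′ ∷ U) → v ∼ g → v ∼ g′ → NoN v M →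
    cnt x (g ∷ M ++ g′ ∷ []) ≡ 2 → Right ¬xv x≢v g′ U
  right M {U = U} env@(k , x∉ , v∉ , _) vg vg′ nM two = side ¬xv x≢v M U k x∉ v∉ vg vg′ nM two (beyond M env two)

  left : ∀ {g} M {g′ U} → Env (g ∷ M ++ g′ ∷ U) → v ∼ g → v ∼ g′ → NoN v M →
    cnt x (g ∷ M ++ g′ ∷ []) ≡ 2 → Left ¬xv x≢v g U
  left M {U = U} env@(k , x∉ , v∉ , _) vg vg′ nM two = side-left ¬xv x≢v M U k x∉ v∉ vg vg′ nM two (beyond M env two)

  -- Both edges `g′ w` and `w′ g` of the ring are seen by `v`. If `U` is a single vertex they share
  -- it: then three neighbours are consecutive, or the ring is too short for four spokes.
  two-triangles : ∀ {g} M {g′ U w B B′ w′} → Env (g ∷ M ++ g′ ∷ U) → v ∼ g → v ∼ g′ →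
    U ≡ w ∷ B → v ∼ w → U ≡ B′ ++ w′ ∷ [] → v ∼ w′ → ⊥
  two-triangles {g} [] {g′} {B′ = []} (_ , _ , _ , four) vg vg′ refl vw e vw′ =
    <⇒≱ four (subst (λ l → cnt x (g ∷ g′ ∷ l) ≤ 3) (sym e) (cnt-≤length x (g ∷ g′ ∷ _ ∷ [])))
  two-triangles {g} (m ∷ M) {g′} {B′ = []} (k , _) vg vg′ refl vw refl vw′ =
    three-in-row (cyc-rot (g ∷ m ∷ M) k) (here refl) vg′ vw vg
  two-triangles {g} M {g′} {w = w} {B′ = b ∷ B′} {w′} (k , _) vg vg′ e vw refl vw′ =
    two-edges B′ M (rot-cyc (rot-turn (g ◂ ⟨ M ⟩) (g′ ◂ b ◂ ⟨ B′ ⟩ ⊹ w′ ◂ ⟨ [] ⟩)) k)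
      vg′ (subst (v ∼_) (sym (∷-injectiveˡ e)) vw) vw′ vg

  spread-gap : ∀ {q O o P w} → x ∼ q → NoN x O → x ∼ o → NoN x P → ∀ c → cnt x (w ∷ []) ≡ c →
    cnt x (q ∷ (O ++ o ∷ P) ++ w ∷ []) ≡ suc (suc c)
  spread-gap {q} {O} {o} {P} {w} xq nO xo nP c e = trans (cnt-yes ((O ++ o ∷ P) ++ w ∷ []) xq) (cong suc
    (trans (cong (cnt x) (flat ((⟨ O ⟩ ⊹ o ◂ ⟨ P ⟩) ⊹ w ◂ ⟨ [] ⟩)))
      (trans (cnt-++ x O) (cong₂ _+_ (cnt-none O nO) (trans (cnt-yes (P ++ w ∷ []) xo) (cong suc
        (trans (cnt-++ x P {w ∷ []}) (cong₂ _+_ (cnt-none P nP) e))))))))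

  -- The gap from `q` to `w` has exactly the spokes `q` and `o`. As `w` is no spoke, `right` leaves
  -- only a triangle of `v` just beyond `w`, which clashes with the triangle on the closing edge
  -- `l g`.
  last-edge : ∀ {g} α {q} O {o} P {w} T {l} → Env (g ∷ α ++ q ∷ O ++ o ∷ P ++ w ∷ T ++ l ∷ []) →
    v ∼ g → v ∼ q → v ∼ w → v ∼ l → NoN v (O ++ o ∷ P) →
    x ∼ q → NoN x O → x ∼ o → NoN x P → ¬ x ∼ w → ⊥
  last-edge {g} α {q} O {o} P {w} T {l} env vg vq vw vl nv xq nO xo nP ¬xw
    with right (O ++ o ∷ P) {w} {T ++ l ∷ g ∷ α} (subst Env
           (sym (flat (q ◂ (⟨ O ⟩ ⊹ o ◂ ⟨ P ⟩) ⊹ w ◂ ⟨ T ⟩ ⊹ l ◂ g ◂ ⟨ α ⟩)))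
           (env-rot (rot-turn (g ◂ ⟨ α ⟩) (q ◂ ⟨ O ⟩ ⊹ o ◂ ⟨ P ⟩ ⊹ w ◂ ⟨ T ⟩ ⊹ l ◂ ⟨ [] ⟩)) env))
           vq vw nv (spread-gap xq nO xo nP 0 (cnt-0 ¬xw))
  ... | inj₁ (xw , _) = ¬xw xw
  ... | inj₂ (n , B , e , vn) = go T e k
    where
    k : Cyc (w ∷ T ++ l ∷ g ∷ α ++ q ∷ O ++ o ∷ P)
    k = rot-cyc (rot-turn (g ◂ ⟨ α ⟩ ⊹ q ◂ ⟨ O ⟩ ⊹ o ◂ ⟨ P ⟩) (w ◂ ⟨ T ⟩ ⊹ l ◂ ⟨ [] ⟩)) (proj₁ env)
    go : ∀ T → T ++ l ∷ g ∷ α ≡ n ∷ B → Cyc (w ∷ T ++ l ∷ g ∷ α ++ q ∷ O ++ o ∷ P) → ⊥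
    go [] e k = three-in-row k (∈-++⁺ʳ α (here refl)) vw vl vg
    go (t ∷ T) e k = two-edges T _ k vw (subst (v ∼_) (sym (∷-injectiveˡ e)) vn) vl vg

  -- The gap q O₁ o P w of v around the unique spoke o of O.
  inner-gap : ∀ {g} α {q} O {q′ β} A {s B} → Env (g ∷ α ++ q ∷ O ++ q′ ∷ β) → v ∼ q → v ∼ q′ → cnt x O ≤ 1 →
    x ∼ q → O ++ q′ ∷ β ≡ A ++ s ∷ B → NoN x A → x ∼ s → NoN v (A ++ s ∷ []) →
    ∃[ P ] ∃[ w ] ∃[ Q ] (O ++ q′ ∷ [] ≡ A ++ s ∷ P ++ w ∷ Q × NoN v (A ++ s ∷ P) × NoN x P × v ∼ w × ¬ x ∼ w)
  inner-gap {g} α {q} O {q′} {β} A {s} {B} (k , x∉ , v∉ , _) vq vq′ one xq e nA xs nv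
    with split-before O A e (λ i → nv i vq′)
  ... | O₂ , refl , _ with first v (O₂ ++ q′ ∷ [])
  ... | inj₁ none = ⊥-elim (none (∈-++⁺ʳ O₂ (here refl)) vq′)
  ... | inj₂ (P , w , Q , e′ , nP , vw) = P , w , Q ,
      trans (flat ((⟨ A ⟩ ⊹ s ◂ ⟨ O₂ ⟩) ⊹ q′ ◂ ⟨ [] ⟩)) (cong (λ l → A ++ s ∷ l) e′) ,
      nv′ , nxP , vw , ¬xw
    where
    nv′ : NoN v (A ++ s ∷ P)
    nv′ = NoN-++ A (λ i → nv (∈-++⁺ˡ i)) (NoN-∷ (nv (∈-++⁺ʳ A (here refl))) nP)
    nO₂ : NoN x O₂
    nO₂ = cnt-zero O₂ (n≤0⇒n≡0 (≤-pred (subst (_≤ 1) (trans (cnt-++ x A)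
      (trans (cong (_+ cnt x (s ∷ O₂)) (cnt-none A nA)) (cnt-yes O₂ xs))) one)))
    nxP : NoN x P
    nxP i = nO₂ (∈-front P O₂ (sym e′) i)
    eq : g ∷ α ++ q ∷ (A ++ s ∷ O₂) ++ q′ ∷ β ≡ g ∷ α ++ q ∷ (A ++ s ∷ P) ++ w ∷ Q ++ β
    eq = trans (same (g ◂ ⟨ α ⟩ ⊹ q ◂ (⟨ A ⟩ ⊹ s ◂ ⟨ O₂ ⟩) ⊹ q′ ◂ ⟨ β ⟩) (g ◂ ⟨ α ⟩ ⊹ q ◂ ⟨ A ⟩ ⊹ s ◂ (⟨ O₂ ⟩ ⊹ q′ ◂ ⟨ [] ⟩) ⊹ ⟨ β ⟩) refl)
      (trans (cong (λ l → g ∷ α ++ q ∷ A ++ s ∷ l ++ β) e′)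
        (same (g ◂ ⟨ α ⟩ ⊹ q ◂ ⟨ A ⟩ ⊹ s ◂ (⟨ P ⟩ ⊹ w ◂ ⟨ Q ⟩) ⊹ ⟨ β ⟩) (g ◂ ⟨ α ⟩ ⊹ q ◂ (⟨ A ⟩ ⊹ s ◂ ⟨ P ⟩) ⊹ w ◂ ⟨ Q ⟩ ⊹ ⟨ β ⟩) refl))
    r : Rot (g ∷ α ++ q ∷ (A ++ s ∷ O₂) ++ q′ ∷ β) (q ∷ (A ++ s ∷ P) ++ w ∷ (Q ++ β) ++ g ∷ α)
    r = subst₂ Rot (trans (same ((g ◂ ⟨ α ⟩) ⊹ q ◂ ⟨ A ++ s ∷ P ⟩ ⊹ w ◂ ⟨ Q ⟩ ⊹ ⟨ β ⟩) (g ◂ ⟨ α ⟩ ⊹ q ◂ ⟨ A ++ s ∷ P ⟩ ⊹ w ◂ ⟨ Q ⟩ ⊹ ⟨ β ⟩) refl) (sym eq))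
      (same ((q ◂ ⟨ A ++ s ∷ P ⟩ ⊹ w ◂ ⟨ Q ⟩ ⊹ ⟨ β ⟩) ⊹ g ◂ ⟨ α ⟩) (q ◂ ⟨ A ++ s ∷ P ⟩ ⊹ w ◂ (⟨ Q ⟩ ⊹ ⟨ β ⟩) ⊹ g ◂ ⟨ α ⟩) refl)
      (rot-swap (g ∷ α))
    ¬xw : ¬ x ∼ w
    -- Were `w` a spoke, `x` would have exactly the neighbours `q`, `s` and `w` on the ring through
    -- this gap.
    ¬xw xw = three-spokes isk {x}
      (gap-ring (A ++ s ∷ P) (rot-cyc r k) (∈-++⁺ʳ (Q ++ β) (here refl)) (λ i → v∉ (rot-∈⁻ r i)) vq vw nv′)
      (λ { (here refl) → x≢v refl
         ; (there i) → x∉ (rot-∈⁻ r (∈-cast (flat ((q ◂ ⟨ A ++ s ∷ P ⟩ ⊹ w ◂ ⟨ [] ⟩) ⊹ ⟨ (Q ++ β) ++ g ∷ α ⟩)) (∈-++⁺ˡ i))) })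
      (trans (cnt-no (q ∷ (A ++ s ∷ P) ++ w ∷ []) ¬xv) (spread-gap xq nA xs nxP 1 (cnt-1 xw)))

  -- The list ends in the neighbour `z` of `v`, which a nonempty suffix `α` without neighbours would
  -- have to contain.
  tail-empty : ∀ {y} α → NoN v α → ∀ {X w} → X ++ y ∷ α ≡ w → ∀ {B z} → w ≡ B ++ z ∷ [] → v ∼ z → α ≡ []
  tail-empty [] nα e e′ vz = refl
  tail-empty {y} (a ∷ α) nα {X} refl {B} {z} e′ vz with snoc-view a α
  ... | I , b , e = ⊥-elim (nα (subst (_∈ a ∷ α) (sym z≡) (∈-cast (sym e) (∈-++⁺ʳ I (here refl)))) vz)
    where
    z≡ : z ≡ b
    z≡ = ∷ʳ-injectiveʳ B (X ++ y ∷ I) (trans (sym e′) (trans (cong (λ l → X ++ y ∷ l) e) (sym (++-assoc X (y ∷ I) (b ∷ [])))))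

  -- The two-spoke gap `y α q` is examined at both ends. Triangles at both ends are excluded. If `q`
  -- is a spoke instead, `inner-gap` gives a second two-spoke gap, starting at `q`, and examining
  -- its ends refutes every remaining case.
  half : ∀ {y} α {q} O {q′} β → Env (y ∷ α ++ q ∷ O ++ q′ ∷ β) → v ∼ y → v ∼ q → v ∼ q′ →
    NoN v α → NoN v β → cnt x (y ∷ α ++ q ∷ []) ≡ 2 → cnt x O ≤ 1 →
    x ∼ y × ∃[ w ] ∃[ B ] (O ++ q′ ∷ [] ≡ w ∷ B × v ∼ w)
  half {y} α {q} O {q′} β env vy vq vq′ nα nβ two one
    with right α env vy vq nα two | left α env vy vq nα two
  ... | inj₂ (w , B , e , vw) | inj₁ (xy , _) = xy , hd O e
    where
    hd : ∀ O → O ++ q′ ∷ β ≡ w ∷ B → ∃[ w ] ∃[ B ] (O ++ q′ ∷ [] ≡ w ∷ B × v ∼ w)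
    hd [] e = q′ , [] , refl , vq′
    hd (o ∷ O) e = o , O ++ q′ ∷ [] , refl , subst (v ∼_) (sym (∷-injectiveˡ e)) vw
  ... | inj₂ (w , B , e , vw) | inj₂ (B′ , w′ , e′ , vw′) = ⊥-elim (two-triangles α env vy vq e vw e′ vw′)
  ... | inj₁ (xq , A , s , B , e , nA , xs , nv) | L with inner-gap α O A env vq vq′ one xq e nA xs nv
  ... | P , w , Q , eO , nvP , nxP , vw , ¬xw = ⊥-elim (go L)
    where
    env′ : Env (y ∷ α ++ q ∷ A ++ s ∷ P ++ w ∷ Q ++ β)
    env′ = subst Env (trans (sym (flat (y ◂ ⟨ α ⟩ ⊹ q ◂ (⟨ O ⟩ ⊹ q′ ◂ ⟨ [] ⟩) ⊹ ⟨ β ⟩)))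
      (trans (cong (λ l → y ∷ α ++ q ∷ l ++ β) eO) (flat (y ◂ ⟨ α ⟩ ⊹ q ◂ (⟨ A ⟩ ⊹ s ◂ ⟨ P ⟩ ⊹ w ◂ ⟨ Q ⟩) ⊹ ⟨ β ⟩)))) env
    close : ∀ Q → O ++ q′ ∷ [] ≡ A ++ s ∷ P ++ w ∷ Q → Env (y ∷ α ++ q ∷ A ++ s ∷ P ++ w ∷ Q) → ⊥
    -- Here `w` is `q′` and `β` is empty: `v` has exactly the neighbours `y`, `q`, `w` on the ring,
    -- and `three-spokes` is used with `v` as the centre.
    close [] eO (k , x∉ , v∉ , _) = three-spokes isk k v∉ (trans (cnt-yes (α ++ q ∷ A ++ s ∷ P ++ w ∷ []) vy) (cong suc
      (trans (cnt-++ v α) (cong₂ _+_ (cnt-none α nα) (trans (cnt-yes (A ++ s ∷ P ++ w ∷ []) vq) (cong suc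
        (trans (cong (cnt v) (sym (flat ((⟨ A ⟩ ⊹ s ◂ ⟨ P ⟩) ⊹ w ◂ ⟨ [] ⟩)))) (trans (cnt-++ v (A ++ s ∷ P))
          (cong₂ _+_ (cnt-none (A ++ s ∷ P) nvP) (cnt-1 vw))))))))))
    close (c ∷ C) eO env with snoc-view c C
    ... | T , l , e = last-edge α A P T {l}
      (subst (λ t → Env (y ∷ α ++ q ∷ A ++ s ∷ P ++ w ∷ t)) e env) vy vq vw
      (subst (v ∼_) (∷ʳ-injectiveʳ O (A ++ s ∷ P ++ w ∷ T) (trans eO (trans (cong (λ t → A ++ s ∷ P ++ w ∷ t) e)
        (sym (flat ((⟨ A ⟩ ⊹ s ◂ ⟨ P ⟩ ⊹ w ◂ ⟨ T ⟩) ⊹ l ◂ ⟨ [] ⟩)))))) vq′)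
      nvP xq nA xs nxP ¬xw
    go : Left ¬xv x≢v y (O ++ q′ ∷ β) → ⊥
    go (inj₂ (B′ , w′ , e′ , vw′)) with tail-empty β nβ {O} refl e′ vw′
    ... | refl = close Q eO (subst (λ t → Env (y ∷ α ++ q ∷ A ++ s ∷ P ++ w ∷ t)) (++-identityʳ Q) env′)
    go (inj₁ (xy , _)) with left (A ++ s ∷ P) {w} {(Q ++ β) ++ y ∷ α} env″ vq vw nvP (spread-gap xq nA xs nxP 0 (cnt-0 ¬xw))
      where
      env″ : Env (q ∷ (A ++ s ∷ P) ++ w ∷ (Q ++ β) ++ y ∷ α)
      env″ = subst Env (sym (flat (q ◂ (⟨ A ⟩ ⊹ s ◂ ⟨ P ⟩) ⊹ w ◂ (⟨ Q ⟩ ⊹ ⟨ β ⟩) ⊹ y ◂ ⟨ α ⟩)))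
        (env-rot (rot-turn (y ◂ ⟨ α ⟩) (q ◂ ⟨ A ⟩ ⊹ s ◂ ⟨ P ⟩ ⊹ w ◂ ⟨ Q ⟩ ⊹ ⟨ β ⟩)) env′)
    -- The spoke preceding `q` would lie in `α`, whose two surrounding spokes `y` and `q` are
    -- already all, or no later than `y`, a neighbour of `v`.
    ... | inj₁ (_ , B′ , s′ , A′ , e′ , nA′ , xs′ , nv′) = case ∈-tails (Q ++ β) B′ e′ of λ
      { (inj₁ i) → xα i xs′ ; (inj₂ i) → nv′ i vy }
      where
      xα : NoN x α
      xα = cnt-zero α (+-cancelʳ-≡ 1 (cnt x α) 0 (trans (cong (cnt x α +_) (sym (cnt-1 xq)))
        (trans (sym (cnt-++ x α)) (suc-injective (trans (sym (cnt-yes (α ++ q ∷ []) xy)) two)))))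
    ... | inj₂ (B′ , w′ , e′ , vw′) with tail-empty α nα {Q ++ β} refl e′ vw′
    -- With `α` empty, `y q` is an edge seen by both `x` and `v`.
    ... | refl = diamond (cyc-adj (proj₁ env)) (∼-sym xy) (∼-sym vy) (∼-sym xq) (∼-sym vq) (x≢v , ¬xv)

  -- Before `y′` comes the spokeless `B` and then the neighbour `y`, so at this end only a triangle
  -- is possible, and `B` is empty. At `q` a second triangle is excluded, and a spoke falls to
  -- `last-edge` with the edge `y y′`.
  half₂ : ∀ {y′} α {q} O {q′} β {y} B → Env (y′ ∷ α ++ q ∷ O ++ q′ ∷ β ++ y ∷ B) → v ∼ y′ → v ∼ q → v ∼ q′ → v ∼ y →
    NoN v α → NoN v B → NoN x B → cnt x (y′ ∷ α ++ q ∷ []) ≡ 2 → cnt x O ≤ 1 → ⊥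
  half₂ {y′} α {q} O {q′} β {y} B env vy′ vq vq′ vy nα nB xB two one with left α env vy′ vq nα two
  ... | inj₁ (_ , B′ , s′ , A′ , e′ , nA′ , xs′ , nv′) =
    case ∈-tails (O ++ q′ ∷ β) B′ (trans (++-assoc O (q′ ∷ β) (y ∷ B)) e′) of λ
      { (inj₁ i) → xB i xs′ ; (inj₂ i) → nv′ i vy }
  ... | inj₂ (B′ , w′ , e′ , vw′) with tail-empty B nB {O ++ q′ ∷ β} (++-assoc O (q′ ∷ β) (y ∷ B)) e′ vw′ | right α env vy′ vq nα two
  ... | _ | inj₂ (w , B″ , e , vw) = two-triangles α env vy′ vq e vw e′ vw′
  ... | refl | inj₁ (xq , A , s , R , e , nA , xs , nv) with inner-gap α O A env vq vq′ one xq e nA xs nv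
  ... | P , w , Q , eO , nvP , nxP , vw , ¬xw = last-edge α A P (Q ++ β) env′ vy′ vq vw vy nvP xq nA xs nxP ¬xw
    where
    env′ : Env (y′ ∷ α ++ q ∷ A ++ s ∷ P ++ w ∷ (Q ++ β) ++ y ∷ [])
    env′ = subst Env (trans (sym (flat (y′ ◂ ⟨ α ⟩ ⊹ q ◂ (⟨ O ⟩ ⊹ q′ ◂ ⟨ [] ⟩) ⊹ ⟨ β ⟩ ⊹ y ◂ ⟨ [] ⟩)))
      (trans (cong (λ l → y′ ∷ α ++ q ∷ l ++ β ++ y ∷ []) eO)
        (same (y′ ◂ ⟨ α ⟩ ⊹ q ◂ (⟨ A ⟩ ⊹ s ◂ ⟨ P ⟩ ⊹ w ◂ ⟨ Q ⟩) ⊹ ⟨ β ⟩ ⊹ y ◂ ⟨ [] ⟩)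
              (y′ ◂ ⟨ α ⟩ ⊹ q ◂ ⟨ A ⟩ ⊹ s ◂ ⟨ P ⟩ ⊹ w ◂ (⟨ Q ⟩ ⊹ ⟨ β ⟩) ⊹ y ◂ ⟨ [] ⟩) refl))) env

  private
    4≰3 : ∀ {n} → 4 ≤ n → n ≤ 3 → ⊥
    4≰3 p q = <⇒≱ p q

    cap : ∀ {n} → n ≤ 2 → n ≡ 2 ⊎ n ≤ 1
    cap {n} b with n ≟ 2
    ... | yes e = inj₁ e
    ... | no ne = inj₂ (≤-pred (≤∧≢⇒< b ne))

  -- The four variants differ in whether the first and last neighbour of `v` coincide on the arc of
  -- `C` (₁ and ₃) and on the path `O` (₁ and ₂). In this one, a gap with exactly two spokes makes
  -- the common end `q` a spoke, which both gaps then count.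
  two-gaps₁ : ∀ {y} α {q} β → Env (y ∷ α ++ q ∷ β) → v ∼ y → v ∼ q → NoN v α → NoN v β →
    cnt x (y ∷ α ++ q ∷ []) ≤ 2 → cnt x (q ∷ β ++ y ∷ []) ≤ 2 → ⊥
  two-gaps₁ {y} α {q} β env vy vq nα nβ ≤R ≤L with cap ≤R
  ... | inj₂ ≤1 = 4≰3 (proj₂ (proj₂ (proj₂ env))) (subst (_≤ 3) (sym (cnt-gap y α q β)) (+-mono-≤ ≤1 ≤β))
    where
    ≤β : cnt x β ≤ 2
    ≤β = ≤-trans (≤-trans (m≤m+n (cnt x β) (cnt x (y ∷ []))) (≤-reflexive (sym (cnt-++ x β)))) (≤-trans (cnt-∷≥ x q (β ++ y ∷ [])) ≤L)
  ... | inj₁ two with right α env vy vq nα two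
  ... | inj₁ (xq , _) = 4≰3 (proj₂ (proj₂ (proj₂ env))) (subst (_≤ 3) (sym (cnt-gap y α q β)) (+-mono-≤ (≤-reflexive two) ≤β))
    where
    ≤β : cnt x β ≤ 1
    ≤β = ≤-trans (≤-trans (m≤m+n (cnt x β) (cnt x (y ∷ []))) (≤-reflexive (sym (cnt-++ x β)))) (≤-pred (subst (_≤ 2) (cnt-yes (β ++ y ∷ []) xq) ≤L))
  ... | inj₂ (w , B , refl , vw) = nβ (here refl) vw

  two-gaps₂ : ∀ {y′} α {q} β {y} B → Env (y′ ∷ α ++ q ∷ β ++ y ∷ B) → v ∼ y′ → v ∼ q → v ∼ y →
    NoN v α → NoN v β → NoN x B →
    cnt x (y′ ∷ α ++ q ∷ []) ≤ 2 → cnt x (q ∷ β ++ y ∷ []) ≤ 2 → ⊥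
  two-gaps₂ {y′} α {q} β {y} B env vy′ vq vy nα nβ xB ≤R ≤L with cap ≤R
  ... | inj₂ ≤1 = 4≰3 (proj₂ (proj₂ (proj₂ env))) (subst (_≤ 3) (sym (cnt-gap y′ α q (β ++ y ∷ B))) (+-mono-≤ ≤1 (subst (_≤ 2) (sym rest) (≤-trans (cnt-∷≥ x q (β ++ y ∷ [])) ≤L))))
    where
    rest : cnt x (β ++ y ∷ B) ≡ cnt x (β ++ y ∷ [])
    rest = trans (cong (cnt x) (sym (++-assoc β (y ∷ []) B))) (trans (cnt-++ x (β ++ y ∷ []))
      (trans (cong (cnt x (β ++ y ∷ []) +_) (cnt-none B xB)) (+-identityʳ _)))
  ... | inj₁ two with right α env vy′ vq nα two
  ... | inj₁ (xq , _) = 4≰3 (proj₂ (proj₂ (proj₂ env))) (subst (_≤ 3) (sym (cnt-gap y′ α q (β ++ y ∷ B))) (+-mono-≤ (≤-reflexive two) (subst (_≤ 1) (sym rest) (≤-pred (subst (_≤ 2) (cnt-yes (β ++ y ∷ []) xq) ≤L)))))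
    where
    rest : cnt x (β ++ y ∷ B) ≡ cnt x (β ++ y ∷ [])
    rest = trans (cong (cnt x) (sym (++-assoc β (y ∷ []) B))) (trans (cnt-++ x (β ++ y ∷ []))
      (trans (cong (cnt x (β ++ y ∷ []) +_) (cnt-none B xB)) (+-identityʳ _)))
  ... | inj₂ (w , R , e , vw) = go β nβ env e
    where
    go : ∀ β → NoN v β → Env (y′ ∷ α ++ q ∷ β ++ y ∷ B) → β ++ y ∷ B ≡ w ∷ R → ⊥
    go (b ∷ β) nβ _ refl = nβ (here refl) vw
    go [] _ env _ = 4≰3 (proj₂ (proj₂ (proj₂ env))) (subst (_≤ 3) (sym (cnt-gap y′ α q (y ∷ B)))
      (+-mono-≤ (≤-reflexive two) (≤-trans (cnt-∷≤ x y B) (s≤s (≤-reflexive (cnt-none B xB))))))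

  private
    count₃ : ∀ y α q O q′ β → cnt x (y ∷ α ++ q ∷ O ++ q′ ∷ β) ≡ cnt x (y ∷ α ++ q ∷ []) + (cnt x O + cnt x (q′ ∷ β))
    count₃ y α q O q′ β = trans (cnt-gap y α q (O ++ q′ ∷ β)) (cong (cnt x (y ∷ α ++ q ∷ []) +_) (cnt-++ x O))

    reversed : ∀ {y} α {q} O {q′} β → Env (y ∷ α ++ q ∷ O ++ q′ ∷ β) →
      Env (y ∷ reverse β ++ q′ ∷ reverse O ++ q ∷ reverse α)
    reversed {y} α {q} O {q′} β env = env-rot (rot-turn (⟨ reverse β ⟩ ⊹ q′ ◂ ⟨ reverse O ⟩ ⊹ q ◂ ⟨ reverse α ⟩) (y ◂ ⟨ [] ⟩))
      (subst Env (rev-nf (y ◂ ⟨ α ⟩ ⊹ q ◂ ⟨ O ⟩ ⊹ q′ ◂ ⟨ β ⟩)) (env-reverse env))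

    cnt-reversed : ∀ q β y → cnt x (q ∷ β ++ y ∷ []) ≡ cnt x (y ∷ reverse β ++ q ∷ [])
    cnt-reversed q β y = trans (sym (cnt-reverse x (q ∷ β ++ y ∷ []))) (cong (cnt x) (rev-nf (q ◂ ⟨ β ⟩ ⊹ y ◂ ⟨ [] ⟩)))

  -- A gap with two spokes has `y` among them, by `half`, and both gaps count `y`; so four spokes
  -- require two on each gap and one on `O`. Then `half` from both sides puts triangles of `v` on
  -- the first and last edge of `q O q′`.
  two-gaps₃ : ∀ {y} α {q} O {q′} β → Env (y ∷ α ++ q ∷ O ++ q′ ∷ β) → v ∼ y → v ∼ q → v ∼ q′ →
    NoN v α → NoN v β → cnt x O ≤ 1 →
    cnt x (y ∷ α ++ q ∷ []) ≤ 2 → cnt x (q′ ∷ β ++ y ∷ []) ≤ 2 → ⊥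
  two-gaps₃ {y} α {q} O {q′} β env@(k , _ , _ , four) vy vq vq′ nα nβ one ≤R ≤L with cap ≤R
  ... | inj₂ ≤1 = 4≰3 four (subst (_≤ 3) (sym (count₃ y α q O q′ β)) (+-mono-≤ ≤1 (+-mono-≤ one ≤q′β)))
    where
    xy : cnt x (q′ ∷ β ++ y ∷ []) ≡ 2 → x ∼ y
    xy two = proj₁ (half (reverse β) (reverse O) (reverse α) (reversed α O β env) vy vq′ vq
      (λ i → nβ (∈-rev i)) (λ i → nα (∈-rev i)) (trans (sym (cnt-reversed q′ β y)) two) (subst (_≤ 1) (sym (cnt-reverse x O)) one))
    split : cnt x (q′ ∷ β ++ y ∷ []) ≡ cnt x (q′ ∷ β) + cnt x (y ∷ [])
    split = cnt-++ x (q′ ∷ β)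
    ≤q′β : cnt x (q′ ∷ β) ≤ 1
    ≤q′β with cap ≤L
    ... | inj₂ b = ≤-trans (m≤m+n _ _) (subst (_≤ 1) split b)
    ... | inj₁ two = ≤-reflexive (+-cancelʳ-≡ 1 _ 1 (trans (cong (cnt x (q′ ∷ β) +_) (sym (cnt-1 (xy two)))) (trans (sym split) two)))
  ... | inj₁ two with half α O β env vy vq vq′ nα nβ two one
  ... | xy , w , B , e , vw = fin O refl
    where
    ≤q′β : cnt x (q′ ∷ β) ≤ 1
    ≤q′β = +-cancelʳ-≤ 1 _ 1 (subst (_≤ 2) (trans (cnt-++ x (q′ ∷ β)) (cong (cnt x (q′ ∷ β) +_) (cnt-1 xy))) ≤L)
    low : 2 ≤ cnt x O + cnt x (q′ ∷ β)
    low = +-cancelˡ-≤ 2 _ _ (subst (4 ≤_) (trans (count₃ y α q O q′ β) (cong (_+ (cnt x O + cnt x (q′ ∷ β))) two)) four)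
    q′β≡1 : cnt x (q′ ∷ β) ≡ 1
    q′β≡1 = ≤-antisym ≤q′β (+-cancelˡ-≤ 1 _ _ (≤-trans low (+-monoˡ-≤ _ one)))
    twoL : cnt x (q′ ∷ β ++ y ∷ []) ≡ 2
    twoL = trans (cnt-++ x (q′ ∷ β)) (cong₂ _+_ q′β≡1 (cnt-1 xy))
    other : ∃[ w ] ∃[ B ] (reverse O ++ q ∷ [] ≡ w ∷ B × v ∼ w)
    other = proj₂ (half (reverse β) (reverse O) (reverse α) (reversed α O β env) vy vq′ vq
      (λ i → nβ (∈-rev i)) (λ i → nα (∈-rev i)) (trans (sym (cnt-reversed q′ β y)) twoL) (subst (_≤ 1) (sym (cnt-reverse x O)) one))
    k′ : Cyc (q ∷ O ++ q′ ∷ β ++ y ∷ α)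
    k′ = rot-cyc (rot-turn (y ◂ ⟨ α ⟩) (q ◂ ⟨ O ⟩ ⊹ q′ ◂ ⟨ β ⟩)) k
    fin : ∀ O′ → O ≡ O′ → ⊥
    fin [] refl = <⇒≱ low ≤q′β
    fin (o ∷ []) refl = three-in-row k′ (∈-++⁺ʳ β (here refl)) vq (subst (v ∼_) (sym (∷-injectiveˡ e)) vw) vq′
    fin (o ∷ o′ ∷ O″) refl with snoc-view o′ O″ | other
    ... | X , l , eX | w′ , B′ , e″ , vw′ = two-edges X (β ++ y ∷ α)
        (subst Cyc (trans (cong (λ t → q ∷ o ∷ t ++ q′ ∷ β ++ y ∷ α) eX) (flat (q ◂ o ◂ (⟨ X ⟩ ⊹ l ◂ ⟨ [] ⟩) ⊹ q′ ◂ ⟨ β ⟩ ⊹ y ◂ ⟨ α ⟩))) k′)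
        vq (subst (v ∼_) (sym (∷-injectiveˡ e)) vw) vl vq′
      where
      vl : v ∼ l
      vl = subst (v ∼_) (sym (∷-injectiveˡ (trans (cong (_++ q ∷ []) (trans (sym (trans (cong (λ t → reverse (o ∷ t)) eX)
        (rev-nf (o ◂ ⟨ X ⟩ ⊹ l ◂ ⟨ [] ⟩)))) refl)) e″))) vw′

  two-gaps₄ : ∀ {y′} α {q} O {q′} β {y} B → Env (y′ ∷ α ++ q ∷ O ++ q′ ∷ β ++ y ∷ B) → v ∼ y′ → v ∼ q → v ∼ q′ → v ∼ y →
    NoN v α → NoN v β → NoN v B → NoN x B → cnt x O ≤ 1 →
    cnt x (y′ ∷ α ++ q ∷ []) ≤ 2 → cnt x (q′ ∷ β ++ y ∷ []) ≤ 2 → ⊥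
  two-gaps₄ {y′} α {q} O {q′} β {y} B env@(_ , _ , _ , four) vy′ vq vq′ vy nα nβ nB xB one ≤R ≤L with cap ≤R | cap ≤L
  ... | inj₁ two | _ = half₂ α O β B env vy′ vq vq′ vy nα nB xB two one
  ... | inj₂ _ | inj₁ two = half₂ (reverse β) (reverse O) (reverse α) (reverse B)
      (env-rot (rot-turn ⟨ reverse B ⟩ (y ◂ ⟨ reverse β ⟩ ⊹ q′ ◂ ⟨ reverse O ⟩ ⊹ q ◂ ⟨ reverse α ⟩ ⊹ y′ ◂ ⟨ [] ⟩))
        (subst Env (rev-nf (y′ ◂ ⟨ α ⟩ ⊹ q ◂ ⟨ O ⟩ ⊹ q′ ◂ ⟨ β ⟩ ⊹ y ◂ ⟨ B ⟩)) (env-reverse env)))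
      vy vq′ vq vy′ (λ i → nβ (∈-rev i)) (λ i → nB (∈-rev i)) (λ i → xB (∈-rev i))
      (trans (sym (cnt-reversed q′ β y)) two) (subst (_≤ 1) (sym (cnt-reverse x O)) one)
  ... | inj₂ ≤1 | inj₂ ≤1′ = 4≰3 four (subst (_≤ 3) (sym total) (+-mono-≤ ≤1 (+-mono-≤ one ≤1′)))
    where
    total : cnt x (y′ ∷ α ++ q ∷ O ++ q′ ∷ β ++ y ∷ B) ≡ cnt x (y′ ∷ α ++ q ∷ []) + (cnt x O + cnt x (q′ ∷ β ++ y ∷ []))
    total = trans (count₃ y′ α q O q′ (β ++ y ∷ B)) (cong (λ t → cnt x (y′ ∷ α ++ q ∷ []) + (cnt x O + t))
      (trans (cnt-gap q′ β y B) (trans (cong (cnt x (q′ ∷ β ++ y ∷ []) +_) (cnt-none B xB)) (+-identityʳ _))))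

-- A ring C with centre x: the list form of a proper wheel with the fewest spokes.
record Rim (G : Graph) (x : V G) (C : List (V G)) : Set where
  open Paths G
  field
    ringC  : Cyc C
    x∉C    : x ∉ C
    spokes : 3 ≤ cnt x C
    pair   : ∀ {v y M z M′} → v ∉ C → v ≢ x → Rot C (y ∷ M ++ z ∷ M′) → v ∼ y → v ∼ z → NoN x M ⊎ NoN x M′
    few    : ∀ {v} → v ∉ C → v ≢ x → ¬ x ∼ v → cnt v C ≤ 2
    least  : ∀ {h p} → Cyc (h ∷ p) → 3 ≤ length p → x ∉ h ∷ p → 3 ≤ cnt x (h ∷ p) →
             (∀ v → v ∉ h ∷ p → v ≢ x → Good x (h ∷ p) v) → cnt x C ≤ cnt x (h ∷ p)

-- Minimal rings made of an arc of `C` and a thin path.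

module Core (G : Graph) (isk : ISK4-free G) (dia : Diamond-free G) (bow : Bowtie-free G)
  {x : V G} {C : List (V G)} (rim : Rim G x C) where
  open Rim rim
  open Paths G
  open Hub G
  open Local G isk dia bow

  -- The ends of O may be spokes: otherwise the class of rings A ++ O with O thin would not be
  -- closed under replacing part of the ring by a vertex v adjacent to x.
  Thin : List (V G) → Set
  Thin O = ∀ a M b → O ≡ a ∷ M ++ b ∷ [] → cnt x M ≤ 1

  -- Only the extreme neighbours are recorded; the stretch `B` between them is controlled
  -- separately, by properness of `W` on `A` and by thinness on `O`.
  data Block (v : V G) : List (V G) → Set where
    none : ∀ {l} → NoN v l → Block v l
    one  : ∀ A y B → v ∼ y → NoN v A → NoN v B → Block v (A ++ y ∷ B)
    two  : ∀ A y B y′ D → v ∼ y → v ∼ y′ → NoN v A → NoN v D → Block v (A ++ y ∷ B ++ y′ ∷ D)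

  block : ∀ v l → Block v l
  block v l with first v l
  ... | inj₁ f = none f
  ... | inj₂ (A , y , B , refl , nA , vy) with last v B
  ... | inj₁ f = one A y B vy nA f
  ... | inj₂ (B′ , y′ , D , refl , nD , vy′) = two A y B′ y′ D vy vy′ nA nD

  module Step (A O R : List (V G)) (rotC : Rot C (A ++ R)) (ring : Cyc (A ++ O)) (x∉ : x ∉ A ++ O)
    (thin : Thin O) (4≤ : 4 ≤ cnt x (A ++ O)) (<m : cnt x (A ++ O) < cnt x C)
    (smaller : ∀ A′ O′ R′ → Rot C (A′ ++ R′) → Cyc (A′ ++ O′) → x ∉ A′ ++ O′ → Thin O′ → 3 ≤ cnt x (A′ ++ O′) →
       cnt x (A′ ++ O′) < cnt x (A ++ O) ⊎ (cnt x (A′ ++ O′) ≡ cnt x (A ++ O) × length (A′ ++ O′) < length (A ++ O)) → ⊥)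
    where

    H : List (V G)
    H = A ++ O

    -- With at most one neighbour `g`, the gap may be taken to be the whole ring, with `U` empty.
    good-one : ∀ {v g p} → Rot H (g ∷ p) → NoN v p → Good x H v
    good-one {v} {g} {[]} r f = ⊥-elim (<⇒≱ 4≤ (subst (_≤ 3) (sym (cnt-rot x r)) (≤-trans (cnt-≤length x (g ∷ [])) (s≤s z≤n))))
    good-one {v} {g} {a ∷ p} r f with snoc-view a p
    ... | M , g′ , e = g , M , g′ , [] , subst (λ l → Rot H (g ∷ l)) e r ,
          (λ i → f (∈-cast (sym e) (∈-++⁺ˡ i))) , (λ ()) , inj₂ (λ ())

    module Outside (v : V G) (v∉ : v ∉ H) (v≢x : v ≢ x) where

      module Gap {g M g′ U} (r : Rot H (g ∷ M ++ g′ ∷ U)) (vg : v ∼ g) (vg′ : v ∼ g′) (nM : NoN v M)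
        {A′ O′ R′} (rC : Rot C (A′ ++ R′)) (th : Thin O′) (r′ : Rot (v ∷ g ∷ M ++ g′ ∷ []) (A′ ++ O′)) where

        private
          arc : List (V G)
          arc = g ∷ M ++ g′ ∷ []
          flat-arc : arc ++ U ≡ g ∷ M ++ g′ ∷ U
          flat-arc = flat ((g ◂ ⟨ M ⟩ ⊹ g′ ◂ ⟨ [] ⟩) ⊹ ⟨ U ⟩)
          k : Cyc (g ∷ M ++ g′ ∷ U)
          k = rot-cyc r ring
          v∉′ : v ∉ g ∷ M ++ g′ ∷ U
          v∉′ i = v∉ (rot-∈⁻ r i)
          x∉′ : x ∉ g ∷ M ++ g′ ∷ U
          x∉′ i = x∉ (rot-∈⁻ r i)
          total : cnt x H ≡ cnt x arc + cnt x U
          total = trans (cnt-rot x r) (trans (cong (cnt x) (sym flat-arc)) (cnt-++ x arc))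
          long : length H ≡ length arc + length U
          long = trans (length-rot r) (trans (cong length (sym flat-arc)) (length-++ arc))
          closed : ∀ {w} → w ∈ U → Cyc (A′ ++ O′)
          closed w∈ = rot-cyc r′ (gap-ring M k w∈ v∉′ vg vg′ nM)
          x∉c : x ∉ A′ ++ O′
          x∉c i with rot-∈⁻ r′ i
          ... | here e = v≢x (sym e)
          ... | there j = x∉′ (∈-cast flat-arc (∈-++⁺ˡ j))
          -- The new ring drops `U` and adds `v`, so it is shorter only if `U` has two vertices.
          refuse : ∀ {w} → w ∈ U → 3 ≤ cnt x (v ∷ arc) → cnt x (v ∷ arc) < cnt x H ⊎ (cnt x (v ∷ arc) ≡ cnt x H × 2 ≤ length U) → ⊥
          refuse w∈ three s = smaller A′ O′ R′ rC (closed w∈) x∉c th (subst (3 ≤_) c≡ three) (case s of λ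
            { (inj₁ l) → inj₁ (subst (_< cnt x H) c≡ l)
            ; (inj₂ (e , l)) → inj₂ (trans (sym c≡) e , subst₂ _<_ (length-rot r′) (sym long)
                (subst (_≤ length arc + length U) (+-comm (length arc) 2) (+-monoʳ-≤ (length arc) l))) })
            where
            c≡ : cnt x (v ∷ arc) ≡ cnt x (A′ ++ O′)
            c≡ = cnt-rot x r′
          good : NoN x U → (x ∼ v ⊎ NoN v U) → Good x H v
          good f s = g , M , g′ , U , r , nM , f , s

        -- The ring through `v` has one spoke more than the gap. From two spokes on the gap onwards
        -- it is refused if `U` has two spokes, or one spoke and two vertices. A single vertex that
        -- is a spoke is the case of `twin`; a spokeless `U` makes `v` good.
        gap-adjacent : x ∼ v → Good x H v ⊎ cnt x arc ≤ 1
        gap-adjacent xv with cnt x arc ≤? 1 | cnt x U in eU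
        ... | yes b | _ = inj₂ b
        ... | no b | zero = inj₁ (good (cnt-zero U eU) (inj₁ xv))
        ... | no b | suc zero = ⊥-elim (go U refl)
          where
          same-cnt : cnt x (v ∷ arc) ≡ cnt x H
          same-cnt = trans (cnt-yes arc xv) (trans (+-comm 1 (cnt x arc)) (trans (cong (cnt x arc +_) (sym eU)) (sym total)))
          go : ∀ U′ → U ≡ U′ → ⊥
          go [] refl = case eU of λ ()
          go (o ∷ []) refl = twin M k x∉′ v∉′ vg vg′ nM xv
            (case x ∼? o of λ { (yes xo) → xo ; (no ¬xo) → case trans (sym eU) (cnt-0 ¬xo) of λ () })
            (≤-pred (subst (4 ≤_) (trans total (trans (cong (cnt x arc +_) eU) (+-comm (cnt x arc) 1))) 4≤))
          go (o ∷ o′ ∷ U′) refl = refuse (here refl) (subst (3 ≤_) (sym same-cnt) (<⇒≤ 4≤)) (inj₂ (same-cnt , s≤s (s≤s z≤n)))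
        ... | no b | suc (suc u) = ⊥-elim (go U refl)
          where
          go : ∀ U′ → U ≡ U′ → ⊥
          go [] refl = case eU of λ ()
          go (o ∷ U′) refl = refuse (here refl) (subst (3 ≤_) (sym (cnt-yes arc xv)) (s≤s (≰⇒> b)))
            (inj₁ (subst₂ _<_ (sym (cnt-yes arc xv)) (sym total) (subst (_≤ cnt x arc + cnt x U) (+-comm (cnt x arc) 2)
              (+-monoʳ-≤ (cnt x arc) (subst (2 ≤_) (sym eU) (s≤s (s≤s z≤n)))))))

        -- Now `v` adds no spoke, so a gap with three is refused once `U` has a spoke. If it has
        -- none, then `v` is good, or has a neighbour in `U`; in that case the ring through `v` is
        -- shorter with equally many spokes, or three neighbours of `v` are consecutive.
        gap-apart : ¬ x ∼ v → Good x H v ⊎ cnt x arc ≤ 2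
        gap-apart ¬xv with cnt x arc ≤? 2 | cnt x U in eU
        ... | yes b | _ = inj₂ b
        ... | no b | suc u = ⊥-elim (go U refl)
          where
          go : ∀ U′ → U ≡ U′ → ⊥
          go [] refl = case eU of λ ()
          go (o ∷ U′) refl = refuse (here refl) (subst (3 ≤_) (sym (cnt-no arc ¬xv)) (≰⇒> b))
            (inj₁ (subst₂ _<_ (sym (cnt-no arc ¬xv)) (sym total) (subst (_≤ cnt x arc + cnt x U) (+-comm (cnt x arc) 1)
              (+-monoʳ-≤ (cnt x arc) (subst (1 ≤_) (sym eU) (s≤s z≤n))))))
        ... | no b | zero with first v U
        ... | inj₁ f = inj₁ (good (cnt-zero U eU) (inj₂ f))
        ... | inj₂ ([] , o , [] , refl , _ , vo) = ⊥-elim (go M refl)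
          where
          go : ∀ M′ → M ≡ M′ → ⊥
          go [] refl = b (≤-trans (cnt-≤length x (g ∷ g′ ∷ [])) ≤-refl)
          go (m ∷ M′) refl = three-in-row (cyc-rot (g ∷ m ∷ M′) k) (here refl) vg′ vo vg
        ... | inj₂ ([] , o , o′ ∷ E , refl , _ , vo) = ⊥-elim (refuse (here refl) (subst (3 ≤_) (sym (cnt-no arc ¬xv)) (≰⇒> b))
              (inj₂ (trans (cnt-no arc ¬xv) (trans (sym (+-identityʳ _)) (trans (cong (cnt x arc +_) (sym eU)) (sym total))) ,
                s≤s (s≤s z≤n))))
        ... | inj₂ (d ∷ D , o , E , refl , _ , vo) = ⊥-elim (refuse (here refl) (subst (3 ≤_) (sym (cnt-no arc ¬xv)) (≰⇒> b))
              (inj₂ (trans (cnt-no arc ¬xv) (trans (sym (+-identityʳ _)) (trans (cong (cnt x arc +_) (sym eU)) (sym total))) ,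
                s≤s (subst (1 ≤_) (sym (length-++ D)) (≤-trans (s≤s z≤n) (m≤n+m (suc (length E)) (length D)))))))

      -- For `v` off `C`, one of the two arcs of `C` between `y` and `y′` is spokeless. It is `B`,
      -- since otherwise all spokes of `C` would be on the ring, against `<m`. For `v` on `C`, both
      -- neighbours are next to it, so `A` is all of `C` but `v`; then `<m` makes `v` a spoke and
      -- `O` spokeless.
      two-on-arc : ∀ A₁ y B y′ A₂ → A ≡ A₁ ++ y ∷ B ++ y′ ∷ A₂ → v ∼ y → v ∼ y′ →
        Good x H v ⊎ (NoN x B × (¬ x ∼ v → NoN v B))
      two-on-arc A₁ y B y′ A₂ refl vy vy′ with v ∈? C
      ... | no v∉C = inj₂ (flatB , sparse)
        where
        rC : Rot C (y ∷ B ++ y′ ∷ A₂ ++ R ++ A₁)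
        rC = rot-trans rotC (subst (λ l → Rot l (y ∷ B ++ y′ ∷ A₂ ++ R ++ A₁))
          (sym (flat ((⟨ A₁ ⟩ ⊹ y ◂ ⟨ B ⟩ ⊹ y′ ◂ ⟨ A₂ ⟩) ⊹ ⟨ R ⟩)))
          (rot-turn ⟨ A₁ ⟩ (y ◂ ⟨ B ⟩ ⊹ y′ ◂ ⟨ A₂ ⟩ ⊹ ⟨ R ⟩)))
        whole : cnt x C ≡ cnt x (y ∷ B ++ y′ ∷ []) + cnt x (A₂ ++ R ++ A₁)
        whole = trans (cnt-rot x rC) (trans (cong (cnt x) (sym (flat ((y ◂ ⟨ B ⟩ ⊹ y′ ◂ ⟨ [] ⟩) ⊹ ⟨ A₂ ⟩ ⊹ ⟨ R ⟩ ⊹ ⟨ A₁ ⟩))))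
          (cnt-++ x (y ∷ B ++ y′ ∷ [])))
        part : cnt x (y ∷ B ++ y′ ∷ []) ≤ cnt x H
        part = subst (cnt x (y ∷ B ++ y′ ∷ []) ≤_) (sym (trans (cong (cnt x) (same
              ((⟨ A₁ ⟩ ⊹ y ◂ ⟨ B ⟩ ⊹ y′ ◂ ⟨ A₂ ⟩) ⊹ ⟨ O ⟩) (⟨ A₁ ⟩ ⊹ (y ◂ ⟨ B ⟩ ⊹ y′ ◂ ⟨ [] ⟩) ⊹ ⟨ A₂ ⟩ ⊹ ⟨ O ⟩) refl))
            (trans (cnt-++ x A₁) (cong (cnt x A₁ +_) (cnt-++ x (y ∷ B ++ y′ ∷ []))))))
          (≤-trans (m≤m+n _ (cnt x (A₂ ++ O))) (m≤n+m _ (cnt x A₁)))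
        flatB : NoN x B
        flatB with pair v∉C v≢x rC vy vy′
        ... | inj₁ f = f
        ... | inj₂ f = ⊥-elim (<⇒≱ <m (subst (_≤ cnt x H) (sym (trans whole
              (trans (cong (cnt x (y ∷ B ++ y′ ∷ []) +_) (cnt-none (A₂ ++ R ++ A₁) f)) (+-identityʳ _)))) part))
        sparse : ¬ x ∼ v → NoN v B
        sparse ¬xv = cnt-zero B (n≤0⇒n≡0 (+-cancelʳ-≤ 2 (cnt v B) 0 (≤-trans low (few v∉C v≢x ¬xv))))
          where
          low : cnt v B + 2 ≤ cnt v C
          low = subst₂ _≤_ (sym (+-suc (cnt v B) 1)) (sym (trans (cnt-rot v rC) (trans (cnt-yes (B ++ y′ ∷ A₂ ++ R ++ A₁) vy)
            (cong suc (trans (cnt-++ v B) (cong (cnt v B +_) (cnt-yes (A₂ ++ R ++ A₁) vy′)))))))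
            (s≤s (+-monoʳ-≤ (cnt v B) (s≤s z≤n)))
      ... | yes v∈C with ∈-++⁻ A (rot-∈ rotC v∈C)
      ... | inj₁ v∈A = ⊥-elim (v∉ (∈-++⁺ˡ v∈A))
      ... | inj₂ v∈R with ∈-∃++ v∈R
      ... | R₁ , R₂ , refl = ends (cyc-nbr (R₂ ++ A₁) k₁ vy) (cyc-nbr (R₂ ++ A₁ ++ y ∷ B) k₂ vy′)
        where
        rC : Rot C (v ∷ R₂ ++ A₁ ++ y ∷ B ++ y′ ∷ A₂ ++ R₁)
        rC = rot-trans rotC (subst₂ Rot (same ((⟨ A ⟩ ⊹ ⟨ R₁ ⟩) ⊹ v ◂ ⟨ R₂ ⟩) (⟨ A ⟩ ⊹ ⟨ R₁ ⟩ ⊹ v ◂ ⟨ R₂ ⟩) refl)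
          (flat ((v ◂ ⟨ R₂ ⟩) ⊹ (⟨ A₁ ⟩ ⊹ y ◂ ⟨ B ⟩ ⊹ y′ ◂ ⟨ A₂ ⟩) ⊹ ⟨ R₁ ⟩)) (rot-swap (A ++ R₁)))
        k₁ : Cyc (v ∷ (R₂ ++ A₁) ++ y ∷ B ++ y′ ∷ A₂ ++ R₁)
        k₁ = subst Cyc (sym (flat (v ◂ (⟨ R₂ ⟩ ⊹ ⟨ A₁ ⟩) ⊹ y ◂ ⟨ B ⟩ ⊹ y′ ◂ ⟨ A₂ ⟩ ⊹ ⟨ R₁ ⟩))) (rot-cyc rC ringC)
        k₂ : Cyc (v ∷ (R₂ ++ A₁ ++ y ∷ B) ++ y′ ∷ A₂ ++ R₁)
        k₂ = subst Cyc (sym (flat (v ◂ (⟨ R₂ ⟩ ⊹ ⟨ A₁ ⟩ ⊹ y ◂ ⟨ B ⟩) ⊹ y′ ◂ ⟨ A₂ ⟩ ⊹ ⟨ R₁ ⟩))) (rot-cyc rC ringC)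
        empty : ∀ X {w : V G} {Z} → X ++ w ∷ Z ≢ []
        empty [] ()
        empty (_ ∷ _) ()
        ends : R₂ ++ A₁ ≡ [] ⊎ B ++ y′ ∷ A₂ ++ R₁ ≡ [] → R₂ ++ A₁ ++ y ∷ B ≡ [] ⊎ A₂ ++ R₁ ≡ [] →
          Good x H v ⊎ (NoN x B × (¬ x ∼ v → NoN v B))
        ends (inj₂ e) _ = ⊥-elim (empty B e)
        ends _ (inj₁ e) = ⊥-elim (empty (R₂ ++ A₁) (trans (++-assoc R₂ A₁ (y ∷ B)) e))
        ends (inj₁ e) (inj₂ e′)
          with ++-conicalˡ R₂ A₁ e | ++-conicalʳ R₂ A₁ e | ++-conicalˡ A₂ R₁ e′ | ++-conicalʳ A₂ R₁ e′
        ... | refl | refl | refl | refl with x ∼? v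
        ... | no ¬xv = ⊥-elim (<⇒≱ <m (subst (_≤ cnt x H) (sym (trans (cnt-rot x rC) (cnt-no A ¬xv)))
                (subst (cnt x A ≤_) (sym (cnt-++ x A)) (m≤m+n (cnt x A) (cnt x O)))))
        ... | yes xv = inj₁ (y , B , y′ , O , subst (Rot H) (flat ((y ◂ ⟨ B ⟩ ⊹ y′ ◂ ⟨ [] ⟩) ⊹ ⟨ O ⟩)) done , nB k₁ , xO , inj₁ xv)
          where
          nB : Cyc (v ∷ y ∷ B ++ y′ ∷ []) → NoN v B
          nB k i e″ with ∈-∃++ i
          ... | X , Y , refl with cyc-nbr (y ∷ X) (subst Cyc (cong (λ l → v ∷ y ∷ l) (++-assoc X _ _)) k) e″
          ... | inj₂ q = empty Y q
          xO : NoN x O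
          xO = cnt-zero O (n≤0⇒n≡0 (+-cancelˡ-≤ (suc (cnt x A)) (cnt x O) 0 (subst₂ _≤_
            (cong suc (cnt-++ x A)) (trans (cnt-rot x rC) (trans (cnt-yes A xv) (sym (+-identityʳ _)))) <m)))

      thin-pair : ∀ {a b} → Thin (a ∷ b ∷ [])
      thin-pair a [] b e = z≤n
      thin-pair a (_ ∷ []) b ()
      thin-pair a (_ ∷ _ ∷ _) b ()

      -- Appending `v` can only make `q` interior. If `q` was not the last vertex of `O`, it counted
      -- as interior before unless it was first; so the sole obstruction is a spoke at the end of
      -- `O`.
      thinʳ : ∀ O₁ q Or → O ≡ O₁ ++ q ∷ Or → Thin (O₁ ++ q ∷ v ∷ []) ⊎ (Or ≡ [] × x ∼ q)
      thinʳ [] q Or e = inj₁ thin-pair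
      thinʳ (c ∷ O₁) q (z ∷ Or) e with snoc-view z Or
      ... | I , b , e′ = inj₁ λ a M b′ e″ → subst (λ l → cnt x l ≤ 1)
            (∷ʳ-injectiveˡ (O₁ ++ q ∷ []) M (trans (++-assoc O₁ (q ∷ []) (v ∷ [])) (∷-injectiveʳ e″)))
            (≤-trans (subst (cnt x (O₁ ++ q ∷ []) ≤_) (sym (cnt-++ x (O₁ ++ q ∷ []))) (m≤m+n _ (cnt x I)))
              (thin c ((O₁ ++ q ∷ []) ++ I) b (trans e (trans (cong (λ l → c ∷ O₁ ++ q ∷ l) e′)
                (same (c ◂ ⟨ O₁ ⟩ ⊹ q ◂ ⟨ I ⟩ ⊹ b ◂ ⟨ [] ⟩) (c ◂ ((⟨ O₁ ⟩ ⊹ q ◂ ⟨ [] ⟩) ⊹ ⟨ I ⟩) ⊹ b ◂ ⟨ [] ⟩) refl)))))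
      thinʳ (c ∷ O₁) q [] e with x ∼? q
      ... | yes xq = inj₂ (refl , xq)
      ... | no ¬xq = inj₁ λ a M b′ e″ → subst (λ l → cnt x l ≤ 1)
            (∷ʳ-injectiveˡ (O₁ ++ q ∷ []) M (trans (++-assoc O₁ (q ∷ []) (v ∷ [])) (∷-injectiveʳ e″)))
            (subst (_≤ 1) (sym (trans (cnt-++ x O₁) (trans (cong (cnt x O₁ +_) (cnt-0 ¬xq)) (+-identityʳ _)))) (thin c O₁ q e))

      thinˡ : ∀ Ol q O₂ → O ≡ Ol ++ q ∷ O₂ → Thin (v ∷ q ∷ O₂) ⊎ (Ol ≡ [] × x ∼ q)
      thinˡ (c ∷ Ol) q O₂ e = inj₁ λ a M b e″ →
        ≤-trans (subst (cnt x M ≤_) (sym (cnt-++ x Ol)) (m≤n+m (cnt x M) (cnt x Ol)))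
          (thin c (Ol ++ M) b (trans e (trans (cong (λ l → c ∷ Ol ++ l) (∷-injectiveʳ e″)) (cong (c ∷_) (sym (++-assoc Ol M (b ∷ [])))))))
      thinˡ [] q O₂ e with x ∼? q
      ... | yes xq = inj₂ (refl , xq)
      ... | no ¬xq = inj₁ λ a M b e″ → go M b (∷-injectiveʳ e″)
        where
        go : ∀ M b → q ∷ O₂ ≡ M ++ b ∷ [] → cnt x M ≤ 1
        go [] b e′ = z≤n
        go (d ∷ M) b e′ with ∷-injectiveˡ e′
        ... | refl = subst (_≤ 1) (sym (cnt-no M ¬xq)) (thin q M b (trans e e′))

      three-neighbours : cnt v H ≢ 3
      three-neighbours = three-spokes isk ring v∉

      module Both (Ar : List (V G)) (y′ : V G) (A₂ : List (V G)) (eA : A ≡ Ar ++ y′ ∷ A₂)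
        (A₁ : List (V G)) (y : V G) (Al : List (V G)) (eA′ : A ≡ A₁ ++ y ∷ Al)
        (O₁ : List (V G)) (q : V G) (Or : List (V G)) (eO : O ≡ O₁ ++ q ∷ Or)
        (Ol : List (V G)) (q′ : V G) (O₂ : List (V G)) (eO′ : O ≡ Ol ++ q′ ∷ O₂)
        (vy : v ∼ y) (vy′ : v ∼ y′) (vq : v ∼ q) (vq′ : v ∼ q′)
        (nA₁ : NoN v A₁) (nA₂ : NoN v A₂) (nO₁ : NoN v O₁) (nO₂ : NoN v O₂) where

        rotʳ : Rot H (y′ ∷ (A₂ ++ O₁) ++ q ∷ Or ++ Ar)
        rotʳ = subst₂ Rot
          (trans (same (⟨ Ar ⟩ ⊹ y′ ◂ ⟨ A₂ ⟩ ⊹ ⟨ O₁ ⟩ ⊹ q ◂ ⟨ Or ⟩) ((⟨ Ar ⟩ ⊹ y′ ◂ ⟨ A₂ ⟩) ⊹ ⟨ O₁ ⟩ ⊹ q ◂ ⟨ Or ⟩) refl) (cong₂ _++_ (sym eA) (sym eO)))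
          (same ((y′ ◂ ⟨ A₂ ⟩ ⊹ ⟨ O₁ ⟩ ⊹ q ◂ ⟨ Or ⟩) ⊹ ⟨ Ar ⟩) (y′ ◂ (⟨ A₂ ⟩ ⊹ ⟨ O₁ ⟩) ⊹ q ◂ ⟨ Or ⟩ ⊹ ⟨ Ar ⟩) refl)
          (rot-swap Ar)

        rotˡ : Rot H (q′ ∷ (O₂ ++ A₁) ++ y ∷ Al ++ Ol)
        rotˡ = subst₂ Rot
          (trans (same ((⟨ A₁ ⟩ ⊹ y ◂ ⟨ Al ⟩ ⊹ ⟨ Ol ⟩) ⊹ q′ ◂ ⟨ O₂ ⟩) ((⟨ A₁ ⟩ ⊹ y ◂ ⟨ Al ⟩) ⊹ ⟨ Ol ⟩ ⊹ q′ ◂ ⟨ O₂ ⟩) refl) (cong₂ _++_ (sym eA′) (sym eO′)))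
          (same ((q′ ◂ ⟨ O₂ ⟩) ⊹ ⟨ A₁ ⟩ ⊹ y ◂ ⟨ Al ⟩ ⊹ ⟨ Ol ⟩) (q′ ◂ (⟨ O₂ ⟩ ⊹ ⟨ A₁ ⟩) ⊹ y ◂ ⟨ Al ⟩ ⊹ ⟨ Ol ⟩) refl)
          (rot-swap (A₁ ++ y ∷ Al ++ Ol))

        arcʳ arcˡ : List (V G)
        arcʳ = y′ ∷ (A₂ ++ O₁) ++ q ∷ []
        arcˡ = q′ ∷ (O₂ ++ A₁) ++ y ∷ []

        module R (th : Thin (O₁ ++ q ∷ v ∷ [])) = Gap rotʳ vy′ vq (NoN-++ A₂ nA₂ nO₁) {y′ ∷ A₂} {O₁ ++ q ∷ v ∷ []} {R ++ Ar}
          (rot-trans (subst (λ l → Rot C (l ++ R)) eA rotC)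
            (subst (λ l → Rot l (y′ ∷ A₂ ++ R ++ Ar)) (sym (flat ((⟨ Ar ⟩ ⊹ y′ ◂ ⟨ A₂ ⟩) ⊹ ⟨ R ⟩)))
              (rot-turn ⟨ Ar ⟩ (y′ ◂ ⟨ A₂ ⟩ ⊹ ⟨ R ⟩)))) th
          (turn (subst (Rot (arcʳ ++ v ∷ [])) (flat ((y′ ◂ (⟨ A₂ ⟩ ⊹ ⟨ O₁ ⟩) ⊹ q ◂ ⟨ [] ⟩) ⊹ v ◂ ⟨ [] ⟩)) done))

        module L (th : Thin (v ∷ q′ ∷ O₂)) = Gap rotˡ vq′ vy (NoN-++ O₂ nO₂ nA₁) {A₁ ++ y ∷ []} {v ∷ q′ ∷ O₂} {Al ++ R}
          (subst (Rot C) (trans (cong (_++ R) eA′) (same ((⟨ A₁ ⟩ ⊹ y ◂ ⟨ Al ⟩) ⊹ ⟨ R ⟩) ((⟨ A₁ ⟩ ⊹ y ◂ ⟨ [] ⟩) ⊹ ⟨ Al ⟩ ⊹ ⟨ R ⟩) refl)) rotC) th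
          (subst (λ l → Rot l ((A₁ ++ y ∷ []) ++ v ∷ q′ ∷ O₂)) (same ((v ◂ q′ ◂ ⟨ O₂ ⟩) ⊹ ⟨ A₁ ⟩ ⊹ y ◂ ⟨ [] ⟩) (v ◂ q′ ◂ (⟨ O₂ ⟩ ⊹ ⟨ A₁ ⟩) ⊹ y ◂ ⟨ [] ⟩) refl)
            (rot-swap (v ∷ q′ ∷ O₂)))

        -- `arcʳ` and `arcˡ` are the gaps leading from `A` into `O` and back; by `cA` and `cO` at
        -- most one spoke lies outside them. If `x` sees `v`, each has at most one spoke and the
        -- ring at most three. Otherwise `apart`, one of the `two-gaps` lemmas, decides. `spʳ` and
        -- `spˡ` cover the ends of `O` where thinness fails.
        conclude :
          cnt x A ≤ cnt x (A₁ ++ y ∷ []) + cnt x (y′ ∷ A₂) →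
          cnt x O ≤ cnt x (O₁ ++ q ∷ []) + cnt x (q′ ∷ O₂) + 1 →
          (¬ x ∼ v → cnt x arcʳ ≤ 2 → cnt x arcˡ ≤ 2 → ⊥) →
          (Or ≡ [] → x ∼ q → Good x H v) →
          (Ol ≡ [] → x ∼ q′ → Good x H v) → Good x H v
        conclude cA cO apart spʳ spˡ with thinʳ O₁ q Or eO | thinˡ Ol q′ O₂ eO′
        ... | inj₂ (e , xq) | _ = spʳ e xq
        ... | inj₁ _ | inj₂ (e , xq) = spˡ e xq
        ... | inj₁ tʳ | inj₁ tˡ with x ∼? v
        ... | no ¬xv = [ id , (λ bʳ → [ id , (λ bˡ → ⊥-elim (apart ¬xv bʳ bˡ)) ]′ (L.gap-apart tˡ ¬xv)) ]′ (R.gap-apart tʳ ¬xv)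
        ... | yes xv = [ id , (λ bʳ → [ id , (λ bˡ → ⊥-elim (<⇒≱ 4≤ (count bʳ bˡ))) ]′ (L.gap-adjacent tˡ xv)) ]′ (R.gap-adjacent tʳ xv)
          where
          a₁ = cnt x (A₁ ++ y ∷ [])
          a₂ = cnt x (y′ ∷ A₂)
          o₁ = cnt x (O₁ ++ q ∷ [])
          o₂ = cnt x (q′ ∷ O₂)
          count : cnt x arcʳ ≤ 1 → cnt x arcˡ ≤ 1 → cnt x H ≤ 3
          count bʳ bˡ = ≤-trans (≤-reflexive (cnt-++ x A)) (≤-trans (+-mono-≤ cA cO)
            (≤-trans (≤-reflexive (shuffle a₁ a₂ o₁ o₂)) (+-monoˡ-≤ 1 (+-mono-≤
              (subst (_≤ 1) (trans (cong (cnt x) (same (y′ ◂ (⟨ A₂ ⟩ ⊹ ⟨ O₁ ⟩) ⊹ q ◂ ⟨ [] ⟩) ((y′ ◂ ⟨ A₂ ⟩) ⊹ ⟨ O₁ ⟩ ⊹ q ◂ ⟨ [] ⟩) refl)) (cnt-++ x (y′ ∷ A₂))) bʳ)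
              (subst (_≤ 1) (trans (cong (cnt x) (same (q′ ◂ (⟨ O₂ ⟩ ⊹ ⟨ A₁ ⟩) ⊹ y ◂ ⟨ [] ⟩) ((q′ ◂ ⟨ O₂ ⟩) ⊹ ⟨ A₁ ⟩ ⊹ y ◂ ⟨ [] ⟩) refl)) (cnt-++ x (q′ ∷ O₂))) bˡ)))))
            where
            shuffle : ∀ a b c d → (a + b) + (c + d + 1) ≡ ((b + c) + (d + a)) + 1
            shuffle = solve-∀

      only-first : ∀ {q} l → x ∼ q → cnt x (q ∷ l) ≤ 1 → NoN x l
      only-first l xq b = cnt-zero l (n≤0⇒n≡0 (≤-pred (subst (_≤ 1) (cnt-yes l xq) b)))

      only-last : ∀ {q} l → x ∼ q → cnt x (l ++ q ∷ []) ≤ 1 → NoN x l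
      only-last {q} l xq b = only-first l xq (subst (_≤ 1) (cnt-swap x l) b)

      some-spoke : ∀ {M} D {w} E → M ≡ D ++ w ∷ E → x ∼ w → 1 ≤ cnt x M
      some-spoke D E refl xw = subst (1 ≤_) (sym (trans (cnt-++ x D) (cong (cnt x D +_) (cnt-yes E xw))))
        (≤-trans (s≤s z≤n) (m≤n+m _ (cnt x D)))

      env-of : ∀ {l} (¬xv : ¬ x ∼ v) → Rot H l → TwoGaps.Env G isk dia bow ¬xv (λ e → v≢x (sym e)) l
      env-of ¬xv r = TwoGaps.env-rot G isk dia bow ¬xv (λ e → v≢x (sym e)) r (ring , x∉ , v∉ , 4≤)

      -- Only the bounds for the gap `M` are at hand. A spoke inside it, besides `q`, exceeds the
      -- bound if `x` sees `v`; otherwise the gap has exactly two, and `right` demands a third at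
      -- `y` or a neighbour of `v` in `U`. So `M` is spokeless or `v` is good anyway, and in the
      -- former case `U` serves as the gap in `Good`.
      two-only : ∀ {q M y U} → Rot H (q ∷ M ++ y ∷ U) → v ∼ q → v ∼ y → NoN v M → NoN v U → x ∼ q →
        (x ∼ v → Good x H v ⊎ cnt x (q ∷ M ++ y ∷ []) ≤ 1) → (¬ x ∼ v → Good x H v ⊎ cnt x (q ∷ M ++ y ∷ []) ≤ 2) → Good x H v
      two-only {q} {M} {y} {U} r vq vy nM nU xq adjacent apart = choose (first x M)
        where
        good : NoN x M → Good x H v
        good f = y , U , q , M , rot-trans r (rot-turn (q ◂ ⟨ M ⟩) (y ◂ ⟨ U ⟩)) , nU , f , inj₂ nM
        choose : NoN x M ⊎ ∃[ A ] ∃[ w ] ∃[ B ] (M ≡ A ++ w ∷ B × NoN x A × x ∼ w) → Good x H v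
        choose (inj₁ f) = good f
        choose (inj₂ (D , w , E , eM , _ , xw)) with x ∼? v
        ... | yes xv = [ id , (λ b → good (λ i → only-first (M ++ y ∷ []) xq b (∈-++⁺ˡ i))) ]′ (adjacent xv)
        ... | no ¬xv with apart ¬xv
        ... | inj₁ g = g
        ... | inj₂ b with TwoGaps.right G isk dia bow ¬xv (λ e → v≢x (sym e)) M (env-of ¬xv r) vq vy nM exact
          where
          exact : cnt x (q ∷ M ++ y ∷ []) ≡ 2
          exact = ≤-antisym b (subst (2 ≤_) (sym (trans (cnt-yes (M ++ y ∷ []) xq) (cong suc (cnt-++ x M))))
            (s≤s (≤-trans (some-spoke D E eM xw) (m≤m+n _ _))))
        ... | inj₂ (_ , _ , refl , vw) = ⊥-elim (nU (here refl) vw)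
        ... | inj₁ (xy , _) = ⊥-elim (<⇒≱ (subst (3 ≤_) (sym (trans (cnt-yes (M ++ y ∷ []) xq) (cong suc (trans (cnt-++ x M) (cong (cnt x M +_) (cnt-1 xy))))))
              (s≤s (+-monoˡ-≤ 1 (some-spoke D E eM xw)))) b)

      two-only′ : ∀ {q M y U} → Rot H (y ∷ M ++ q ∷ U) → v ∼ q → v ∼ y → NoN v M → NoN v U → x ∼ q →
        (x ∼ v → Good x H v ⊎ cnt x (y ∷ M ++ q ∷ []) ≤ 1) → (¬ x ∼ v → Good x H v ⊎ cnt x (y ∷ M ++ q ∷ []) ≤ 2) → Good x H v
      two-only′ {q} {M} {y} {U} r vq vy nM nU xq adjacent apart = choose (first x M)
        where
        good : NoN x M → Good x H v
        good f = q , U , y , M , rot-trans r (rot-turn (y ◂ ⟨ M ⟩) (q ◂ ⟨ U ⟩)) , nU , f , inj₂ nM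
        choose : NoN x M ⊎ ∃[ A ] ∃[ w ] ∃[ B ] (M ≡ A ++ w ∷ B × NoN x A × x ∼ w) → Good x H v
        choose (inj₁ f) = good f
        choose (inj₂ (D , w , E , eM , _ , xw)) with x ∼? v
        ... | yes xv = [ id , (λ b → good (λ i → only-last (y ∷ M) xq b (there i))) ]′ (adjacent xv)
        ... | no ¬xv with apart ¬xv
        ... | inj₁ g = g
        ... | inj₂ b with TwoGaps.left G isk dia bow ¬xv (λ e → v≢x (sym e)) M (env-of ¬xv r) vy vq nM exact
          where
          exact : cnt x (y ∷ M ++ q ∷ []) ≡ 2
          exact = ≤-antisym b (subst (2 ≤_) (sym (trans (cnt-++ x (y ∷ M)) (cong (cnt x (y ∷ M) +_) (cnt-1 xq))))
            (+-monoˡ-≤ 1 (≤-trans (some-spoke D E eM xw) (cnt-∷≥ x y M))))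
        ... | inj₂ (B , _ , refl , vw) = ⊥-elim (nU (∈-++⁺ʳ B (here refl)) vw)
        ... | inj₁ (xy , _) = ⊥-elim (<⇒≱ (subst (3 ≤_) (sym (trans (cnt-yes (M ++ q ∷ []) xy) (cong suc (trans (cnt-++ x M) (cong (cnt x M +_) (cnt-1 xq))))))
              (s≤s (+-monoˡ-≤ 1 (some-spoke D E eM xw)))) b)

      cnt-one : ∀ A₁ y A₂ → cnt x (A₁ ++ y ∷ A₂) ≤ cnt x (A₁ ++ y ∷ []) + cnt x (y ∷ A₂)
      cnt-one A₁ y A₂ = subst (_≤ cnt x (A₁ ++ y ∷ []) + cnt x (y ∷ A₂)) (sym (cnt-++ x A₁))
        (+-monoˡ-≤ (cnt x (y ∷ A₂)) (subst (cnt x A₁ ≤_) (sym (cnt-++ x A₁)) (m≤m+n (cnt x A₁) (cnt x (y ∷ [])))))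

      cnt-two : ∀ A₁ y B y′ A₂ → cnt x (A₁ ++ y ∷ B ++ y′ ∷ A₂) ≡ cnt x (A₁ ++ y ∷ []) + cnt x (y′ ∷ A₂) + cnt x B
      cnt-two A₁ y B y′ A₂ = trans (cong (cnt x) (sym (flat ((⟨ A₁ ⟩ ⊹ y ◂ ⟨ [] ⟩) ⊹ ⟨ B ⟩ ⊹ y′ ◂ ⟨ A₂ ⟩))))
        (trans (cnt-++ x (A₁ ++ y ∷ [])) (trans (cong (cnt x (A₁ ++ y ∷ []) +_) (trans (cnt-++ x B) (+-comm (cnt x B) _)))
          (sym (+-assoc (cnt x (A₁ ++ y ∷ [])) _ _))))

      -- One choice of `X` and `Y` for every middle part `Z`: the interior spokes can be compared
      -- when `B` is replaced by `v`.
      frame : ∀ O₁ q q′ O₂ → ∃[ a ] ∃[ X ] ∃[ Y ] ∃[ b ] ∀ Z → O₁ ++ q ∷ Z ++ q′ ∷ O₂ ≡ a ∷ (X ++ Z ++ Y) ++ b ∷ []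
      frame O₁ q q′ O₂ with cons-view O₁ | snoc-view q′ O₂
        where
        cons-view : ∀ W → ∃[ a ] ∃[ Z ] (W ++ q ∷ [] ≡ a ∷ Z)
        cons-view [] = q , [] , refl
        cons-view (c ∷ W) = c , W ++ q ∷ [] , refl
      ... | a , X , eX | Y , b , eY = a , X , Y , b , λ Z →
        trans (sym (flat ((⟨ O₁ ⟩ ⊹ q ◂ ⟨ [] ⟩) ⊹ ⟨ Z ⟩ ⊹ q′ ◂ ⟨ O₂ ⟩)))
          (trans (cong₂ (λ s t → s ++ Z ++ t) eX eY) (same (a ◂ ⟨ X ⟩ ⊹ ⟨ Z ⟩ ⊹ ⟨ Y ⟩ ⊹ b ◂ ⟨ [] ⟩) (a ◂ (⟨ X ⟩ ⊹ ⟨ Z ⟩ ⊹ ⟨ Y ⟩) ⊹ b ◂ ⟨ [] ⟩) refl))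

      middle : ∀ O₁ q B q′ O₂ → O ≡ O₁ ++ q ∷ B ++ q′ ∷ O₂ → cnt x B ≤ 1
      middle O₁ q B q′ O₂ eO with frame O₁ q q′ O₂
      ... | a , X , Y , b , shape = ≤-trans (≤-trans (m≤m+n _ _) (m≤n+m (cnt x B + cnt x Y) (cnt x X)))
        (subst (_≤ 1) (trans (cnt-++ x X) (cong (cnt x X +_) (cnt-++ x B))) (thin a (X ++ B ++ Y) b (trans eO (shape B))))

      -- The gap containing all of `A` closes up with `v` in the place of `B`. This stays thin
      -- unless `v` is a spoke and `B` has none, and then `v` is good. As `B` has at most one spoke,
      -- the gap has at least three and violates both gap bounds.
      none-two : ∀ O₁ q B q′ O₂ → O ≡ O₁ ++ q ∷ B ++ q′ ∷ O₂ → NoN v A → v ∼ q → v ∼ q′ → NoN v O₁ → NoN v O₂ → Good x H v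
      none-two O₁ q B q′ O₂ eO nA vq vq′ nO₁ nO₂ with frame O₁ q q′ O₂
      ... | a , X , Y , b , shape = decide (x ∼? v) (cnt x B) refl
        where
        within : cnt x X + (cnt x B + cnt x Y) ≤ 1
        within = subst (_≤ 1) (trans (cnt-++ x X) (cong (cnt x X +_) (cnt-++ x B))) (thin a (X ++ B ++ Y) b (trans eO (shape B)))
        B≤1 : cnt x B ≤ 1
        B≤1 = middle O₁ q B q′ O₂ eO
        r : Rot H (q′ ∷ (O₂ ++ A ++ O₁) ++ q ∷ B)
        r = subst₂ Rot (trans (same ((⟨ A ⟩ ⊹ ⟨ O₁ ⟩ ⊹ q ◂ ⟨ B ⟩) ⊹ q′ ◂ ⟨ O₂ ⟩) (⟨ A ⟩ ⊹ ⟨ O₁ ⟩ ⊹ q ◂ ⟨ B ⟩ ⊹ q′ ◂ ⟨ O₂ ⟩) refl) (cong (A ++_) (sym eO)))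
          (same ((q′ ◂ ⟨ O₂ ⟩) ⊹ ⟨ A ⟩ ⊹ ⟨ O₁ ⟩ ⊹ q ◂ ⟨ B ⟩) (q′ ◂ (⟨ O₂ ⟩ ⊹ ⟨ A ⟩ ⊹ ⟨ O₁ ⟩) ⊹ q ◂ ⟨ B ⟩) refl)
          (rot-swap (A ++ O₁ ++ q ∷ B))
        nM : NoN v (O₂ ++ A ++ O₁)
        nM = NoN-++ O₂ nO₂ (NoN-++ A nA nO₁)
        r′ : Rot (v ∷ q′ ∷ (O₂ ++ A ++ O₁) ++ q ∷ []) (A ++ O₁ ++ q ∷ v ∷ q′ ∷ O₂)
        r′ = subst₂ Rot (same ((v ◂ q′ ◂ ⟨ O₂ ⟩) ⊹ ⟨ A ⟩ ⊹ ⟨ O₁ ⟩ ⊹ q ◂ ⟨ [] ⟩) (v ◂ q′ ◂ (⟨ O₂ ⟩ ⊹ ⟨ A ⟩ ⊹ ⟨ O₁ ⟩) ⊹ q ◂ ⟨ [] ⟩) refl)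
          (flat ((⟨ A ⟩ ⊹ ⟨ O₁ ⟩ ⊹ q ◂ ⟨ [] ⟩) ⊹ v ◂ q′ ◂ ⟨ O₂ ⟩)) (rot-swap (v ∷ q′ ∷ O₂))
        thin′ : cnt x X + (cnt x (v ∷ []) + cnt x Y) ≤ 1 → Thin (O₁ ++ q ∷ v ∷ q′ ∷ O₂)
        thin′ bound a′ M b′ e = subst (λ l → cnt x l ≤ 1)
          (∷ʳ-injectiveˡ (X ++ v ∷ Y) M (∷-injectiveʳ (trans (sym (shape (v ∷ []))) e)))
          (subst (_≤ 1) (sym (trans (cnt-++ x X) (cong (cnt x X +_) (cnt-++ x (v ∷ []) {Y})))) bound)
        arc : List (V G)
        arc = q′ ∷ (O₂ ++ A ++ O₁) ++ q ∷ []
        small : cnt x arc ≤ 2 → ⊥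
        small c = <⇒≱ 4≤ (subst (_≤ 3) (sym (trans (cnt-rot x r) (trans (cong (cnt x) (sym (flat ((q′ ◂ ⟨ O₂ ++ A ++ O₁ ⟩ ⊹ q ◂ ⟨ [] ⟩) ⊹ ⟨ B ⟩))))
          (cnt-++ x arc)))) (+-mono-≤ c B≤1))
        decide : Dec (x ∼ v) → ∀ b → cnt x B ≡ b → Good x H v
        decide (yes xv) zero e = q′ , O₂ ++ A ++ O₁ , q , B , r , nM , cnt-zero B e , inj₁ xv
        decide (yes xv) (suc b) e = [ id , (λ c → ⊥-elim (small (≤-trans c (s≤s z≤n)))) ]′
          (Gap.gap-adjacent {U = B} r vq′ vq nM {A} {R′ = R} rotC (thin′ (subst (λ t → cnt x X + (t + cnt x Y) ≤ 1)
            (trans (≤-antisym B≤1 (subst (1 ≤_) (sym e) (s≤s z≤n))) (sym (cnt-1 xv))) within)) r′ xv)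
        decide (no ¬xv) b e = [ id , (λ c → ⊥-elim (small c)) ]′
          (Gap.gap-apart r vq′ vq nM {A} {R′ = R} rotC (thin′ (subst (λ t → cnt x X + (t + cnt x Y) ≤ 1) (sym (cnt-0 ¬xv))
            (≤-trans (+-monoʳ-≤ (cnt x X) (m≤n+m _ (cnt x B))) within))) r′ ¬xv)

      adjacent-or : ∀ B → (¬ x ∼ v → NoN v B) → x ∼ v ⊎ NoN v B
      adjacent-or B f with x ∼? v
      ... | yes xv = inj₁ xv
      ... | no ¬xv = inj₂ (f ¬xv)

      nowhere : ∀ l → H ≡ l → NoN v l → Good x H v
      nowhere [] e f = ⊥-elim (<⇒≱ 4≤ (subst (λ l → cnt x l ≤ 3) (sym e) z≤n))
      nowhere (h ∷ p) e f = good-one (subst (Rot H) e done) (λ i → f (there i))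

      nonempty : ∀ X {w : V G} {Z} → X ++ w ∷ Z ≢ []
      nonempty [] ()
      nonempty (_ ∷ _) ()

      good : Good x H v
      good with block v A | block v O
      ... | none nA | none nO = nowhere H refl (NoN-++ A nA nO)
      ... | none nA | one O₁ q O₂ vq nO₁ nO₂ = good-one
            (subst₂ Rot (++-assoc A O₁ (q ∷ O₂)) refl (rot-swap (A ++ O₁))) (NoN-++ O₂ nO₂ (NoN-++ A nA nO₁))
      ... | none nA | two O₁ q B q′ O₂ vq vq′ nO₁ nO₂ = none-two O₁ q B q′ O₂ refl nA vq vq′ nO₁ nO₂
      ... | one A₁ y A₂ vy nA₁ nA₂ | none nO = good-one
            (subst₂ Rot (same (⟨ A₁ ⟩ ⊹ y ◂ ⟨ A₂ ⟩ ⊹ ⟨ O ⟩) ((⟨ A₁ ⟩ ⊹ y ◂ ⟨ A₂ ⟩) ⊹ ⟨ O ⟩) refl) refl (rot-swap A₁))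
            (NoN-++ (A₂ ++ O) (NoN-++ A₂ nA₂ nO) nA₁)
      ... | two A₁ y B y′ A₂ vy vy′ nA₁ nA₂ | none nO with two-on-arc A₁ y B y′ A₂ refl vy vy′
      ... | inj₁ g = g
      ... | inj₂ (xB , vB) = y′ , A₂ ++ O ++ A₁ , y , B ,
            subst₂ Rot (same ((⟨ A₁ ⟩ ⊹ y ◂ ⟨ B ⟩) ⊹ y′ ◂ ⟨ A₂ ⟩ ⊹ ⟨ O ⟩) ((⟨ A₁ ⟩ ⊹ y ◂ ⟨ B ⟩ ⊹ y′ ◂ ⟨ A₂ ⟩) ⊹ ⟨ O ⟩) refl)
              (same ((y′ ◂ ⟨ A₂ ⟩ ⊹ ⟨ O ⟩) ⊹ ⟨ A₁ ⟩ ⊹ y ◂ ⟨ B ⟩) (y′ ◂ (⟨ A₂ ⟩ ⊹ ⟨ O ⟩ ⊹ ⟨ A₁ ⟩) ⊹ y ◂ ⟨ B ⟩) refl)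
              (rot-swap (A₁ ++ y ∷ B)) ,
            NoN-++ A₂ nA₂ (NoN-++ O nO nA₁) , xB , adjacent-or B vB
      good | one A₁ y A₂ vy nA₁ nA₂ | one O₁ q O₂ vq nO₁ nO₂ = conclude (cnt-one A₁ y A₂)
          (≤-trans (cnt-one O₁ q O₂) (m≤m+n _ 1))
          (λ ¬xv → TwoGaps.two-gaps₁ G isk dia bow ¬xv (λ e → v≢x (sym e)) (A₂ ++ O₁) (O₂ ++ A₁) (env-of ¬xv rotʳ) vy vq
             (NoN-++ A₂ nA₂ nO₁) (NoN-++ O₂ nO₂ nA₁))
          (λ { refl xq → two-only rotˡ vq vy nA₁ (NoN-++ A₂ nA₂ nO₁) xq (L.gap-adjacent thin-pair) (L.gap-apart thin-pair) })
          (λ { refl xq → two-only′ rotʳ vq vy (NoN-++ A₂ nA₂ (λ ())) (NoN-++ O₂ nO₂ nA₁) xq (R.gap-adjacent thin-pair) (R.gap-apart thin-pair) })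
        where open Both A₁ y A₂ refl A₁ y A₂ refl O₁ q O₂ refl O₁ q O₂ refl vy vy vq vq nA₁ nA₂ nO₁ nO₂
      good | one A₁ y A₂ vy nA₁ nA₂ | two O₁ q B q′ O₂ vq vq′ nO₁ nO₂ = conclude (cnt-one A₁ y A₂)
          (subst (_≤ cnt x (O₁ ++ q ∷ []) + cnt x (q′ ∷ O₂) + 1) (sym (cnt-two O₁ q B q′ O₂)) (+-monoʳ-≤ _ B≤1))
          (λ ¬xv → TwoGaps.two-gaps₃ G isk dia bow ¬xv (λ e → v≢x (sym e)) (A₂ ++ O₁) B (O₂ ++ A₁)
             (subst (TwoGaps.Env G isk dia bow ¬xv (λ e → v≢x (sym e)))
               (same (y ◂ ⟨ A₂ ++ O₁ ⟩ ⊹ q ◂ (⟨ B ⟩ ⊹ q′ ◂ ⟨ O₂ ⟩) ⊹ ⟨ A₁ ⟩) (y ◂ ⟨ A₂ ++ O₁ ⟩ ⊹ q ◂ ⟨ B ⟩ ⊹ q′ ◂ ⟨ O₂ ⟩ ⊹ ⟨ A₁ ⟩) refl)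
               (env-of ¬xv rotʳ)) vy vq vq′
             (NoN-++ A₂ nA₂ nO₁) (NoN-++ O₂ nO₂ nA₁) B≤1)
          (λ e _ → ⊥-elim (nonempty B e)) (λ e _ → ⊥-elim (nonempty O₁ e))
        where
        open Both A₁ y A₂ refl A₁ y A₂ refl O₁ q (B ++ q′ ∷ O₂) refl (O₁ ++ q ∷ B) q′ O₂ (sym (++-assoc O₁ (q ∷ B) (q′ ∷ O₂)))
          vy vy vq vq′ nA₁ nA₂ nO₁ nO₂
        B≤1 = middle O₁ q B q′ O₂ refl
      good | two A₁ y B y′ A₂ vy vy′ nA₁ nA₂ | one O₁ q O₂ vq nO₁ nO₂ with two-on-arc A₁ y B y′ A₂ refl vy vy′
      ... | inj₁ g = g
      ... | inj₂ (xB , vB) = conclude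
          (≤-reflexive (trans (cnt-two A₁ y B y′ A₂) (trans (cong (cnt x (A₁ ++ y ∷ []) + cnt x (y′ ∷ A₂) +_) (cnt-none B xB)) (+-identityʳ _))))
          (≤-trans (cnt-one O₁ q O₂) (m≤m+n _ 1))
          (λ ¬xv → TwoGaps.two-gaps₂ G isk dia bow ¬xv (λ e → v≢x (sym e)) (A₂ ++ O₁) (O₂ ++ A₁) B
             (subst (TwoGaps.Env G isk dia bow ¬xv (λ e → v≢x (sym e)))
               (same (y′ ◂ ⟨ A₂ ++ O₁ ⟩ ⊹ q ◂ ⟨ O₂ ⟩ ⊹ ⟨ A₁ ⟩ ⊹ y ◂ ⟨ B ⟩) (y′ ◂ ⟨ A₂ ++ O₁ ⟩ ⊹ q ◂ (⟨ O₂ ⟩ ⊹ ⟨ A₁ ⟩) ⊹ y ◂ ⟨ B ⟩) refl)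
               (env-of ¬xv rotʳ)) vy′ vq vy
             (NoN-++ A₂ nA₂ nO₁) (NoN-++ O₂ nO₂ nA₁) xB)
          spʳ spˡ
        where
        open Both (A₁ ++ y ∷ B) y′ A₂ (sym (++-assoc A₁ (y ∷ B) (y′ ∷ A₂))) A₁ y (B ++ y′ ∷ A₂) refl O₁ q O₂ refl O₁ q O₂ refl
          vy vy′ vq vq nA₁ nA₂ nO₁ nO₂
        goodʳ : NoN x (O₂ ++ A₁ ++ y ∷ B) → x ∼ v → Good x H v
        goodʳ f xv = y′ , A₂ ++ O₁ , q , O₂ ++ A₁ ++ y ∷ B , rotʳ , NoN-++ A₂ nA₂ nO₁ , f , inj₁ xv
        goodˡ : NoN x ((B ++ y′ ∷ A₂) ++ O₁) → x ∼ v → Good x H v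
        goodˡ f xv = q , O₂ ++ A₁ , y , (B ++ y′ ∷ A₂) ++ O₁ , rotˡ , NoN-++ O₂ nO₂ nA₁ , f , inj₁ xv
        three : ¬ x ∼ v → cnt v H ≡ 3
        three ¬xv = trans (cnt-rot v rotʳ) (trans (cnt-yes ((A₂ ++ O₁) ++ q ∷ O₂ ++ A₁ ++ y ∷ B) vy′) (cong suc
          (trans (cnt-++ v (A₂ ++ O₁)) (cong₂ _+_ (cnt-none (A₂ ++ O₁) (NoN-++ A₂ nA₂ nO₁)) (trans (cnt-yes (O₂ ++ A₁ ++ y ∷ B) vq) (cong suc
            (trans (cong (cnt v) (sym (++-assoc O₂ A₁ (y ∷ B)))) (trans (cnt-++ v (O₂ ++ A₁))
              (cong₂ _+_ (cnt-none (O₂ ++ A₁) (NoN-++ O₂ nO₂ nA₁)) (trans (cnt-yes B vy) (cong suc (cnt-none B (vB ¬xv)))))))))))))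
        -- The right-hand ring may fail to be thin. If `x` does not see `v`, then `v` has exactly
        -- three neighbours on the ring. If it does, the left gap has no spoke but `q`, so
        -- everything beyond the right gap is spokeless and that gap shows `v` good.
        spʳ : O₂ ≡ [] → x ∼ q → Good x H v
        spʳ e xq with x ∼? v
        ... | no ¬xv = ⊥-elim (three-neighbours (three ¬xv))
        ... | yes xv with L.gap-adjacent (subst (λ l → Thin (v ∷ q ∷ l)) (sym e) thin-pair) xv
        ... | inj₁ g = g
        ... | inj₂ b = goodʳ (∈-NoN (only-first ((O₂ ++ A₁) ++ y ∷ []) xq b)) xv
          where
          ∈-NoN : NoN x ((O₂ ++ A₁) ++ y ∷ []) → NoN x (O₂ ++ A₁ ++ y ∷ B)
          ∈-NoN f = subst (NoN x) (++-assoc O₂ A₁ (y ∷ B)) (NoN-++ (O₂ ++ A₁) (λ i → f (∈-++⁺ˡ i)) (NoN-∷ (f (∈-++⁺ʳ (O₂ ++ A₁) (here refl))) xB))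
        spˡ : O₁ ≡ [] → x ∼ q → Good x H v
        spˡ e xq with x ∼? v
        ... | no ¬xv = ⊥-elim (three-neighbours (three ¬xv))
        ... | yes xv with R.gap-adjacent (subst (λ l → Thin (l ++ q ∷ v ∷ [])) (sym e) thin-pair) xv
        ... | inj₁ g = g
        ... | inj₂ b = goodˡ (∈-NoN (only-last (y′ ∷ A₂ ++ O₁) xq b)) xv
          where
          ∈-NoN : NoN x (y′ ∷ A₂ ++ O₁) → NoN x ((B ++ y′ ∷ A₂) ++ O₁)
          ∈-NoN f = subst (NoN x) (sym (++-assoc B (y′ ∷ A₂) O₁)) (NoN-++ B xB f)
      good | two A₁ y B y′ A₂ vy vy′ nA₁ nA₂ | two O₁ q D q′ O₂ vq vq′ nO₁ nO₂ with two-on-arc A₁ y B y′ A₂ refl vy vy′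
      ... | inj₁ g = g
      ... | inj₂ (xB , vB) = conclude
          (≤-reflexive (trans (cnt-two A₁ y B y′ A₂) (trans (cong (cnt x (A₁ ++ y ∷ []) + cnt x (y′ ∷ A₂) +_) (cnt-none B xB)) (+-identityʳ _))))
          (subst (_≤ cnt x (O₁ ++ q ∷ []) + cnt x (q′ ∷ O₂) + 1) (sym (cnt-two O₁ q D q′ O₂)) (+-monoʳ-≤ _ D≤1))
          (λ ¬xv → TwoGaps.two-gaps₄ G isk dia bow ¬xv (λ e → v≢x (sym e)) (A₂ ++ O₁) D (O₂ ++ A₁) B
             (subst (TwoGaps.Env G isk dia bow ¬xv (λ e → v≢x (sym e)))
               (same (y′ ◂ ⟨ A₂ ++ O₁ ⟩ ⊹ q ◂ (⟨ D ⟩ ⊹ q′ ◂ ⟨ O₂ ⟩) ⊹ ⟨ A₁ ⟩ ⊹ y ◂ ⟨ B ⟩)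
                     (y′ ◂ ⟨ A₂ ++ O₁ ⟩ ⊹ q ◂ ⟨ D ⟩ ⊹ q′ ◂ (⟨ O₂ ⟩ ⊹ ⟨ A₁ ⟩) ⊹ y ◂ ⟨ B ⟩) refl)
               (env-of ¬xv rotʳ)) vy′ vq vq′ vy
             (NoN-++ A₂ nA₂ nO₁) (NoN-++ O₂ nO₂ nA₁) (vB ¬xv) xB D≤1)
          (λ e _ → ⊥-elim (nonempty D e)) (λ e _ → ⊥-elim (nonempty O₁ e))
        where
        open Both (A₁ ++ y ∷ B) y′ A₂ (sym (++-assoc A₁ (y ∷ B) (y′ ∷ A₂))) A₁ y (B ++ y′ ∷ A₂) refl
          O₁ q (D ++ q′ ∷ O₂) refl (O₁ ++ q ∷ D) q′ O₂ (sym (++-assoc O₁ (q ∷ D) (q′ ∷ O₂)))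
          vy vy′ vq vq′ nA₁ nA₂ nO₁ nO₂
        D≤1 = middle O₁ q D q′ O₂ refl

  Smaller : List (V G) → List (V G) → Set
  Smaller l′ l = cnt x l′ < cnt x l ⊎ (cnt x l′ ≡ cnt x l × length l′ < length l)

  ring-step : ∀ A O R → Rot C (A ++ R) → Cyc (A ++ O) → x ∉ A ++ O → Thin O → 3 ≤ cnt x (A ++ O) → cnt x (A ++ O) < cnt x C →
    (∀ A′ O′ R′ → Rot C (A′ ++ R′) → Cyc (A′ ++ O′) → x ∉ A′ ++ O′ → Thin O′ → 3 ≤ cnt x (A′ ++ O′) →
       Smaller (A′ ++ O′) (A ++ O) → ⊥) → ⊥
  ring-step A O R rotC ring x∉ thin three <m smaller = go (A ++ O) refl
    where
    4≤ : 4 ≤ cnt x (A ++ O)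
    4≤ = ≤∧≢⇒< three (λ e → three-spokes isk ring x∉ (sym e))
    open Step A O R rotC ring x∉ thin 4≤ <m smaller
    go : ∀ l → A ++ O ≡ l → ⊥
    go [] e = <⇒≱ three (subst (λ l → cnt x l ≤ 2) (sym e) z≤n)
    go (h ∷ p) e = <⇒≱ <m (subst (λ l → cnt x C ≤ cnt x l) (sym e) (least (subst Cyc e ring)
      -- Four spokes force four vertices, so the ring is a hole.
      (≤-pred (≤-trans (subst (λ l → 4 ≤ cnt x l) e 4≤) (cnt-≤length x (h ∷ p))))
      (subst (x ∉_) e x∉) (subst (λ l → 3 ≤ cnt x l) e three)
      (λ v v∉ v≢x → subst (λ l → Good x l v) e (Outside.good v (subst (v ∉_) (sym e) v∉) v≢x))))

  private
    -- Lexicographic descent: the length bound `n` is reset whenever the spoke bound `c` drops.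
    descend : ∀ c n A O R → cnt x (A ++ O) ≤ c → length (A ++ O) ≤ n → Rot C (A ++ R) → Cyc (A ++ O) → x ∉ A ++ O →
      Thin O → 3 ≤ cnt x (A ++ O) → cnt x (A ++ O) < cnt x C → ⊥
    descend zero n A O R ≤c _ _ _ _ _ three _ = <⇒≱ three (≤-trans ≤c z≤n)
    descend (suc c) zero A O R _ ≤n _ _ _ _ three _ = <⇒≱ three (≤-trans (cnt-≤length x (A ++ O)) (≤-trans ≤n z≤n))
    descend (suc c) (suc n) A O R ≤c ≤n rotC ring x∉ thin three <m =
      ring-step A O R rotC ring x∉ thin three <m (λ A′ O′ R′ rC k x∉′ th 3≤ →
        [ (λ l → descend c (length (A′ ++ O′)) A′ O′ R′ (≤-pred (≤-trans l ≤c)) ≤-refl rC k x∉′ th 3≤ (<-trans l <m))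
        , (λ p → descend (suc c) n A′ O′ R′ (subst (_≤ suc c) (sym (proj₁ p)) ≤c) (≤-pred (≤-trans (proj₂ p) ≤n))
            rC k x∉′ th 3≤ (subst (_< cnt x C) (sym (proj₁ p)) <m)) ]′)

  no-thin-ring : ∀ A O R → Rot C (A ++ R) → Cyc (A ++ O) → x ∉ A ++ O →
    Thin O → 3 ≤ cnt x (A ++ O) → cnt x (A ++ O) < cnt x C → ⊥
  no-thin-ring A O R = descend _ _ A O R ≤-refl ≤-refl

-- Walks inside a set of vertices, and the induced paths they contain.

module Trails (G : Graph) where
  open Paths G

  data Trail (Q : V G → Set) : V G → V G → ℕ → Set where
    stop : ∀ {v} → Q v → Trail Q v v 0
    step : ∀ {u w v n} → Q u → u ∼ w → Trail Q w v n → Trail Q u v (suc n)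

  trail-snoc : ∀ {Q u v w n} → Trail Q u v n → v ∼ w → Q w → Trail Q u w (suc n)
  trail-snoc (stop q) e r = step q e (stop r)
  trail-snoc (step q e′ t) e r = step q e′ (trail-snoc t e r)

  trail-reverse : ∀ {Q u v n} → Trail Q u v n → Trail Q v u n
  trail-reverse (stop q) = stop q
  trail-reverse (step q e t) = trail-snoc (trail-reverse t) (∼-sym e) q

  trail-in : ∀ {Q L} → IPath L → (∀ {w} → w ∈ L → Q w) → ∀ {u w} → u ∈ L → w ∈ L → ∃[ n ] (n < length L × Trail Q u w n)
  trail-in p f (here refl) (here refl) = 0 , s≤s z≤n , stop (f (here refl))
  trail-in (link e _ p) f (here refl) (there j) with trail-in p (λ i → f (there i)) (here refl) j
  ... | n , l , t = suc n , s≤s l , step (f (here refl)) e t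
  trail-in (link e _ p) f (there i) (here refl) with trail-in p (λ i → f (there i)) i (here refl)
  ... | n , l , t = suc n , s≤s l , trail-snoc t (∼-sym e) (f (here refl))
  trail-in p f (there i) (there j) with trail-in (ip-tail p) (λ i → f (there i)) i j
  ... | n , l , t = n , ≤-trans l (n≤1+n _) , t

  data Last (q : V G) : List (V G) → Set where
    end  : Last q (q ∷ [])
    more : ∀ {a l} → Last q l → Last q (a ∷ l)

  last-suffix : ∀ {q} X {w Y} → Last q (X ++ w ∷ Y) → Last q (w ∷ Y)
  last-suffix [] l = l
  last-suffix (_ ∷ []) (more l) = l
  last-suffix (_ ∷ b ∷ X) (more l) = last-suffix (b ∷ X) l

  last-snoc : ∀ {q l} → Last q l → ∃[ I ] l ≡ I ++ q ∷ []
  last-snoc end = [] , refl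
  last-snoc (more {a} l) with last-snoc l
  ... | I , e = a ∷ I , cong (a ∷_) e

  -- Built from the far end: if `u` is already on the path, cut there; otherwise enter the path at
  -- the last neighbour of `u`. The length never grows, which the induction in `linked` relies on.
  induced-path : ∀ {Q u v n} → Trail Q u v n →
    ∃[ L ] (IPath (u ∷ L) × Last v (u ∷ L) × (∀ {w} → w ∈ u ∷ L → Q w) × length L ≤ n)
  induced-path (stop q) = [] , [-] , end , (λ { (here refl) → q }) , z≤n
  induced-path (step {u} {b} {v} {n} q e t) with induced-path t
  ... | L , p , l , f , len with u ∈? (b ∷ L)
  ... | yes u∈ with ∈-∃++ u∈
  ... | X , Y , eq = Y , ip-++ʳ X (subst IPath eq p) , last-suffix X (subst (Last v) eq l) ,
        (λ i → f (∈-cast (sym eq) (∈-++⁺ʳ X i))) ,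
        ≤-trans (≤-pred (subst (suc (length Y) ≤_) (sym (trans (cong length eq) (length-++ X))) (m≤n+m _ (length X)))) (≤-trans len (n≤1+n n))
  induced-path (step {u} {b} {v} {n} q e t) | L , p , l , f , len | no u∉ with last u (b ∷ L)
  ... | inj₁ none = ⊥-elim (none (here refl) e)
  ... | inj₂ (X , w , Y , eq , nY , uw) = w ∷ Y ,
        link uw (λ i → (λ { refl → u∉ (∈-cast (sym eq) (∈-++⁺ʳ X (there i))) }) , nY i) (ip-++ʳ X (subst IPath eq p)) ,
        more (last-suffix X (subst (Last v) eq l)) ,
        (λ { (here refl) → q ; (there i) → f (∈-cast (sym eq) (∈-++⁺ʳ X i)) }) ,
        ≤-trans (subst (suc (length Y) ≤_) (sym (trans (cong length eq) (length-++ X))) (m≤n+m _ (length X))) (s≤s len)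

  arc-ring : ∀ {Z} N {Y p} I {q} → IPath (Z ∷ N ++ Y ∷ []) → IPath (p ∷ I ++ q ∷ []) → Y ∼ p → q ∼ Z →
    (∀ {u w} → u ∈ p ∷ I ++ q ∷ [] → w ∈ Z ∷ N ++ Y ∷ [] → u ≢ w) →
    (∀ {u w} → u ∈ p ∷ I ++ q ∷ [] → w ∈ Z ∷ N ++ Y ∷ [] → u ∼ w → (u ≡ p × w ≡ Y) ⊎ (u ≡ q × w ≡ Z)) →
    Cyc ((Z ∷ N ++ Y ∷ []) ++ p ∷ I ++ q ∷ [])
  arc-ring {Z} N {Y} {p} I {q} arc path yp qz ne cross with snoc-view p I
  ... | J , b , e = subst Cyc (same ((Z ◂ ⟨ N ⟩ ⊹ Y ◂ p ◂ ⟨ I ⟩) ⊹ q ◂ ⟨ [] ⟩) ((Z ◂ ⟨ N ⟩ ⊹ Y ◂ ⟨ [] ⟩) ⊹ p ◂ ⟨ I ⟩ ⊹ q ◂ ⟨ [] ⟩) refl)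
      (cyc-rot₁ (subst (λ l → Cyc (q ∷ Z ∷ l)) (sym eq)
        (mkCyc (N ++ Y ∷ J) (subst (λ l → IPath (Z ∷ l)) eq whole) qz (∼-sym (ip-adj J path′)) off)))
    where
    eq : N ++ Y ∷ p ∷ I ≡ (N ++ Y ∷ J) ++ b ∷ []
    eq = trans (cong (λ l → N ++ Y ∷ l) e) (sym (flat ((⟨ N ⟩ ⊹ Y ◂ ⟨ J ⟩) ⊹ b ◂ ⟨ [] ⟩)))
    path′ : IPath (J ++ b ∷ q ∷ [])
    path′ = subst IPath (trans (cong (_++ q ∷ []) e) (++-assoc J (b ∷ []) (q ∷ []))) path
    q∉ : q ∉ p ∷ I
    q∉ i with ∈-∃++ i
    ... | X , X′ , e′ = ip-fresh (ip-++ʳ X (subst IPath (trans (cong (_++ q ∷ []) e′) (++-assoc X _ _)) path)) (∈-++⁺ʳ X′ (here refl))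
    Y∉ : ∀ {w} → w ∈ Z ∷ N → w ≢ Y
    Y∉ i refl with ∈-∃++ i
    ... | X , X′ , e′ = ip-fresh (ip-++ʳ X (subst IPath (trans (cong (_++ Y ∷ []) e′) (++-assoc X _ _)) arc)) (∈-++⁺ʳ X′ (here refl))
    p∈ : ∀ {u} → u ∈ p ∷ I → u ∈ p ∷ I ++ q ∷ []
    p∈ = ∈-++⁺ˡ
    q∈ : q ∈ p ∷ I ++ q ∷ []
    q∈ = there (∈-++⁺ʳ I (here refl))
    Z∈ : ∀ {w} → w ∈ Z ∷ N → w ∈ Z ∷ N ++ Y ∷ []
    Z∈ = ∈-++⁺ˡ
    Y∈ : Y ∈ Z ∷ N ++ Y ∷ []
    Y∈ = there (∈-++⁺ʳ N (here refl))
    whole : IPath (Z ∷ N ++ Y ∷ p ∷ I)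
    whole = ip-join (Z ∷ N) arc (ip-++ˡ (p ∷ I) path) yp
      (λ w∈ u∈ → (λ e′ → ne (p∈ u∈) (Z∈ w∈) (sym e′)) , λ a → case cross (p∈ u∈) (Z∈ w∈) (∼-sym a) of λ
        { (inj₁ (_ , w≡Y)) → Y∉ w∈ w≡Y ; (inj₂ (refl , _)) → q∉ u∈ })
      (λ u∈ → (λ e′ → ne (p∈ (there u∈)) Y∈ (sym e′)) , λ a → case cross (p∈ (there u∈)) Y∈ (∼-sym a) of λ
        { (inj₁ (refl , _)) → ip-fresh path (∈-++⁺ˡ u∈) ; (inj₂ (refl , _)) → q∉ (there u∈) })
    off : Off q (N ++ Y ∷ J)
    off i with ∈-++⁻ N i
    ... | inj₁ j = ne q∈ (Z∈ (there j)) , λ a → case cross q∈ (Z∈ (there j)) a of λ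
        { (inj₁ (refl , _)) → q∉ (here refl) ; (inj₂ (_ , refl)) → ip-fresh arc (∈-++⁺ˡ j) }
    ... | inj₂ (here refl) = ne q∈ Y∈ , λ a → case cross q∈ Y∈ a of λ
        { (inj₁ (refl , _)) → q∉ (here refl) ; (inj₂ (_ , refl)) → Y∉ (here refl) refl }
    ... | inj₂ (there j) = #-sym (ip-cross J path′ j (here refl))

-- A shortest walk attached to `C` in no common sector.

module Walks (G : Graph) (isk : ISK4-free G) (dia : Diamond-free G) (bow : Bowtie-free G)
  {x : V G} {C : List (V G)} (rim : Rim G x C) where
  open Paths G
  open Hub G
  open Local G isk dia bow
  open Trails G
  open Rim rim
  open Core G isk dia bow rim using (Thin; no-thin-ring)

  Out : V G → Set
  Out v = v ∉ C × v ≢ x × ¬ x ∼ v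

  -- Lying in a common sector, expressed through the two arcs of `C` between `a` and `b`; vacuous
  -- for `a` equal to `b`.
  SS : V G → V G → Set
  SS a b = ∀ {M M′} → Rot C (a ∷ M ++ b ∷ M′) → NoN x M ⊎ NoN x M′

  four : 4 ≤ cnt x C
  four = ≤∧≢⇒< spokes (λ e → three-spokes isk ringC x∉C (sym e))

  has-spoke : ∀ {s} l → s ∈ l → x ∼ s → 1 ≤ cnt x l
  has-spoke l i xs with cnt x l in e
  ... | zero = ⊥-elim (cnt-zero l e i xs)
  ... | suc _ = s≤s z≤n

  -- A shortest walk p I q off C and N[x], attached to C at y and z in no common sector.
  record Bad (p : V G) (I : List (V G)) (q y : V G) (M : List (V G)) (z : V G) (M′ : List (V G)) : Set where
    field
      path : IPath (p ∷ I ++ q ∷ [])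
      out  : ∀ {w} → w ∈ p ∷ I ++ q ∷ [] → Out w
      ssˡ  : ∀ {u w a b} → u ∈ p ∷ I → w ∈ p ∷ I → u ∼ a → w ∼ b → SS a b
      ssʳ  : ∀ {u w a b} → u ∈ I ++ q ∷ [] → w ∈ I ++ q ∷ [] → u ∼ a → w ∼ b → SS a b
      rot  : Rot C (y ∷ M ++ z ∷ M′)
      py   : p ∼ y
      qz   : q ∼ z
      {s s′} : V G
      s∈   : s ∈ M
      xs   : x ∼ s
      s′∈  : s′ ∈ M′
      xs′  : x ∼ s′

  -- What the walk sees other than through exactly one of its ends. By minimality such a `t` shares
  -- a sector with each neighbour of `p` and each neighbour of `q` on `C`.
  Inner : V G → List (V G) → V G → V G → Set
  Inner p I q t = (∃[ u ] (u ∈ I × u ∼ t)) ⊎ (p ∼ t × q ∼ t)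

  rev-ends : ∀ p I (q : V G) → reverse (p ∷ I ++ q ∷ []) ≡ q ∷ reverse I ++ p ∷ []
  rev-ends p I q = rev-nf (p ◂ ⟨ I ⟩ ⊹ q ◂ ⟨ [] ⟩)

  flip : ∀ {p I q y M z M′} → Bad p I q y M z M′ → Bad q (reverse I) p z M′ y M
  flip {p} {I} {q} {y} {M} {z} {M′} B = record
    { path = subst IPath (rev-ends p I q) (ip-reverse path)
    ; out = λ i → out (∈-rev (∈-cast (sym (rev-ends p I q)) i))
    ; ssˡ = λ i j → ssʳ (∈-leg I i) (∈-leg I j)
    ; ssʳ = λ i j → ssˡ (back i) (back j)
    ; rot = rot-trans rot (rot-turn (y ◂ ⟨ M ⟩) (z ◂ ⟨ M′ ⟩))
    ; py = qz ; qz = py ; s∈ = s′∈ ; xs = xs′ ; s′∈ = s∈ ; xs′ = xs }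
    where
    open Bad B
    back : ∀ {u} → u ∈ reverse I ++ p ∷ [] → u ∈ p ∷ I
    back i with ∈-++⁻ (reverse I) i
    ... | inj₁ j = there (∈-rev j)
    ... | inj₂ (here refl) = here refl

  -- The arc Z N Y of z M′ y from the last neighbour of q to the next neighbour of p.
  record Span (p q y z : V G) (M′ : List (V G)) : Set where
    field
      {Z Y} : V G
      {D E N F} : List (V G)
      eD : z ∷ M′ ≡ D ++ Z ∷ E
      qZ : q ∼ Z
      nE : NoN q E
      eE : E ++ y ∷ [] ≡ N ++ Y ∷ F
      pY : p ∼ Y
      nN : NoN p N

  inner-flip : ∀ {p I q t} → Inner p I q t → Inner q (reverse I) p t
  inner-flip (inj₁ (u , i , e)) = inj₁ (u , reverse⁺ i , e)
  inner-flip (inj₂ (a , b)) = inj₂ (b , a)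

  module _ {p I q y M z M′} (B : Bad p I q y M z M′) where
    open Bad B

    ¬z : ∀ {u} → u ∈ p ∷ I → ¬ u ∼ z
    ¬z i e with ssˡ (here refl) i py e rot
    ... | inj₁ f = f s∈ xs
    ... | inj₂ f = f s′∈ xs′

    ¬y : ∀ {u} → u ∈ I ++ q ∷ [] → ¬ u ∼ y
    ¬y i e with ssʳ i (∈-++⁺ʳ I (here refl)) e qz rot
    ... | inj₁ f = f s∈ xs
    ... | inj₂ f = f s′∈ xs′

    innerˡ : ∀ {t} → Inner p I q t → ∃[ u ] (u ∈ p ∷ I × u ∼ t)
    innerˡ (inj₁ (u , i , e)) = u , there i , e
    innerˡ (inj₂ (e , _)) = p , here refl , e

    innerʳ : ∀ {t} → Inner p I q t → ∃[ u ] (u ∈ I ++ q ∷ [] × u ∼ t)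
    innerʳ (inj₁ (u , i , e)) = u , ∈-++⁺ˡ i , e
    innerʳ (inj₂ (_ , e)) = q , ∈-++⁺ʳ I (here refl) , e

    ss-p : ∀ {t a} → Inner p I q t → p ∼ a → SS a t × SS t a
    ss-p i e with innerˡ i
    ... | u , u∈ , ut = ssˡ (here refl) u∈ e ut , ssˡ u∈ (here refl) ut e

    ss-q : ∀ {t a} → Inner p I q t → q ∼ a → SS a t × SS t a
    ss-q i e with innerʳ i
    ... | u , u∈ , ut = ssʳ (∈-++⁺ʳ I (here refl)) u∈ e ut , ssʳ u∈ (∈-++⁺ʳ I (here refl)) ut e

    -- `t` shares a sector with `y` and with `z`. The arcs running through `M′` contain the spoke
    -- `s′`, so `M₁` and `M₂` are spokeless, and the spoke `s` of `M` must be `t`.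
    inner-alone : ∀ {t} → Inner p I q t → ∀ M₁ M₂ → M ≡ M₁ ++ t ∷ M₂ → NoN x M₁ × NoN x M₂ × x ∼ t
    inner-alone {t} i M₁ M₂ refl = n₁ , n₂ , xt
      where
      n₁ : NoN x M₁
      n₁ with proj₁ (ss-p i py) (subst (λ l → Rot C (y ∷ l)) (++-assoc M₁ (t ∷ M₂) (z ∷ M′)) rot)
      ... | inj₁ f = f
      ... | inj₂ f = ⊥-elim (f (∈-++⁺ʳ M₂ (there s′∈)) xs′)
      n₂ : NoN x M₂
      n₂ with proj₂ (ss-q i qz) (rot-trans (subst (λ l → Rot C (y ∷ l)) (++-assoc M₁ (t ∷ M₂) (z ∷ M′)) rot)
               (rot-turn (y ◂ ⟨ M₁ ⟩) (t ◂ ⟨ M₂ ⟩ ⊹ z ◂ ⟨ M′ ⟩)))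
      ... | inj₁ f = f
      ... | inj₂ f = ⊥-elim (f (∈-++⁺ˡ s′∈) xs′)
      xt : x ∼ t
      xt with ∈-++⁻ M₁ s∈
      ... | inj₁ j = ⊥-elim (n₁ j xs)
      ... | inj₂ (here refl) = xs
      ... | inj₂ (there j) = ⊥-elim (n₂ j xs)

  module _ {p I q y M z M′} (B : Bad p I q y M z M′) where
    open Bad B

    -- All spokes of `C` would be among `y`, `t`, `z`, `t′`. As `t` and `t′` share a sector, `y` or
    -- `z` is no spoke, and at most three remain.
    inner-once : ∀ {t t′} → Inner p I q t → t ∈ M → Inner p I q t′ → t′ ∈ M′ → ⊥
    inner-once {t} {t′} i t∈ i′ t′∈ with ∈-∃++ t∈ | ∈-∃++ t′∈
    ... | M₁ , M₂ , refl | N₁ , N₂ , refl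
      with inner-alone B i M₁ M₂ refl | inner-alone (flip B) (inner-flip {I = I} i′) N₁ N₂ refl
    ... | n₁ , n₂ , xt | k₁ , k₂ , xt′ with innerˡ B i | innerˡ B i′
    ... | u , u∈ , ut | w , w∈ , wt′ with ssˡ u∈ w∈ ut wt′ r
      where
      r : Rot C (t ∷ (M₂ ++ z ∷ N₁) ++ t′ ∷ N₂ ++ y ∷ M₁)
      r = subst (Rot C) (same (t ◂ ⟨ M₂ ⟩ ⊹ z ◂ ⟨ N₁ ⟩ ⊹ t′ ◂ ⟨ N₂ ⟩ ⊹ y ◂ ⟨ M₁ ⟩) (t ◂ (⟨ M₂ ⟩ ⊹ z ◂ ⟨ N₁ ⟩) ⊹ t′ ◂ ⟨ N₂ ⟩ ⊹ y ◂ ⟨ M₁ ⟩) refl)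
        (rot-trans (subst (Rot C) (flat (y ◂ (⟨ M₁ ⟩ ⊹ t ◂ ⟨ M₂ ⟩) ⊹ z ◂ ⟨ N₁ ⟩ ⊹ t′ ◂ ⟨ N₂ ⟩)) rot)
          (rot-turn (y ◂ ⟨ M₁ ⟩) (t ◂ ⟨ M₂ ⟩ ⊹ z ◂ ⟨ N₁ ⟩ ⊹ t′ ◂ ⟨ N₂ ⟩)))
    ... | f = <⇒≱ four (subst (_≤ 3) (sym total) (few-spokes f))
      where
      total : cnt x C ≡ cnt x (y ∷ []) + (1 + (cnt x (z ∷ []) + 1))
      total = trans (cnt-rot x rot) (trans (cnt-∷ x y ((M₁ ++ t ∷ M₂) ++ z ∷ N₁ ++ t′ ∷ N₂)) (cong (cnt x (y ∷ []) +_)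
        (trans (cong (cnt x) (flat ((⟨ M₁ ⟩ ⊹ t ◂ ⟨ M₂ ⟩) ⊹ z ◂ ⟨ N₁ ⟩ ⊹ t′ ◂ ⟨ N₂ ⟩)))
        (trans (cnt-skip M₁ n₁) (trans (cnt-yes (M₂ ++ z ∷ N₁ ++ t′ ∷ N₂) xt) (cong suc
        (trans (cnt-skip M₂ n₂) (trans (cnt-∷ x z (N₁ ++ t′ ∷ N₂)) (cong (cnt x (z ∷ []) +_)
        (trans (cnt-skip N₁ k₁) (trans (cnt-yes N₂ xt′) (cong suc (cnt-none N₂ k₂)))))))))))))
      few-spokes : NoN x (M₂ ++ z ∷ N₁) ⊎ NoN x (N₂ ++ y ∷ M₁) → cnt x (y ∷ []) + (1 + (cnt x (z ∷ []) + 1)) ≤ 3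
      few-spokes (inj₁ f) = +-mono-≤ (cnt-∷≤ x y []) (≤-reflexive (cong (λ n → 1 + (n + 1)) (cnt-0 (f (∈-++⁺ʳ M₂ (here refl))))))
      few-spokes (inj₂ f) = subst (λ n → n + (1 + (cnt x (z ∷ []) + 1)) ≤ 3) (sym (cnt-0 (f (∈-++⁺ʳ N₂ (here refl)))))
        (s≤s (+-monoˡ-≤ 1 (cnt-∷≤ x z [])))

    span : Span p q y z M′
    span with last q (z ∷ M′)
    ... | inj₁ f = ⊥-elim (f (here refl) qz)
    ... | inj₂ (D , Z , E , e , nE , qZ) with first p (E ++ y ∷ [])
    ... | inj₁ f = ⊥-elim (f (∈-++⁺ʳ E (here refl)) py)
    ... | inj₂ (N , Y , F , e′ , nN , pY) = record { eD = e ; qZ = qZ ; nE = nE ; eE = e′ ; pY = pY ; nN = nN }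

    module _ (S : Span p q y z M′) where
      open Span S

      span-rot : Rot C ((Z ∷ N ++ Y ∷ []) ++ F ++ M ++ D)
      span-rot = rot-trans rot (subst₂ Rot eq₁ refl (rot-trans (rot-turn (y ◂ ⟨ M ⟩ ⊹ ⟨ D ⟩) (Z ◂ ⟨ E ⟩))
          (subst (λ l → Rot l ((Z ∷ N ++ Y ∷ []) ++ F ++ M ++ D)) eq₂ done)))
        where
        eq₁ : y ∷ M ++ D ++ Z ∷ E ≡ y ∷ M ++ z ∷ M′
        eq₁ = cong (λ l → y ∷ M ++ l) (sym eD)
        eq₂ : (Z ∷ N ++ Y ∷ []) ++ F ++ M ++ D ≡ Z ∷ E ++ y ∷ M ++ D
        eq₂ = trans (same ((Z ◂ ⟨ N ⟩ ⊹ Y ◂ ⟨ [] ⟩) ⊹ ⟨ F ⟩ ⊹ ⟨ M ⟩ ⊹ ⟨ D ⟩) (Z ◂ (⟨ N ⟩ ⊹ Y ◂ ⟨ F ⟩) ⊹ ⟨ M ⟩ ⊹ ⟨ D ⟩) refl)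
          (trans (cong (λ l → Z ∷ l ++ M ++ D) (sym eE)) (flat (Z ◂ (⟨ E ⟩ ⊹ y ◂ ⟨ [] ⟩) ⊹ ⟨ M ⟩ ⊹ ⟨ D ⟩)))

      span-∈ : ∀ {w} → w ∈ N ++ Y ∷ [] → w ∈ E ++ y ∷ []
      span-∈ i = ∈-cast (sym eE) (∈-cast (flat ((⟨ N ⟩ ⊹ Y ◂ ⟨ [] ⟩) ⊹ ⟨ F ⟩)) (∈-++⁺ˡ i))

      E⊆ : ∀ {w} → w ∈ E → w ∈ M′
      E⊆ i with D | eD
      ... | [] | e = ∈-cast (sym (∷-injectiveʳ e)) i
      ... | d ∷ D′ | e = ∈-cast (sym (∷-injectiveʳ e)) (∈-++⁺ʳ D′ (there i))

      Z∈ : Z ≡ z ⊎ Z ∈ M′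
      Z∈ with D | eD
      ... | [] | e = inj₁ (sym (∷-injectiveˡ e))
      ... | d ∷ D′ | e = inj₂ (∈-cast (sym (∷-injectiveʳ e)) (∈-++⁺ʳ D′ (here refl)))

      arc-∈C : ∀ {w} → w ∈ Z ∷ N ++ Y ∷ [] → w ∈ C
      arc-∈C i = rot-∈⁻ span-rot (∈-++⁺ˡ i)

      arc-path : IPath (Z ∷ N ++ Y ∷ [])
      arc-path = cyc-arc (Z ∷ N ++ Y ∷ []) (∈-++⁺ʳ F (∈-++⁺ˡ s∈)) (rot-cyc span-rot ringC)

      span-cnt : cnt x C ≡ cnt x (Z ∷ N ++ Y ∷ []) + (cnt x F + (cnt x M + cnt x D))
      span-cnt = trans (cnt-rot x span-rot) (trans (cnt-++ x (Z ∷ N ++ Y ∷ [])) (cong (cnt x (Z ∷ N ++ Y ∷ []) +_)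
        (trans (cnt-++ x F) (cong (cnt x F +_) (cnt-++ x M)))))

      module _ (free : ∀ {t} → Inner p I q t → t ∈ M′ → ⊥) where

        ¬inner : ∀ {u w} → u ∈ I → w ∈ Z ∷ N ++ Y ∷ [] → ¬ u ∼ w
        ¬inner u∈ (here refl) e with Z∈
        ... | inj₁ refl = ¬z B (there u∈) e
        ... | inj₂ i = free (inj₁ (_ , u∈ , e)) i
        ¬inner u∈ (there j) e with ∈-++⁻ E (span-∈ j)
        ... | inj₁ i = free (inj₁ (_ , u∈ , e)) (E⊆ i)
        ... | inj₂ (here refl) = ¬y B (∈-++⁺ˡ u∈) e

        ¬pZ : ¬ p ∼ Z
        ¬pZ e with Z∈
        ... | inj₁ refl = ¬z B (here refl) e
        ... | inj₂ i = free (inj₂ (e , qZ)) i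

        ¬qY : ∀ {w} → w ∈ N ++ Y ∷ [] → ¬ q ∼ w
        ¬qY j e with ∈-++⁻ E (span-∈ j)
        ... | inj₁ i = nE i e
        ... | inj₂ (here refl) = ¬y B (∈-++⁺ʳ I (here refl)) e

        cross : ∀ {u w} → u ∈ p ∷ I ++ q ∷ [] → w ∈ Z ∷ N ++ Y ∷ [] → u ∼ w → (u ≡ p × w ≡ Y) ⊎ (u ≡ q × w ≡ Z)
        cross (here refl) (here refl) e = ⊥-elim (¬pZ e)
        cross (here refl) (there j) e with ∈-++⁻ N j
        ... | inj₁ i = ⊥-elim (nN i e)
        ... | inj₂ (here refl) = inj₁ (refl , refl)
        cross (there u∈) w∈ e with ∈-++⁻ I u∈
        ... | inj₁ i = ⊥-elim (¬inner i w∈ e)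
        ... | inj₂ (here refl) with w∈
        ... | here refl = inj₂ (refl , refl)
        ... | there j = ⊥-elim (¬qY j e)

        distinct : ∀ {u w} → u ∈ p ∷ I ++ q ∷ [] → w ∈ C → u ≢ w
        distinct u∈ w∈ refl = proj₁ (out u∈) w∈

        ring : Cyc ((Z ∷ N ++ Y ∷ []) ++ p ∷ I ++ q ∷ [])
        ring = arc-ring N I arc-path path (∼-sym pY) qZ (λ i j → distinct i (arc-∈C j)) cross

        nP : NoN x (p ∷ I ++ q ∷ [])
        nP i = proj₂ (proj₂ (out i))

        x∉ring : x ∉ (Z ∷ N ++ Y ∷ []) ++ p ∷ I ++ q ∷ []
        x∉ring i with ∈-++⁻ (Z ∷ N ++ Y ∷ []) i
        ... | inj₁ j = x∉C (arc-∈C j)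
        ... | inj₂ j = proj₁ (proj₂ (out j)) refl

        ring-cnt : cnt x ((Z ∷ N ++ Y ∷ []) ++ p ∷ I ++ q ∷ []) ≡ cnt x (Z ∷ N ++ Y ∷ [])
        ring-cnt = trans (cnt-++ x (Z ∷ N ++ Y ∷ [])) (trans (cong (cnt x (Z ∷ N ++ Y ∷ []) +_) (cnt-none (p ∷ I ++ q ∷ []) nP)) (+-identityʳ _))

        thin : Thin (p ∷ I ++ q ∷ [])
        thin a L b e = subst (_≤ 1) (sym (cnt-none L (λ i → nP (∈-cast (sym e) (there (∈-++⁺ˡ i)))))) z≤n

        -- The ring closed by the walk gains no spoke from it and misses the spoke `s` of `M`; with
        -- three spokes it would fall under `no-thin-ring`.
        span≤2 : cnt x (Z ∷ N ++ Y ∷ []) ≤ 2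
        span≤2 with cnt x (Z ∷ N ++ Y ∷ []) ≤? 2
        ... | yes b = b
        ... | no ¬b = ⊥-elim (no-thin-ring (Z ∷ N ++ Y ∷ []) (p ∷ I ++ q ∷ []) (F ++ M ++ D) span-rot ring x∉ring thin
              (subst (3 ≤_) (sym ring-cnt) (≰⇒> ¬b))
              (subst₂ _<_ (sym ring-cnt) (sym span-cnt) (m<m+n _ (≤-trans (≤-trans (has-spoke M s∈ xs) (m≤m+n _ _)) (m≤n+m _ (cnt x F))))))

-- Closing the walk along both arcs of `C`.

module Sectors (G : Graph) (isk : ISK4-free G) (dia : Diamond-free G) (bow : Bowtie-free G) (prf : Prism-free G)
  {x : V G} {C : List (V G)} (rim : Rim G x C) where
  open Paths G
  open Hub G
  open Prisms G
  open Local G isk dia bow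
  open Trails G
  open Rim rim
  open Walks G isk dia bow rim

  snoc-split : ∀ E {y : V G} N {Y F} → E ++ y ∷ [] ≡ N ++ Y ∷ F →
    (F ≡ [] × E ≡ N × y ≡ Y) ⊎ ∃[ F′ ] (F ≡ F′ ++ y ∷ [] × E ≡ N ++ Y ∷ F′)
  snoc-split E N {Y} {[]} e = inj₁ (refl , ∷ʳ-injectiveˡ E N e , ∷ʳ-injectiveʳ E N e)
  snoc-split E N {Y} {f ∷ F} e with snoc-view f F
  ... | F′ , l , e′ with ∷ʳ-injectiveʳ E (N ++ Y ∷ F′) (trans e (trans (cong (λ t → N ++ Y ∷ t) e′) (sym (++-assoc N (Y ∷ F′) (l ∷ [])))))
                       | ∷ʳ-injectiveˡ E (N ++ Y ∷ F′) (trans e (trans (cong (λ t → N ++ Y ∷ t) e′) (sym (++-assoc N (Y ∷ F′) (l ∷ [])))))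
  ... | refl | eE = inj₂ (F′ , e′ , eE)

  -- The only spoke of `M` would be `t`, the span on the other side has at most two, and the
  -- remaining pieces `D` and `F` have none: three spokes in all.
  no-inner : ∀ {p I q y M z M′} → Bad p I q y M z M′ → ∀ {t} → Inner p I q t → t ∈ M → ⊥
  no-inner {p} {I} {q} {y} {M} {z} {M′} B {t} i t∈ with ∈-∃++ t∈
  ... | M₁ , M₂ , refl with inner-alone B i M₁ M₂ refl
  ... | n₁ , n₂ , xt = <⇒≱ four (subst (_≤ 3) (sym (span-cnt B S))
        (+-mono-≤ (span≤2 B S (λ i′ j → inner-once B i t∈ i′ j))
          (≤-reflexive (cong₂ _+_ (cnt-none F nF) (cong₂ _+_ cM (cnt-none D nD))))))
    where
    open Bad B
    S = span B
    open Span S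
    cM : cnt x M ≡ 1
    cM = trans (cnt-skip M₁ n₁) (trans (cnt-yes M₂ xt) (cong suc (cnt-none M₂ n₂)))
    q∈ : q ∈ I ++ q ∷ []
    q∈ = ∈-++⁺ʳ I (here refl)
    three : ∀ a b c → cnt x (a ∷ []) + (cnt x (b ∷ []) + cnt x (c ∷ [])) ≤ 3
    three a b c = +-mono-≤ (cnt-∷≤ x a []) (+-mono-≤ (cnt-∷≤ x b []) (cnt-∷≤ x c []))
    nD : NoN x D
    nD with D in eqD | eD
    ... | [] | _ = λ ()
    ... | d ∷ D′ | e = NoN-∷ (subst (λ w → ¬ x ∼ w) (∷-injectiveˡ e) ¬xz) nD′
      where
      rz : Rot C (z ∷ D′ ++ Z ∷ E ++ y ∷ M₁ ++ t ∷ M₂)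
      rz = rot-trans rot (subst₂ Rot
        (cong (λ l → y ∷ (M₁ ++ t ∷ M₂) ++ z ∷ l) (sym (∷-injectiveʳ e)))
        (flat ((z ◂ ⟨ D′ ⟩ ⊹ Z ◂ ⟨ E ⟩) ⊹ y ◂ ⟨ M₁ ⟩ ⊹ t ◂ ⟨ M₂ ⟩)) (rot-swap (y ∷ M₁ ++ t ∷ M₂)))
      nD′ : NoN x D′
      nD′ with ssʳ q∈ q∈ qz qZ rz
      ... | inj₁ f = f
      ... | inj₂ f = ⊥-elim (f (∈-++⁺ʳ E (there t∈)) xt)
      rt : Rot C (t ∷ (M₂ ++ z ∷ D′) ++ Z ∷ E ++ y ∷ M₁)
      rt = subst (Rot C) (same (t ◂ ⟨ M₂ ⟩ ⊹ z ◂ ⟨ D′ ⟩ ⊹ Z ◂ ⟨ E ⟩ ⊹ y ◂ ⟨ M₁ ⟩) (t ◂ (⟨ M₂ ⟩ ⊹ z ◂ ⟨ D′ ⟩) ⊹ Z ◂ ⟨ E ⟩ ⊹ y ◂ ⟨ M₁ ⟩) refl)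
        (rot-trans rz (rot-turn (z ◂ ⟨ D′ ⟩ ⊹ Z ◂ ⟨ E ⟩ ⊹ y ◂ ⟨ M₁ ⟩) (t ◂ ⟨ M₂ ⟩)))
      ¬xz : ¬ x ∼ z
      -- `t` and `Z` share a sector. If it is not the arc through `z` that is spokeless, all spokes
      -- are among `t`, `z` and `Z`.
      ¬xz with proj₂ (ss-q B i qZ) rt
      ... | inj₁ f = f (∈-++⁺ʳ M₂ (here refl))
      ... | inj₂ f = ⊥-elim (<⇒≱ four (subst (_≤ 3) (sym eq) (three t z Z)))
        where
        eq : cnt x C ≡ cnt x (t ∷ []) + (cnt x (z ∷ []) + cnt x (Z ∷ []))
        eq = trans (cnt-rot x rt) (trans (cnt-∷ x t ((M₂ ++ z ∷ D′) ++ Z ∷ E ++ y ∷ M₁)) (cong (cnt x (t ∷ []) +_)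
          (trans (cong (cnt x) (flat ((⟨ M₂ ⟩ ⊹ z ◂ ⟨ D′ ⟩) ⊹ Z ◂ ⟨ E ++ y ∷ M₁ ⟩))) (trans (cnt-skip M₂ n₂)
          (trans (cnt-∷ x z (D′ ++ Z ∷ E ++ y ∷ M₁)) (cong (cnt x (z ∷ []) +_) (trans (cnt-skip D′ nD′)
          (trans (cnt-∷ x Z (E ++ y ∷ M₁)) (trans (cong (cnt x (Z ∷ []) +_) (cnt-none (E ++ y ∷ M₁) f)) (+-identityʳ _))))))))))
    nF : NoN x F
    nF with snoc-split E N eE
    ... | inj₁ (eF , _) = subst (NoN x) (sym eF) NoN-[]
    ... | inj₂ (F′ , eF , eE′) = subst (NoN x) (sym eF) (NoN-++ F′ nF′ (NoN-∷ ¬xy λ ()))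
      where
      rY : Rot C (Y ∷ F′ ++ y ∷ (M₁ ++ t ∷ M₂) ++ D ++ Z ∷ N)
      rY = rot-trans rot (subst₂ Rot
        (trans (same ((y ◂ ⟨ M₁ ++ t ∷ M₂ ⟩ ⊹ ⟨ D ⟩ ⊹ Z ◂ ⟨ N ⟩) ⊹ Y ◂ ⟨ F′ ⟩) (y ◂ ⟨ M₁ ++ t ∷ M₂ ⟩ ⊹ ⟨ D ⟩ ⊹ Z ◂ ⟨ N ⟩ ⊹ Y ◂ ⟨ F′ ⟩) refl)
          (cong (λ l → y ∷ (M₁ ++ t ∷ M₂) ++ l) (trans (cong (λ l → D ++ Z ∷ l) (sym eE′)) (sym eD))))
        (flat ((Y ◂ ⟨ F′ ⟩) ⊹ y ◂ ⟨ M₁ ++ t ∷ M₂ ⟩ ⊹ ⟨ D ⟩ ⊹ Z ◂ ⟨ N ⟩)) (rot-swap (y ∷ (M₁ ++ t ∷ M₂) ++ D ++ Z ∷ N)))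
      nF′ : NoN x F′
      nF′ with ssˡ (here refl) (here refl) pY py rY
      ... | inj₁ f = f
      ... | inj₂ f = ⊥-elim (f (∈-++⁺ˡ t∈) xt)
      rt : Rot C (Y ∷ (F′ ++ y ∷ M₁) ++ t ∷ M₂ ++ D ++ Z ∷ N)
      rt = subst (Rot C) (same (Y ◂ ⟨ F′ ⟩ ⊹ y ◂ (⟨ M₁ ⟩ ⊹ t ◂ ⟨ M₂ ⟩) ⊹ ⟨ D ⟩ ⊹ Z ◂ ⟨ N ⟩) (Y ◂ (⟨ F′ ⟩ ⊹ y ◂ ⟨ M₁ ⟩) ⊹ t ◂ ⟨ M₂ ⟩ ⊹ ⟨ D ⟩ ⊹ Z ◂ ⟨ N ⟩) refl) rY
      ¬xy : ¬ x ∼ y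
      ¬xy with proj₁ (ss-p B i pY) rt
      ... | inj₁ f = f (∈-++⁺ʳ F′ (here refl))
      ... | inj₂ f = ⊥-elim (<⇒≱ four (subst (_≤ 3) (sym eq) (three Y y t)))
        where
        eq : cnt x C ≡ cnt x (Y ∷ []) + (cnt x (y ∷ []) + cnt x (t ∷ []))
        eq = trans (cnt-rot x rt) (trans (cnt-∷ x Y ((F′ ++ y ∷ M₁) ++ t ∷ M₂ ++ D ++ Z ∷ N)) (cong (cnt x (Y ∷ []) +_)
          (trans (cong (cnt x) (flat ((⟨ F′ ⟩ ⊹ y ◂ ⟨ M₁ ⟩) ⊹ t ◂ ⟨ M₂ ++ D ++ Z ∷ N ⟩))) (trans (cnt-skip F′ nF′)
          (trans (cnt-∷ x y (M₁ ++ t ∷ M₂ ++ D ++ Z ∷ N)) (cong (cnt x (y ∷ []) +_) (trans (cnt-skip M₁ n₁)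
          (trans (cnt-∷ x t (M₂ ++ D ++ Z ∷ N)) (trans (cong (cnt x (t ∷ []) +_) (cnt-none (M₂ ++ D ++ Z ∷ N) f)) (+-identityʳ _))))))))))

  -- The stretch of `C` at one end of the walk, between the neighbours of that end at which the two
  -- spans stop.
  data Joint (Y₁ Y₂ : V G) : List (V G) → Set where
    shared : Y₁ ≡ Y₂ → Joint Y₁ Y₂ (Y₁ ∷ [])
    apart  : ∀ J → NoN x J → Joint Y₁ Y₂ (Y₁ ∷ J ++ Y₂ ∷ [])

  -- One of the spans stops at `y` itself, since otherwise `p` would have three neighbours on `C`,
  -- too many for a vertex that `x` does not see. Both stops being neighbours of `p`, they share a
  -- sector.
  joint : ∀ {p I q y M z M′} → Bad p I q y M z M′ → (S : Span p q y z M′) (T : Span q p z y M) →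
    ∃[ yB ] (Joint (Span.Y S) (Span.Z T) yB × Span.E S ++ y ∷ M ≡ Span.N S ++ yB ++ Span.E T)
  joint {p} {I} {q} {y} {M} {z} {M′} B S T with snoc-split S.E S.N S.eE | T.D in eqD | T.eD
    where
    module S = Span S
    module T = Span T
  ... | inj₁ (_ , eN , refl) | [] | e = y ∷ [] , shared (∷-injectiveˡ e) , cong₂ (λ k l → k ++ y ∷ l) eN (∷-injectiveʳ e)
  ... | inj₁ (_ , eN , refl) | d ∷ D′ | e = y ∷ D′ ++ Span.Z T ∷ [] , apart D′ nJ ,
        trans (cong₂ (λ k l → k ++ y ∷ l) eN (∷-injectiveʳ e)) (same (⟨ Span.N S ⟩ ⊹ y ◂ ⟨ D′ ⟩ ⊹ Span.Z T ◂ ⟨ Span.E T ⟩)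
          (⟨ Span.N S ⟩ ⊹ (y ◂ ⟨ D′ ⟩ ⊹ Span.Z T ◂ ⟨ [] ⟩) ⊹ ⟨ Span.E T ⟩) refl)
    where
    open Bad B
    nJ : NoN x D′
    nJ with ssˡ (here refl) (here refl) py (Span.qZ T) (subst (λ l → Rot C (y ∷ l)) (trans (cong (_++ z ∷ M′) (∷-injectiveʳ e)) (++-assoc D′ _ _)) rot)
    ... | inj₁ f = f
    ... | inj₂ f = ⊥-elim (f (∈-++⁺ʳ (Span.E T) (there s′∈)) xs′)
  ... | inj₂ (F′ , _ , eE) | [] | e = Span.Y S ∷ F′ ++ y ∷ [] , subst (λ w → Joint (Span.Y S) w (Span.Y S ∷ F′ ++ y ∷ [])) (∷-injectiveˡ e) (apart F′ nJ) ,
        trans (cong₂ (λ k l → k ++ y ∷ l) eE (∷-injectiveʳ e)) (same ((⟨ Span.N S ⟩ ⊹ Span.Y S ◂ ⟨ F′ ⟩) ⊹ y ◂ ⟨ Span.E T ⟩)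
          (⟨ Span.N S ⟩ ⊹ (Span.Y S ◂ ⟨ F′ ⟩ ⊹ y ◂ ⟨ [] ⟩) ⊹ ⟨ Span.E T ⟩) refl)
    where
    open Bad B
    r : Rot C (Span.Y S ∷ F′ ++ y ∷ M ++ Span.D S ++ Span.Z S ∷ Span.N S)
    r = rot-trans rot (subst₂ Rot
        (trans (same ((y ◂ ⟨ M ⟩ ⊹ ⟨ Span.D S ⟩ ⊹ Span.Z S ◂ ⟨ Span.N S ⟩) ⊹ Span.Y S ◂ ⟨ F′ ⟩) (y ◂ ⟨ M ⟩ ⊹ ⟨ Span.D S ⟩ ⊹ Span.Z S ◂ ⟨ Span.N S ⟩ ⊹ Span.Y S ◂ ⟨ F′ ⟩) refl)
          (cong (λ l → y ∷ M ++ l) (trans (cong (λ l → Span.D S ++ Span.Z S ∷ l) (sym eE)) (sym (Span.eD S)))))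
        refl (rot-swap (y ∷ M ++ Span.D S ++ Span.Z S ∷ Span.N S)))
    nJ : NoN x F′
    nJ with ssˡ (here refl) (here refl) (Span.pY S) py r
    ... | inj₁ f = f
    ... | inj₂ f = ⊥-elim (f (∈-++⁺ˡ s∈) xs)
  ... | inj₂ (F′ , _ , eE) | d ∷ D′ | e = ⊥-elim (<⇒≱ (s≤s (s≤s (s≤s z≤n))) (≤-trans many (few (proj₁ (out (here refl))) (proj₁ (proj₂ (out (here refl)))) (proj₂ (proj₂ (out (here refl)))))))
    where
    open Bad B
    A₁ = Span.D S ++ Span.Z S ∷ Span.N S
    r : Rot C (Span.Y S ∷ F′ ++ y ∷ D′ ++ Span.Z T ∷ Span.E T ++ A₁)
    r = rot-trans rot (subst₂ Rot
        (trans (same ((y ◂ ⟨ M ⟩ ⊹ ⟨ Span.D S ⟩ ⊹ Span.Z S ◂ ⟨ Span.N S ⟩) ⊹ Span.Y S ◂ ⟨ F′ ⟩) (y ◂ ⟨ M ⟩ ⊹ ⟨ Span.D S ⟩ ⊹ Span.Z S ◂ ⟨ Span.N S ⟩ ⊹ Span.Y S ◂ ⟨ F′ ⟩) refl)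
          (cong (λ l → y ∷ M ++ l) (trans (cong (λ l → Span.D S ++ Span.Z S ∷ l) (sym eE)) (sym (Span.eD S)))))
        (trans (cong (λ l → Span.Y S ∷ F′ ++ y ∷ l ++ A₁) (∷-injectiveʳ e)) (flat (Span.Y S ◂ ⟨ F′ ⟩ ⊹ y ◂ (⟨ D′ ⟩ ⊹ Span.Z T ◂ ⟨ Span.E T ⟩) ⊹ ⟨ A₁ ⟩)))
        (rot-swap (y ∷ M ++ A₁)))
    skip : ∀ {n} A {w} R → n ≤ cnt p R → p ∼ w → suc n ≤ cnt p (A ++ w ∷ R)
    skip A R b pw = subst (_ ≤_) (sym (trans (cnt-++ p A) (cong (cnt p A +_) (cnt-yes R pw)))) (≤-trans (s≤s b) (m≤n+m _ (cnt p A)))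
    many : 3 ≤ cnt p C
    many = subst (3 ≤_) (sym (cnt-rot p r)) (skip [] (F′ ++ y ∷ D′ ++ Span.Z T ∷ Span.E T ++ A₁) (skip F′ (D′ ++ Span.Z T ∷ Span.E T ++ A₁) (skip D′ (Span.E T ++ A₁) z≤n (Span.qZ T)) py) (Span.pY S))

  sum₄ : ∀ {a b} → 4 ≤ a + b → a ≤ 2 → b ≤ 2 → a ≡ 2 × b ≡ 2
  sum₄ {a} {b} l p q = ≤-antisym p (+-cancelʳ-≤ 2 2 a (≤-trans l (+-monoʳ-≤ a q))) ,
                       ≤-antisym q (+-cancelˡ-≤ 2 2 b (≤-trans l (+-monoˡ-≤ b p)))

  joint-split : ∀ {Y₁ Y₂ yB} → Joint Y₁ Y₂ yB → ∃[ J ] (yB ≡ J ++ Y₂ ∷ [] × cnt x J ≤ cnt x (Y₁ ∷ []))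
  joint-split (shared refl) = [] , refl , z≤n
  joint-split {Y₁} (apart J nJ) = Y₁ ∷ J , refl , ≤-reflexive (trans (cnt-∷ x Y₁ J) (trans (cong (cnt x (Y₁ ∷ []) +_) (cnt-none J nJ)) (+-identityʳ _)))

  some-∈ : ∀ l → 1 ≤ cnt x l → ∃[ w ] w ∈ l
  some-∈ (w ∷ l) _ = w , here refl

  prefix-of : ∀ L₁ {Z : V G} {N s F} → Z ∷ N ≡ L₁ ++ s ∷ F → ∃[ L ] (L₁ ++ s ∷ [] ≡ Z ∷ L × (∀ {w} → w ∈ L → w ∈ N))
  prefix-of [] refl = [] , refl , λ ()
  prefix-of (_ ∷ L′) {s = s} {F} refl = L′ ++ s ∷ [] , refl , λ i → ∈-cast (++-assoc L′ (s ∷ []) F) (∈-++⁺ˡ i)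

  module Tight {p I q y M z M′} (B : Bad p I q y M z M′)
    (free : ∀ {t} → Inner p I q t → t ∈ M ⊎ t ∈ M′ → ⊥)
    (S : Span p q y z M′) (T : Span q p z y M) where
    open Bad B
    module S = Span S
    module T = Span T

    freeS : ∀ {t} → Inner p I q t → t ∈ M′ → ⊥
    freeS i j = free i (inj₂ j)

    freeT : ∀ {t} → Inner q (reverse I) p t → t ∈ M → ⊥
    freeT (inj₁ (u , u∈ , e)) j = free (inj₁ (u , ∈-rev u∈ , e)) (inj₁ j)
    freeT (inj₂ (a , b)) j = free (inj₂ (b , a)) (inj₁ j)

    P∈ : ∀ {u} → u ∈ q ∷ reverse I ++ p ∷ [] → u ∈ p ∷ I ++ q ∷ []
    P∈ i = ∈-rev (∈-cast (sym (rev-ends p I q)) i)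

    arcS arcT : List (V G)
    arcS = S.Z ∷ S.N ++ S.Y ∷ []
    arcT = T.Z ∷ T.N ++ T.Y ∷ []

    K : Cyc (arcT ++ q ∷ reverse I ++ p ∷ [])
    K = ring (flip B) T freeT

    N≢Y : ∀ {w} → w ∈ S.Z ∷ S.N → w ≢ S.Y
    N≢Y i refl = ip-disjoint (S.Z ∷ S.N) (arc-path B S) i (here refl)

    N≢Z : ∀ {w} → w ∈ S.N → w ≢ S.Z
    N≢Z i refl = ip-fresh (arc-path B S) (∈-++⁺ˡ i)

    N-off : ∀ {w u} → w ∈ S.N → u ∈ p ∷ I ++ q ∷ [] → w # u
    N-off w∈ u∈ = (λ e → distinct B S freeS u∈ (arc-∈C B S (there (∈-++⁺ˡ w∈))) (sym e)) ,
      λ e → case cross B S freeS u∈ (there (∈-++⁺ˡ w∈)) (∼-sym e) of λ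
        { (inj₁ (_ , r)) → N≢Y (there w∈) r ; (inj₂ (_ , r)) → N≢Z w∈ r }

    Z-off : ∀ {u} → u ∈ p ∷ I → S.Z # u
    Z-off u∈ = (λ e → distinct B S freeS (∈-++⁺ˡ u∈) (arc-∈C B S (here refl)) (sym e)) ,
      λ e → case cross B S freeS (∈-++⁺ˡ u∈) (here refl) (∼-sym e) of λ
        { (inj₁ (_ , r)) → N≢Y (here refl) r ; (inj₂ (r , _)) → ip-disjoint (p ∷ I) path u∈ (here r) }

    module _ {yB zB} (r : Rot C (S.N ++ yB ++ T.N ++ zB)) (jy : Joint S.Y T.Z yB) where

      private
        J = proj₁ (joint-split jy)
        eJ = proj₁ (proj₂ (joint-split jy))
        cJ = proj₂ (proj₂ (joint-split jy))

        cntT : cnt x arcT ≡ cnt x (T.Z ∷ []) + (cnt x T.N + cnt x (T.Y ∷ []))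
        cntT = trans (cnt-∷ x T.Z (T.N ++ T.Y ∷ [])) (cong (cnt x (T.Z ∷ []) +_) (cnt-++ x T.N))

        cntS : cnt x arcS ≡ cnt x (S.Z ∷ []) + (cnt x S.N + cnt x (S.Y ∷ []))
        cntS = trans (cnt-∷ x S.Z (S.N ++ S.Y ∷ [])) (cong (cnt x (S.Z ∷ []) +_) (cnt-++ x S.N))

        r′ : Rot C (T.Z ∷ T.N ++ zB ++ S.N ++ J)
        r′ = rot-trans r (subst₂ Rot (trans (same ((⟨ S.N ⟩ ⊹ ⟨ J ⟩) ⊹ T.Z ◂ ⟨ T.N ⟩ ⊹ ⟨ zB ⟩) (⟨ S.N ⟩ ⊹ (⟨ J ⟩ ⊹ T.Z ◂ ⟨ [] ⟩) ⊹ ⟨ T.N ⟩ ⊹ ⟨ zB ⟩) refl)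
            (cong (λ l → S.N ++ l ++ T.N ++ zB) (sym eJ)))
          (flat ((T.Z ◂ ⟨ T.N ⟩ ⊹ ⟨ zB ⟩) ⊹ ⟨ S.N ⟩ ⊹ ⟨ J ⟩)) (rot-swap (S.N ++ J)))

        total : cnt x C ≡ cnt x (T.Z ∷ []) + (cnt x T.N + (cnt x zB + (cnt x S.N + cnt x J)))
        total = trans (cnt-rot x r′) (trans (cnt-∷ x T.Z (T.N ++ zB ++ S.N ++ J)) (cong (cnt x (T.Z ∷ []) +_)
          (trans (cnt-++ x T.N) (cong (cnt x T.N +_) (trans (cnt-++ x zB) (cong (cnt x zB +_) (cnt-++ x S.N)))))))

        x∉K : x ∉ arcT ++ q ∷ reverse I ++ p ∷ []
        x∉K = x∉ring (flip B) T freeT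

        nP′ : NoN x (q ∷ reverse I ++ p ∷ [])
        nP′ i = nP B S freeS (P∈ i)

        ≤S : cnt x arcS ≤ 2
        ≤S = span≤2 B S freeS

        ≤T : cnt x arcT ≤ 2
        ≤T = span≤2 (flip B) T freeT

      private
        shared-counts : zB ≡ T.Y ∷ [] → cnt x S.N + cnt x (S.Y ∷ []) ≡ 2 × cnt x arcT ≡ 2
        shared-counts refl = sum₄ 4≤sum (≤-trans (m≤n+m _ (cnt x (S.Z ∷ []))) (subst (_≤ 2) cntS ≤S)) ≤T
          where
          4≤sum : 4 ≤ (cnt x S.N + cnt x (S.Y ∷ [])) + cnt x arcT
          4≤sum = ≤-trans four (≤-trans (≤-reflexive total) (≤-trans
            (+-monoʳ-≤ (cnt x (T.Z ∷ [])) (+-monoʳ-≤ (cnt x T.N) (+-monoʳ-≤ (cnt x (T.Y ∷ [])) (+-monoʳ-≤ (cnt x S.N) cJ))))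
            (≤-reflexive (trans (shuffle (cnt x (T.Z ∷ [])) (cnt x T.N) (cnt x (T.Y ∷ [])) (cnt x S.N + cnt x (S.Y ∷ []))) (cong (cnt x S.N + cnt x (S.Y ∷ []) +_) (sym cntT))))))
            where
            shuffle : ∀ a b c d → a + (b + (c + d)) ≡ d + (a + (b + c))
            shuffle = solve-∀

        apart-counts : ∀ H → NoN x H → zB ≡ T.Y ∷ H ++ S.Z ∷ [] → cnt x arcS ≡ 2 × cnt x arcT ≡ 2
        apart-counts H nH refl = sum₄ 4≤sum ≤S ≤T
          where
          4≤sum : 4 ≤ cnt x arcS + cnt x arcT
          4≤sum = ≤-trans four (≤-trans (≤-reflexive total) (≤-trans
            (+-monoʳ-≤ (cnt x (T.Z ∷ [])) (+-monoʳ-≤ (cnt x T.N) (+-mono-≤ (≤-reflexive (trans (cnt-∷ x T.Y (H ++ S.Z ∷ [])) (cong (cnt x (T.Y ∷ []) +_) (cnt-skip H nH)))) (+-monoʳ-≤ (cnt x S.N) cJ))))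
            (≤-reflexive (trans (shuffle (cnt x (T.Z ∷ [])) (cnt x T.N) (cnt x (T.Y ∷ [])) (cnt x (S.Z ∷ [])) (cnt x S.N + cnt x (S.Y ∷ []))) (cong₂ _+_ (sym cntS) (sym cntT))))))
            where
            shuffle : ∀ a b c e d → a + (b + ((c + e) + d)) ≡ (e + d) + (a + (b + c))
            shuffle = solve-∀

      -- If both spans stop at the same neighbour of `q`, the counts are tight: two spokes on
      -- `arcT`, two on `S.N S.Y`, hence none at that neighbour. It becomes `e₀` on the ring of `T`,
      -- with a leg from the first spoke of `S.N`.
      not-shared : zB ≡ T.Y ∷ [] → T.Y ≡ S.Z → ⊥
      not-shared refl Z≡ with first-of x (S.N ++ S.Y ∷ []) (trans (cnt-++ x S.N) (proj₁ (shared-counts refl)))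
      ... | L₁ , s₁ , L₂ , eL , nL , xs₁ , one with snoc-split S.N L₁ eL
      ... | inj₁ (refl , _) = case one of λ ()
      ... | inj₂ (F , _ , eN) = hub isk {x} {T.Y} {(q ∷ reverse I ++ p ∷ []) ++ T.Z ∷ T.N} (s₁ ∷ reverse L₁) ringZ
          (λ i → x∉K (rot-∈⁻ rK (there i))) two
          (leg L₁ (ip-++ʳ (T.Z ∷ T.N) arc) xs₁ (λ i → x∉C (rot-∈⁻ r″ (∈-cast (flat ((T.Z ◂ ⟨ T.N ⟩ ⊹ T.Y ◂ ⟨ L₁ ⟩ ⊹ s₁ ◂ ⟨ [] ⟩) ⊹ ⟨ F ⟩ ⊹ ⟨ J ⟩)) (∈-++⁺ˡ (∈-++⁺ʳ (T.Z ∷ T.N) i))))) (NoN-∷ ¬xZ nL))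
          (λ l∈ → Off-++ (q ∷ reverse I ++ p ∷ []) (λ u∈ → N-off (L⊆ (∈-leg L₁ l∈)) (P∈ u∈))
            (λ w∈ → #-sym (ip-cross (T.Z ∷ T.N) arc w∈ (∈-leg L₁ l∈))))
        where
        both = shared-counts refl
        ¬xZ : ¬ x ∼ T.Y
        ¬xZ e = <⇒≱ (≤-reflexive (sym (trans cntS (cong₂ _+_ (cnt-1 (subst (x ∼_) Z≡ e)) (proj₁ both))))) ≤S
        L⊆ : ∀ {w} → w ∈ L₁ ++ s₁ ∷ [] → w ∈ S.N
        L⊆ i = ∈-cast (sym eN) (∈-cast (++-assoc L₁ (s₁ ∷ []) F) (∈-++⁺ˡ i))
        r″ : Rot C (T.Z ∷ T.N ++ T.Y ∷ L₁ ++ s₁ ∷ F ++ J)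
        r″ = subst (Rot C) (trans (cong (λ l → T.Z ∷ T.N ++ T.Y ∷ l ++ J) eN) (flat (T.Z ◂ ⟨ T.N ⟩ ⊹ T.Y ◂ (⟨ L₁ ⟩ ⊹ s₁ ◂ ⟨ F ⟩) ⊹ ⟨ J ⟩))) r′
        rest : 1 ≤ cnt x (F ++ J)
        rest = +-cancelˡ-≤ 3 1 _ (subst (4 ≤_) (trans (cnt-rot x r″) (trans (cong (cnt x) (sym (flat ((T.Z ◂ ⟨ T.N ⟩ ⊹ T.Y ◂ ⟨ [] ⟩) ⊹ ⟨ L₁ ++ s₁ ∷ F ++ J ⟩))))
          (trans (cnt-++ x arcT) (cong₂ _+_ (proj₂ both) (trans (cnt-skip L₁ nL) (cnt-yes (F ++ J) xs₁)))))) four)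
        arc : IPath ((T.Z ∷ T.N) ++ T.Y ∷ L₁ ++ s₁ ∷ [])
        arc = cyc-arc (T.Z ∷ T.N ++ T.Y ∷ L₁ ++ s₁ ∷ []) (proj₂ (some-∈ (F ++ J) rest))
          (subst Cyc (sym (flat ((T.Z ◂ ⟨ T.N ⟩ ⊹ T.Y ◂ ⟨ L₁ ⟩ ⊹ s₁ ◂ ⟨ [] ⟩) ⊹ ⟨ F ⟩ ⊹ ⟨ J ⟩))) (rot-cyc r″ ringC))
        rK : Rot (arcT ++ q ∷ reverse I ++ p ∷ []) (T.Y ∷ (q ∷ reverse I ++ p ∷ []) ++ T.Z ∷ T.N)
        rK = subst (λ l → Rot l (T.Y ∷ (q ∷ reverse I ++ p ∷ []) ++ T.Z ∷ T.N)) (sym (++-assoc (T.Z ∷ T.N) (T.Y ∷ []) (q ∷ reverse I ++ p ∷ [])))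
          (rot-swap (T.Z ∷ T.N))
        ringZ : Cyc (T.Y ∷ (q ∷ reverse I ++ p ∷ []) ++ T.Z ∷ T.N)
        ringZ = rot-cyc rK K
        two : cnt x ((q ∷ reverse I ++ p ∷ []) ++ T.Z ∷ T.N) ≡ 2
        two = trans (cnt-skip (q ∷ reverse I ++ p ∷ []) nP′) (trans (sym (+-identityʳ _)) (trans (cong (cnt x (T.Z ∷ T.N) +_) (sym (cnt-0 ¬xZ)))
          (trans (sym (cnt-++ x (T.Z ∷ T.N))) (proj₂ both))))

      -- A vertex `c` between `T.Y` and `S.Z` would separate the ring of `T` from a leg that runs
      -- from the first spoke of the other span back to `S.Z` and on to `q`, which serves as `e₀`.
      adjacent : ∀ H → NoN x H → zB ≡ T.Y ∷ H ++ S.Z ∷ [] → H ≡ []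
      adjacent [] nH eq = refl
      adjacent (c ∷ H) nH refl with first-of x arcS (proj₁ (apart-counts (c ∷ H) nH refl))
      ... | L₁ , s₁ , L₂ , eL , nL , xs₁ , one with snoc-split (S.Z ∷ S.N) L₁ eL
      ... | inj₁ (refl , _) = case one of λ ()
      ... | inj₂ (F , _ , eN) = ⊥-elim (hub isk {x} {q} {(reverse I ++ p ∷ []) ++ arcT} (s₁ ∷ reverse L₁) (rot-cyc rK K)
          (λ i → x∉K (rot-∈⁻ rK (there i))) two
          (leg L₁ legq xs₁ (λ { (here refl) → x∉K (∈-++⁺ʳ arcT (here refl)) ; (there i) → x∉C (in-C i) }) (NoN-∷ (nP′ (here refl)) nL))
          (λ l∈ → Off-++ (reverse I ++ p ∷ []) (λ u∈ → off (∈-leg L₁ l∈) u∈)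
            (λ w∈ → #-sym (ip-cross arcT arc w∈ (∈-++⁺ʳ H (∈-leg L₁ l∈))))))
        where
        both = apart-counts (c ∷ H) nH refl
        r″ : Rot C (T.Z ∷ T.N ++ T.Y ∷ c ∷ H ++ L₁ ++ s₁ ∷ F ++ J)
        r″ = subst (Rot C) (trans (same (T.Z ◂ ⟨ T.N ⟩ ⊹ (T.Y ◂ c ◂ ⟨ H ⟩ ⊹ S.Z ◂ ⟨ [] ⟩) ⊹ ⟨ S.N ⟩ ⊹ ⟨ J ⟩) (T.Z ◂ ⟨ T.N ⟩ ⊹ T.Y ◂ c ◂ ⟨ H ⟩ ⊹ (S.Z ◂ ⟨ S.N ⟩) ⊹ ⟨ J ⟩) refl)
          (trans (cong (λ l → T.Z ∷ T.N ++ T.Y ∷ c ∷ H ++ l ++ J) eN) (flat (T.Z ◂ ⟨ T.N ⟩ ⊹ T.Y ◂ c ◂ ⟨ H ⟩ ⊹ (⟨ L₁ ⟩ ⊹ s₁ ◂ ⟨ F ⟩) ⊹ ⟨ J ⟩)))) r′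
        flat-r : (arcT ++ c ∷ H ++ L₁ ++ s₁ ∷ []) ++ F ++ J ≡ T.Z ∷ T.N ++ T.Y ∷ c ∷ H ++ L₁ ++ s₁ ∷ F ++ J
        flat-r = flat (((T.Z ◂ ⟨ T.N ⟩ ⊹ T.Y ◂ ⟨ [] ⟩) ⊹ c ◂ ⟨ H ⟩ ⊹ ⟨ L₁ ⟩ ⊹ s₁ ◂ ⟨ [] ⟩) ⊹ ⟨ F ⟩ ⊹ ⟨ J ⟩)
        rest : 1 ≤ cnt x (F ++ J)
        rest = +-cancelˡ-≤ 3 1 _ (subst (4 ≤_) (trans (cnt-rot x r″) (trans (cong (cnt x) (sym (flat ((T.Z ◂ ⟨ T.N ⟩ ⊹ T.Y ◂ ⟨ [] ⟩) ⊹ c ◂ ⟨ H ⟩ ⊹ ⟨ L₁ ⟩ ⊹ s₁ ◂ ⟨ F ++ J ⟩))))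
          (trans (cnt-++ x arcT) (cong₂ _+_ (proj₂ both) (trans (cnt-skip (c ∷ H) nH) (trans (cnt-skip L₁ nL) (cnt-yes (F ++ J) xs₁))))))) four)
        arc : IPath (arcT ++ c ∷ H ++ L₁ ++ s₁ ∷ [])
        arc = cyc-arc (arcT ++ c ∷ H ++ L₁ ++ s₁ ∷ []) (proj₂ (some-∈ (F ++ J) rest)) (subst Cyc (sym flat-r) (rot-cyc r″ ringC))
        in-C : ∀ {w} → w ∈ L₁ ++ s₁ ∷ [] → w ∈ C
        in-C i = rot-∈⁻ r″ (∈-cast flat-r (∈-++⁺ˡ (∈-++⁺ʳ arcT (there (∈-++⁺ʳ H i)))))
        prefix = prefix-of L₁ eN
        q∈ : q ∈ p ∷ I ++ q ∷ []
        q∈ = there (∈-++⁺ʳ I (here refl))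
        legq : IPath (q ∷ L₁ ++ s₁ ∷ [])
        legq = subst (λ l → IPath (q ∷ l)) (sym (proj₁ (proj₂ prefix)))
          (link S.qZ (λ i → #-sym (N-off (proj₂ (proj₂ prefix) i) q∈))
            (subst IPath (proj₁ (proj₂ prefix)) (ip-++ʳ H (ip-tail (ip-++ʳ arcT arc)))))
        off : ∀ {l u} → l ∈ L₁ ++ s₁ ∷ [] → u ∈ reverse I ++ p ∷ [] → l # u
        off i u∈ with ∈-cast (proj₁ (proj₂ prefix)) i
        ... | there j = N-off (proj₂ (proj₂ prefix) j) (P∈ (there u∈))
        ... | here refl with ∈-++⁻ (reverse I) u∈
        ... | inj₁ j = Z-off (there (∈-rev j))
        ... | inj₂ (here refl) = Z-off (here refl)
        rK : Rot (arcT ++ q ∷ reverse I ++ p ∷ []) (q ∷ (reverse I ++ p ∷ []) ++ arcT)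
        rK = rot-swap arcT
        two : cnt x ((reverse I ++ p ∷ []) ++ arcT) ≡ 2
        two = trans (cnt-skip (reverse I ++ p ∷ []) (λ i → nP′ (there i))) (proj₂ both)

  no-bad : ∀ {p I q y M z M′} → Bad p I q y M z M′ → ⊥
  no-bad {p} {I} {q} {y} {M} {z} {M′} B = finish (joint B S T) (joint (flip B) T S)
    where
    open Bad B
    S = span B
    T = span (flip B)
    module S = Span S
    module T = Span T
    free : ∀ {t} → Inner p I q t → t ∈ M ⊎ t ∈ M′ → ⊥
    free i (inj₁ j) = no-inner B i j
    free i (inj₂ j) = no-inner (flip B) (inner-flip {I = I} i) j
    unflip : ∀ {t} → Inner q (reverse I) p t → Inner p I q t
    unflip (inj₁ (u , u∈ , e)) = inj₁ (u , ∈-rev u∈ , e)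
    unflip (inj₂ (a , b)) = inj₂ (b , a)
    module U = Tight B free S T
    module W = Tight (flip B) (λ i j → free (unflip i) (swap j)) T S
    finish : ∃[ yB ] (Joint S.Y T.Z yB × S.E ++ y ∷ M ≡ S.N ++ yB ++ T.E) →
             ∃[ zB ] (Joint T.Y S.Z zB × T.E ++ z ∷ M′ ≡ T.N ++ zB ++ S.E) → ⊥
    finish (yB , jy , ey) (zB , jz , ez) = close jy jz refl refl
      where
      ez′ : T.E ++ S.D ++ S.Z ∷ [] ≡ T.N ++ zB
      ez′ = ++-cancelʳ S.E _ _ (trans (same ((⟨ T.E ⟩ ⊹ ⟨ S.D ⟩ ⊹ S.Z ◂ ⟨ [] ⟩) ⊹ ⟨ S.E ⟩) (⟨ T.E ⟩ ⊹ ⟨ S.D ⟩ ⊹ S.Z ◂ ⟨ S.E ⟩) refl)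
        (trans (cong (T.E ++_) (sym S.eD)) (trans ez (sym (++-assoc T.N zB S.E)))))
      r : Rot C (S.N ++ yB ++ T.N ++ zB)
      r = rot-trans rot (subst₂ Rot (trans (same ((y ◂ ⟨ M ⟩ ⊹ ⟨ S.D ⟩ ⊹ S.Z ◂ ⟨ [] ⟩) ⊹ ⟨ S.E ⟩) (y ◂ ⟨ M ⟩ ⊹ ⟨ S.D ⟩ ⊹ S.Z ◂ ⟨ S.E ⟩) refl) (cong (λ l → y ∷ M ++ l) (sym S.eD)))
        (trans (same (⟨ S.E ⟩ ⊹ y ◂ ⟨ M ⟩ ⊹ ⟨ S.D ++ S.Z ∷ [] ⟩) ((⟨ S.E ⟩ ⊹ y ◂ ⟨ M ⟩) ⊹ ⟨ S.D ++ S.Z ∷ [] ⟩) refl)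
          (trans (cong (_++ S.D ++ S.Z ∷ []) ey) (trans (flat ((⟨ S.N ⟩ ⊹ ⟨ yB ⟩ ⊹ ⟨ T.E ⟩) ⊹ ⟨ S.D ++ S.Z ∷ [] ⟩)) (cong (λ l → S.N ++ yB ++ l) ez′))))
        (rot-swap (y ∷ M ++ S.D ++ S.Z ∷ [])))
      r′ : Rot C (T.N ++ zB ++ S.N ++ yB)
      r′ = rot-trans r (subst₂ Rot (++-assoc S.N yB _) (++-assoc T.N zB _) (rot-swap (S.N ++ yB)))
      close : ∀ {yB′ zB′} → Joint S.Y T.Z yB′ → Joint T.Y S.Z zB′ → yB ≡ yB′ → zB ≡ zB′ → ⊥
      close _ (shared e) _ ez″ = U.not-shared r jy ez″ e
      close (shared e) _ ey″ _ = W.not-shared r′ jz ey″ e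
      close (apart H nH) (apart L nL) ey″ ez″ with W.adjacent r′ jz H nH ey″ | U.adjacent r jy L nL ez″
      -- Each end of the walk now sees an edge of `C`; the walk and the two spans are the three
      -- paths of a prism.
      ... | refl | refl = prf (prism {y = T.Z} {z = T.Y} {y′ = S.Y} {z′ = S.Z} {I = I} {N = T.N} {N′ = S.N} path
            (rot-cyc ring-rot ringC) T.qZ S.pY T.pY S.qZ (λ i j e → proj₁ (out i) (subst (_∈ C) (sym e) (rot-∈⁻ ring-rot j))) meet)
        where
        ring-rot : Rot C ((T.Z ∷ T.N ++ T.Y ∷ []) ++ S.Z ∷ S.N ++ S.Y ∷ [])
        ring-rot = rot-trans (subst₂ (λ k l → Rot C (S.N ++ k ++ T.N ++ l)) ey″ ez″ r)
          (subst (Rot (S.N ++ S.Y ∷ T.Z ∷ T.N ++ T.Y ∷ S.Z ∷ [])) (sym (flat ((T.Z ◂ ⟨ T.N ⟩ ⊹ T.Y ◂ ⟨ [] ⟩) ⊹ S.Z ◂ ⟨ S.N ⟩ ⊹ S.Y ◂ ⟨ [] ⟩)))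
            (rot-turn (⟨ S.N ⟩ ⊹ S.Y ◂ ⟨ [] ⟩) (T.Z ◂ ⟨ T.N ⟩ ⊹ T.Y ◂ S.Z ◂ ⟨ [] ⟩)))
        meet : ∀ {u w} → u ∈ p ∷ I ++ q ∷ [] → w ∈ (T.Z ∷ T.N ++ T.Y ∷ []) ++ S.Z ∷ S.N ++ S.Y ∷ [] → u ∼ w →
          (u ≡ p × (w ≡ T.Z ⊎ w ≡ S.Y)) ⊎ (u ≡ q × (w ≡ T.Y ⊎ w ≡ S.Z))
        meet i j e with ∈-++⁻ (T.Z ∷ T.N ++ T.Y ∷ []) j
        ... | inj₂ k = [ (λ (a , b) → inj₁ (a , inj₂ b)) , (λ (a , b) → inj₂ (a , inj₂ b)) ]′ (cross B S U.freeS i k e)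
        ... | inj₁ k = [ (λ (a , b) → inj₂ (a , inj₁ b)) , (λ (a , b) → inj₁ (a , inj₁ b)) ]′
              (cross (flip B) T U.freeT (∈-cast (rev-ends p I q) (reverse⁺ i)) k e)

  -- Induction on the bound `N`. For a single vertex this is properness of `W`. A longer induced
  -- path with spokes on both arcs is `Bad`: deleting either of its ends shortens it, which provides
  -- `ssˡ` and `ssʳ`.
  linked : ∀ N {p q n y z} → n ≤ N → Trail Out p q n → p ∼ y → q ∼ z → SS y z
  linked N {p} {q} {n} {y} {z} n≤ t py qz {M} {M′} rt with induced-path t
  ... | [] , _ , end , f , _ = pair (proj₁ (f (here refl))) (proj₁ (proj₂ (f (here refl)))) rt py qz
  ... | a ∷ L , ip , more l , f , len with last-snoc l | first x M | first x M′
  ... | _ | inj₁ g | _ = inj₁ g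
  ... | _ | inj₂ _ | inj₁ g = inj₂ g
  linked (suc N) {p} {q} {n} {y} {z} n≤ t py qz {M} {M′} rt | a ∷ L , ip , more l , f , len
    | I , e | inj₂ (A , s , B , eM , _ , xs) | inj₂ (A′ , s′ , B′ , eM′ , _ , xs′) = ⊥-elim (no-bad (record
      { path = path
      ; out = out
      ; ssˡ = λ {u} {w} i j ua wb → let (n′ , n′< , t′) = trail-in (ip-++ˡ (p ∷ I) path) (λ k → out (∈-++⁺ˡ k)) i j in
                linked N (≤-trans (≤-pred n′<) short) t′ ua wb
      ; ssʳ = λ {u} {w} i j ua wb → let (n′ , n′< , t′) = trail-in (ip-tail path) (λ k → out (there k)) i j in
                linked N (≤-trans (≤-pred (subst (n′ <_) (trans (length-++ I) (+-comm (length I) 1)) n′<)) short) t′ ua wb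
      ; rot = rt ; py = py ; qz = qz
      ; s∈ = ∈-cast (sym eM) (∈-++⁺ʳ A (here refl)) ; xs = xs
      ; s′∈ = ∈-cast (sym eM′) (∈-++⁺ʳ A′ (here refl)) ; xs′ = xs′ }))
    where
    path : IPath (p ∷ I ++ q ∷ [])
    path = subst (λ k → IPath (p ∷ k)) e ip
    out : ∀ {w} → w ∈ p ∷ I ++ q ∷ [] → Out w
    out i = f (∈-cast (cong (p ∷_) (sym e)) i)
    short : length I ≤ N
    short = ≤-pred (≤-trans (subst (_≤ n) (trans (cong length e) (trans (length-++ I) (+-comm (length I) 1))) len) n≤)
  linked zero n≤ t py qz rt | a ∷ L , ip , more l , f , len | _ | inj₂ _ | inj₂ _ = case ≤-trans len n≤ of λ ()

-- Sectors as list decompositions, components outside `N[x]`, and the ring through `u`.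

module Components (G : Graph) (isk : ISK4-free G) (dia : Diamond-free G) (bow : Bowtie-free G) (prf : Prism-free G)
  {x : V G} {C : List (V G)} (rim : Rim G x C)
  (same-head : ∀ {z X Y} → Paths.Rot G C (z ∷ X) → Paths.Rot G C (z ∷ Y) → X ≡ Y) where
  open Paths G
  open Trails G
  open Rim rim
  open Core G isk dia bow rim using (Thin; no-thin-ring)
  open Walks G isk dia bow rim using (Out; SS; four; has-spoke)
  open Sectors G isk dia bow prf rim using (linked)

  record Sec (s : V G) (I : List (V G)) (e : V G) (R : List (V G)) : Set where
    field
      rot : Rot C (s ∷ I ++ e ∷ R)
      xs  : x ∼ s
      xe  : x ∼ e
      nI  : NoN x I

  same-end : ∀ {s I e R s′ I′ R′} → Sec s I e R → Sec s′ I′ e R′ → s ≡ s′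
  same-end {s} {I} {e} {R} {s′} {I′} {R′} S S′
    with ∈-tails R R′ (same-head (rot-trans (Sec.rot S) (rot-turn (s ◂ ⟨ I ⟩) (e ◂ ⟨ R ⟩)))
                                 (rot-trans (Sec.rot S′) (rot-turn (s′ ◂ ⟨ I′ ⟩) (e ◂ ⟨ R′ ⟩))))
  ... | inj₁ i = ⊥-elim (Sec.nI S i (Sec.xs S′))
  ... | inj₂ (here q) = q
  ... | inj₂ (there i) = ⊥-elim (Sec.nI S′ i (Sec.xs S))

  same-interior : ∀ {s I e R s′ I′ e′ R′ v} → Sec s I e R → Sec s′ I′ e′ R′ → v ∈ I → v ∈ I′ → s ≡ s′
  same-interior {s} {I} {e} {R} {s′} {I′} {e′} {R′} S S′ v∈ v∈′ with ∈-∃++ v∈ | ∈-∃++ v∈′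
  ... | A , B , refl | A′ , B′ , refl
    with ∈-tails (B ++ e ∷ R) (B′ ++ e′ ∷ R′) (trans (++-assoc B (e ∷ R) (s ∷ A)) (trans (same-head (turned S) (turned S′)) (sym (++-assoc B′ (e′ ∷ R′) (s′ ∷ A′)))))
    where
    turned : ∀ {s A v B e R} → Sec s (A ++ v ∷ B) e R → Rot C (v ∷ B ++ e ∷ R ++ s ∷ A)
    turned {s} {A} {v} {B} {e} {R} S = rot-trans (subst (Rot C) (flat (s ◂ (⟨ A ⟩ ⊹ v ◂ ⟨ B ⟩) ⊹ e ◂ ⟨ R ⟩)) (Sec.rot S))
      (rot-turn (s ◂ ⟨ A ⟩) (v ◂ ⟨ B ⟩ ⊹ e ◂ ⟨ R ⟩))
  ... | inj₁ i = ⊥-elim (Sec.nI S (∈-++⁺ˡ i) (Sec.xs S′))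
  ... | inj₂ (here q) = q
  ... | inj₂ (there i) = ⊥-elim (Sec.nI S′ (∈-++⁺ˡ i) (Sec.xs S))

  -- A common vertex is an end of both sectors if it is a spoke and interior to both if it is not.
  meeting : ∀ {s I e R s′ I′ e′ R′ v} → Sec s I e R → Sec s′ I′ e′ R′ →
    v ∈ s ∷ I ++ e ∷ [] → v ∈ s′ ∷ I′ ++ e′ ∷ [] → s ≡ s′ ⊎ e ≡ s′ ⊎ e′ ≡ s
  meeting {I = I} {I′ = I′} S S′ i j with classify I i | classify I′ j
    where
    classify : ∀ {s e v} I → v ∈ s ∷ I ++ e ∷ [] → v ≡ s ⊎ v ∈ I ⊎ v ≡ e
    classify I (here q) = inj₁ q
    classify I (there i) with ∈-++⁻ I i
    ... | inj₁ j = inj₂ (inj₁ j)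
    ... | inj₂ (here q) = inj₂ (inj₂ q)
  ... | inj₁ refl | inj₁ q = inj₁ q
  ... | inj₁ refl | inj₂ (inj₁ k) = ⊥-elim (Sec.nI S′ k (Sec.xs S))
  ... | inj₁ refl | inj₂ (inj₂ q) = inj₂ (inj₂ (sym q))
  ... | inj₂ (inj₁ k) | inj₁ refl = ⊥-elim (Sec.nI S k (Sec.xs S′))
  ... | inj₂ (inj₁ k) | inj₂ (inj₁ l) = inj₁ (same-interior S S′ k l)
  ... | inj₂ (inj₁ k) | inj₂ (inj₂ refl) = ⊥-elim (Sec.nI S k (Sec.xe S′))
  ... | inj₂ (inj₂ refl) | inj₁ q = inj₂ (inj₁ q)
  ... | inj₂ (inj₂ refl) | inj₂ (inj₁ l) = ⊥-elim (Sec.nI S′ l (Sec.xe S))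
  ... | inj₂ (inj₂ refl) | inj₂ (inj₂ refl) = inj₁ (same-end S S′)

  -- Three sectors that follow one another cyclically exhaust `C`, leaving it only three spokes.
  around : ∀ {s₁ I₁ s₂ R₁ I₂ s₃ R₂ I₃ R₃} → Sec s₁ I₁ s₂ R₁ → Sec s₂ I₂ s₃ R₂ → Sec s₃ I₃ s₁ R₃ → s₃ ≢ s₁ → ⊥
  around {s₁} {I₁} {s₂} {R₁} {I₂} {s₃} {R₂} {I₃} {R₃} S₁ S₂ S₃ ne
    with split-before R₁ I₂ (same-head (rot-trans (Sec.rot S₁) (rot-turn (s₁ ◂ ⟨ I₁ ⟩) (s₂ ◂ ⟨ R₁ ⟩))) (Sec.rot S₂))
           (λ i → case ∈-++⁻ I₂ i of λ { (inj₁ j) → Sec.nI S₂ j (Sec.xs S₁) ; (inj₂ (here q)) → ne (sym q) })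
  ... | O , refl , _ = <⇒≱ four (≤-reflexive total)
    where
    r : Rot C (s₃ ∷ O ++ s₁ ∷ I₁ ++ s₂ ∷ I₂)
    r = rot-trans (Sec.rot S₁) (rot-turn (s₁ ◂ ⟨ I₁ ⟩ ⊹ s₂ ◂ ⟨ I₂ ⟩) (s₃ ◂ ⟨ O ⟩))
    O≡ : O ≡ I₃
    O≡ = Counting.uniq-split G O I₃ (same-head r (Sec.rot S₃))
      (λ i → cyc-fresh (rot-cyc (Sec.rot S₁) ringC) (∈-++⁺ʳ I₁ (there (∈-++⁺ʳ I₂ (there i)))))
      (λ i → Sec.nI S₃ i (Sec.xs S₁))
    total : cnt x C ≡ 3
    total = trans (cnt-rot x r) (trans (cnt-yes (O ++ s₁ ∷ I₁ ++ s₂ ∷ I₂) (Sec.xs S₃)) (cong suc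
      (trans (cnt-skip O (subst (NoN x) (sym O≡) (Sec.nI S₃))) (trans (cnt-yes (I₁ ++ s₂ ∷ I₂) (Sec.xs S₁)) (cong suc
      (trans (cnt-skip I₁ (Sec.nI S₁)) (trans (cnt-yes I₂ (Sec.xs S₂)) (cong suc (cnt-none I₂ (Sec.nI S₂))))))))))

  three-sectors : ∀ {s₁ I₁ e₁ R₁ s₂ I₂ e₂ R₂ s₃ I₃ e₃ R₃} → Sec s₁ I₁ e₁ R₁ → Sec s₂ I₂ e₂ R₂ → Sec s₃ I₃ e₃ R₃ →
    s₁ ≡ s₂ ⊎ e₁ ≡ s₂ ⊎ e₂ ≡ s₁ → s₁ ≡ s₃ ⊎ e₁ ≡ s₃ ⊎ e₃ ≡ s₁ → s₂ ≡ s₃ ⊎ e₂ ≡ s₃ ⊎ e₃ ≡ s₂ →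
    s₁ ≡ s₂ ⊎ s₁ ≡ s₃ ⊎ s₂ ≡ s₃
  three-sectors S₁ S₂ S₃ (inj₁ q) _ _ = inj₁ q
  three-sectors S₁ S₂ S₃ _ (inj₁ q) _ = inj₂ (inj₁ q)
  three-sectors S₁ S₂ S₃ _ _ (inj₁ q) = inj₂ (inj₂ q)
  three-sectors S₁ S₂ S₃ (inj₂ (inj₁ refl)) (inj₂ (inj₁ q)) _ = inj₂ (inj₂ q)
  three-sectors S₁ S₂ S₃ (inj₂ (inj₁ refl)) (inj₂ (inj₂ refl)) (inj₂ (inj₂ q)) = inj₁ q
  three-sectors {s₁} {s₃ = s₃} S₁ S₂ S₃ (inj₂ (inj₁ refl)) (inj₂ (inj₂ refl)) (inj₂ (inj₁ refl)) with s₃ Finₚ.≟ s₁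
  ... | yes q = inj₂ (inj₁ (sym q))
  ... | no ne = ⊥-elim (around S₁ S₂ S₃ ne)
  three-sectors S₁ S₂ S₃ (inj₂ (inj₂ refl)) (inj₂ (inj₂ refl)) (inj₂ (inj₁ q)) = inj₂ (inj₁ q)
  three-sectors S₁ S₂ S₃ (inj₂ (inj₂ refl)) (inj₂ (inj₂ refl)) (inj₂ (inj₂ q)) = inj₁ q
  three-sectors S₁ S₂ S₃ (inj₂ (inj₂ refl)) (inj₂ (inj₁ q)) (inj₂ (inj₁ refl)) = inj₂ (inj₁ refl)
  three-sectors {s₁} {s₂ = s₂} S₁ S₂ S₃ (inj₂ (inj₂ refl)) (inj₂ (inj₁ refl)) (inj₂ (inj₂ refl)) with s₂ Finₚ.≟ s₁
  ... | yes q = inj₁ (sym q)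
  ... | no ne = ⊥-elim (around S₁ S₃ S₂ ne)

  module _ {s I e R} (S : Sec s I e R) where
    open Sec S

    ∈-sector : ∀ {v w} → v ∈ I → w ∈ C → v ∼ w → w ∈ s ∷ I ++ e ∷ []
    ∈-sector v∈ w∈ vw with rot-∈ rot w∈
    ... | here q = here q
    ... | there i with ∈-++⁻ I i
    ... | inj₁ j = there (∈-++⁺ˡ j)
    ... | inj₂ (here q) = there (∈-++⁺ʳ I (here q))
    ... | inj₂ (there j) = ⊥-elim (proj₂ (ip-cross R (cyc-tail (cyc-rot (s ∷ I) (rot-cyc rot ringC))) j v∈) (∼-sym vw))

    ss-sector : ∀ {w y} → w ∈ C → y ∈ I → SS w y → w ∈ s ∷ I ++ e ∷ []
    ss-sector {w} {y} w∈ y∈ ss with rot-∈ rot w∈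
    ... | here q = here q
    ... | there i with ∈-++⁻ I i
    ... | inj₁ j = there (∈-++⁺ˡ j)
    ... | inj₂ (here q) = there (∈-++⁺ʳ I (here q))
    ... | inj₂ (there j) with ∈-∃++ j | ∈-∃++ y∈
    ... | R₁ , R₂ , refl | A , B , refl with ss (rot-trans rot (subst₂ Rot
            (same ((s ◂ ⟨ A ⟩ ⊹ y ◂ ⟨ B ⟩ ⊹ e ◂ ⟨ R₁ ⟩) ⊹ w ◂ ⟨ R₂ ⟩) (s ◂ (⟨ A ⟩ ⊹ y ◂ ⟨ B ⟩) ⊹ e ◂ ⟨ R₁ ⟩ ⊹ w ◂ ⟨ R₂ ⟩) refl)
            (same ((w ◂ ⟨ R₂ ⟩) ⊹ s ◂ ⟨ A ⟩ ⊹ y ◂ ⟨ B ⟩ ⊹ e ◂ ⟨ R₁ ⟩) (w ◂ (⟨ R₂ ⟩ ⊹ s ◂ ⟨ A ⟩) ⊹ y ◂ ⟨ B ⟩ ⊹ e ◂ ⟨ R₁ ⟩) refl)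
            (rot-swap (s ∷ A ++ y ∷ B ++ e ∷ R₁))))
    ... | inj₁ f = ⊥-elim (f (∈-++⁺ʳ R₂ (here refl)) xs)
    ... | inj₂ f = ⊥-elim (f (∈-++⁺ʳ B (here refl)) xe)

    Attached : V G → Set
    Attached v = Out v × ∃[ p ] ∃[ n ] ∃[ y ] (Trail Out v p n × p ∼ y × y ∈ I)

    -- Contains `I` and, by `linked`, is closed under steps outside `N[x]`; so it contains the
    -- component of every vertex of `I`.
    Inv : V G → Set
    Inv v = v ∈ I ⊎ Attached v

    attached-in : ∀ {v w} → Attached v → w ∈ C → v ∼ w → w ∈ s ∷ I ++ e ∷ []
    attached-in (_ , p , n , y , t , py , y∈) w∈ vw = ss-sector w∈ y∈ (linked n ≤-refl t vw py)

    inv-out : ∀ {v} → Inv v → ¬ N[_] G x v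
    inv-out (inj₁ v∈) (inj₁ refl) = x∉C (rot-∈⁻ rot (there (∈-++⁺ˡ v∈)))
    inv-out (inj₁ v∈) (inj₂ xv) = nI v∈ xv
    inv-out (inj₂ ((_ , v≢ , _) , _)) (inj₁ q) = v≢ q
    inv-out (inj₂ ((_ , _ , ¬xv) , _)) (inj₂ xv) = ¬xv xv

    inside : ∀ {w} → ¬ x ∼ w → w ∈ s ∷ I ++ e ∷ [] → w ∈ I
    inside ¬xw (here refl) = ⊥-elim (¬xw xs)
    inside ¬xw (there i) with ∈-++⁻ I i
    ... | inj₁ j = j
    ... | inj₂ (here refl) = ⊥-elim (¬xw xe)

    inv-step : ∀ {v w} → v ∼ w → ¬ N[_] G x w → Inv v → Inv w
    inv-step {v} {w} vw w-out iv with w ∈? C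
    inv-step {v} {w} vw w-out (inj₁ v∈) | yes w∈ = inj₁ (inside (λ xw → w-out (inj₂ xw)) (∈-sector v∈ w∈ vw))
    inv-step {v} {w} vw w-out (inj₂ at) | yes w∈ = inj₁ (inside (λ xw → w-out (inj₂ xw)) (attached-in at w∈ vw))
    inv-step {v} {w} vw w-out (inj₁ v∈) | no w∉ = inj₂ (o , w , 0 , v , stop o , ∼-sym vw , v∈)
      where o = w∉ , (λ q → w-out (inj₁ q)) , (λ xw → w-out (inj₂ xw))
    inv-step {v} {w} vw w-out (inj₂ (_ , p , n , y , t , py , y∈)) | no w∉ = inj₂ (o , p , suc n , y , step o (∼-sym vw) t , py , y∈)
      where o = w∉ , (λ q → w-out (inj₁ q)) , (λ xw → w-out (inj₂ xw))

    reach-back : ∀ {a v} → Reach G (N[_] G x) a v → Inv v → Inv a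
    reach-back (here _) iv = iv
    reach-back (step ¬X e r) iv = inv-step (∼-sym e) ¬X (reach-back r iv)

    reach-fwd : ∀ {a v} → Reach G (N[_] G x) a v → Inv a → Inv v
    reach-fwd (here _) iv = iv
    reach-fwd (step _ e r) iv = reach-fwd r (inv-step e (head-out r) iv)
      where
      head-out : ∀ {a v} → Reach G (N[_] G x) a v → ¬ N[_] G x a
      head-out (here f) = f
      head-out (step f _ _) = f

    Touches : V G → Set
    Touches u = ∃[ w ] (u ∼ w × Inv w)

    -- The walk is read from its end in the sector. It stays in `Inv` until it meets `u`, the only
    -- vertex of `N[x]` on its way.
    touch : ∀ {u a v} → Reach G (λ w → N[_] G x w × w ≢ u) a v → Inv v → Inv a ⊎ Touches u
    touch (here _) iv = inj₁ iv
    touch {u} {a} (step ¬X e r) iv with touch r iv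
    ... | inj₂ t = inj₂ t
    ... | inj₁ iw with a Finₚ.≟ u
    ... | yes refl = inj₂ (_ , e , iw)
    ... | no ne = inj₁ (inv-step (∼-sym e) (λ i → ¬X (i , ne)) iw)

    touches : ∀ {u v} → x ∼ u → Reach G (λ w → N[_] G x w × w ≢ u) u v → v ∈ I → Touches u
    touches xu r v∈ with touch r (inj₁ v∈)
    ... | inj₁ iu = ⊥-elim (inv-out iu (inj₂ xu))
    ... | inj₂ t = t

    touch-on-ring : ∀ {u} → u ∈ C → Touches u → u ∈ s ∷ I ++ e ∷ []
    touch-on-ring u∈ (w , uw , inj₁ w∈) = ∈-sector w∈ u∈ (∼-sym uw)
    touch-on-ring u∈ (w , uw , inj₂ at) = attached-in at u∈ (∼-sym uw)

    common-component : ∀ {r v w} → Reach G (N[_] G x) r v → v ∈ I → Reach G (N[_] G x) r w → w ∈ C → w ∈ I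
    common-component rv v∈ rw w∈ with reach-fwd rw (reach-back rv (inj₁ v∈))
    ... | inj₁ i = i
    ... | inj₂ ((w∉ , _) , _) = ⊥-elim (w∉ w∈)

  trail-map : ∀ {Q Q′ : V G → Set} → (∀ {w} → Q w → Q′ w) → ∀ {u v n} → Trail Q u v n → Trail Q′ u v n
  trail-map f (stop q) = stop (f q)
  trail-map f (step q e t) = step (f q) e (trail-map f t)

  trail-++ : ∀ {Q u v w n m} → Trail Q u v n → Trail Q v w m → Trail Q u w (n + m)
  trail-++ (stop _) t = t
  trail-++ (step q e t′) t = step q e (trail-++ t′ t)

  attached-trail : ∀ {s I e R} (S : Sec s I e R) {v p n y} → Trail Out v p n → p ∼ y → y ∈ I → Trail (Attached S) v p n
  attached-trail S (stop o) py y∈ = stop (o , _ , 0 , _ , stop o , py , y∈)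
  attached-trail S (step o e t) py y∈ = step (o , _ , _ , _ , step o e t , py , y∈) e (attached-trail S t py y∈)

  touch-trail : ∀ {s I e R} (S : Sec s I e R) {u} → Touches S u →
    ∃[ p ] ∃[ n ] ∃[ y ] (Trail (λ w → w ≡ u ⊎ Attached S w) u p n × p ∼ y × y ∈ I)
  touch-trail S {u} (w , uw , inj₁ w∈) = u , 0 , w , stop (inj₁ refl) , uw , w∈
  touch-trail S {u} (w , uw , inj₂ (_ , p , n , y , t , py , y∈)) =
    p , suc n , y , step (inj₁ refl) uw (trail-map inj₂ (attached-trail S t py y∈)) , py , y∈

  -- A subpath of Q from its neighbours of a to its neighbours of b, with only its ends attached.
  record Trimmed (Q : List (V G)) (a b : V G) : Set where
    field
      {p q} : V G
      {P P₁ P₂} : List (V G)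
      eP₁ : P ≡ p ∷ P₁
      eP₂ : P ≡ P₂ ++ q ∷ []
      ip  : IPath P
      sub : ∀ {w} → w ∈ P → w ∈ Q
      pa  : p ∼ a
      qb  : q ∼ b
      pa! : ∀ {w} → w ∈ P → w ∼ a → w ≡ p
      qb! : ∀ {w} → w ∈ P → w ∼ b → w ≡ q

  trimmed-reverse : ∀ {Q a b} → Trimmed Q a b → Trimmed Q b a
  trimmed-reverse T = record
    { eP₁ = trans (cong reverse eP₂) (rev-snoc P₂ q)
    ; eP₂ = trans (cong reverse eP₁) (rev-∷ p P₁)
    ; ip = ip-reverse ip ; sub = λ i → sub (∈-rev i) ; pa = qb ; qb = pa
    ; pa! = λ i → qb! (∈-rev i) ; qb! = λ i → pa! (∈-rev i) }
    where open Trimmed T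

  trim-right : ∀ {Q a b} A w B → Q ≡ A ++ w ∷ B → IPath Q → a ∼ w → NoN a B → ∀ {c} → c ∈ w ∷ B → b ∼ c → Trimmed Q a b
  trim-right {a = a} {b} A w B refl ip aw nB c∈ bc with first b (w ∷ B)
  ... | inj₁ f = ⊥-elim (f c∈ bc)
  ... | inj₂ (D , r , E , e , nD , br) with start D e
    where
    start : ∀ D → w ∷ B ≡ D ++ r ∷ E → ∃[ K ] (D ++ r ∷ [] ≡ w ∷ K × (∀ {v} → v ∈ K → v ∈ B))
    start [] refl = [] , refl , λ ()
    start (_ ∷ D) refl = D ++ r ∷ [] , refl , λ i → ∈-cast (++-assoc D (r ∷ []) E) (∈-++⁺ˡ i)
  ... | K , eK , K⊆ = record
      { eP₁ = eK ; eP₂ = refl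
      ; ip = ip-++ˡ (D ++ r ∷ []) (subst IPath (trans e (sym (++-assoc D (r ∷ []) E))) (ip-++ʳ A ip))
      ; sub = λ i → ∈-++⁺ʳ A (case ∈-cast eK i of λ { (here q) → here q ; (there j) → there (K⊆ j) })
      ; pa = ∼-sym aw ; qb = ∼-sym br
      ; pa! = λ i wa → case ∈-cast eK i of λ { (here q) → q ; (there j) → ⊥-elim (nB (K⊆ j) (∼-sym wa)) }
      ; qb! = λ i wb → case ∈-++⁻ D i of λ { (inj₁ j) → ⊥-elim (nD j (∼-sym wb)) ; (inj₂ (here q)) → q } }

  -- The last neighbours of `a` and of `b` on `Q` are compared. The subpath starts at the earlier
  -- one and stops at the next neighbour of the other vertex.
  trim : ∀ {Q a b c d} → IPath Q → c ∈ Q → a ∼ c → d ∈ Q → b ∼ d → Trimmed Q a b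
  trim {Q} {a} {b} ip c∈ ac d∈ bd with last a Q | last b Q
  ... | inj₁ f | _ = ⊥-elim (f c∈ ac)
  ... | _ | inj₁ f = ⊥-elim (f d∈ bd)
  ... | inj₂ (A , w , B , e , nB , aw) | inj₂ (A′ , w′ , B′ , e′ , nB′ , bw) with ∈-tails A A′ (trans (sym e) e′)
  ... | inj₁ i = trim-right A w B e ip aw nB (there i) bw
  ... | inj₂ i = trimmed-reverse (trim-right A′ w′ B′ e′ ip bw nB′ i aw)

  close-ring : ∀ {Q Z} N {Y} → IPath (Z ∷ N ++ Y ∷ []) → (T : Trimmed Q Y Z) →
    (∀ {u w} → u ∈ Q → w ∈ Z ∷ N ++ Y ∷ [] → u ≢ w) → (∀ {u w} → u ∈ Q → w ∈ N → ¬ u ∼ w) →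
    Cyc ((Z ∷ N ++ Y ∷ []) ++ Trimmed.P T)
  close-ring {Q} {Z} N {Y} arc T ne clear with Trimmed.P₁ T in e₁
  -- A single vertex that sees both `Y` and `Z`; the path in `arc-ring` has two ends.
  ... | [] = subst (λ l → Cyc ((Z ∷ N ++ Y ∷ []) ++ l)) (sym single) (cyc-rot₁ (mkCyc N arc pZ pa
        (λ i → ne p∈ (there (∈-++⁺ˡ i)) , clear p∈ i)))
    where
    open Trimmed T
    single : P ≡ p ∷ []
    single = trans eP₁ (cong (p ∷_) e₁)
    p∈ : p ∈ Q
    p∈ = sub (∈-cast (sym single) (here refl))
    q≡p : q ≡ p
    q≡p = ∷ʳ-injectiveʳ P₂ [] (trans (sym eP₂) single)
    pZ : p ∼ Z
    pZ = subst (_∼ Z) q≡p qb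
  ... | a ∷ L with snoc-view a L
  ... | I , b , e = subst (λ l → Cyc ((Z ∷ N ++ Y ∷ []) ++ l)) (sym shape)
        (arc-ring N I arc (subst IPath shape ip) (∼-sym pa) qb (λ i → ne (in-Q i)) cross)
    where
    open Trimmed T
    shape₀ : P ≡ (p ∷ I) ++ b ∷ []
    shape₀ = trans eP₁ (cong (p ∷_) (trans e₁ e))
    shape : P ≡ p ∷ I ++ q ∷ []
    shape = trans shape₀ (cong (λ w → p ∷ I ++ w ∷ []) (sym (∷ʳ-injectiveʳ P₂ (p ∷ I) (trans (sym eP₂) shape₀))))
    in-Q : ∀ {u} → u ∈ p ∷ I ++ q ∷ [] → u ∈ Q
    in-Q i = sub (∈-cast (sym shape) i)
    cross : ∀ {u w} → u ∈ p ∷ I ++ q ∷ [] → w ∈ Z ∷ N ++ Y ∷ [] → u ∼ w → (u ≡ p × w ≡ Y) ⊎ (u ≡ q × w ≡ Z)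
    cross i (here refl) uw = inj₂ (qb! (∈-cast (sym shape) i) uw , refl)
    cross i (there j) uw with ∈-++⁻ N j
    ... | inj₁ k = ⊥-elim (clear (in-Q i) k uw)
    ... | inj₂ (here refl) = inj₁ (pa! (∈-cast (sym shape) i) uw , refl)

  cnt-only : ∀ {u} L → IPath L → (∀ {w} → w ∈ L → x ∼ w → w ≡ u) → cnt x L ≤ 1
  cnt-only [] _ _ = z≤n
  cnt-only {u} (a ∷ L) ip f with x ∼? a
  ... | no ¬xa = subst (_≤ 1) (sym (cnt-no L ¬xa)) (cnt-only L (ip-tail ip) (λ i → f (there i)))
  ... | yes xa = subst (_≤ 1) (sym (trans (cnt-yes L xa) (cong suc (cnt-none L
        (λ i xw → ip-fresh ip (subst (_∈ L) (trans (f (there i) xw) (sym (f (here refl) xa))) i)))))) ≤-refl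

  last-attached : ∀ Q l → (∀ {c} → c ∈ l → NoN c Q) ⊎
    ∃[ A ] ∃[ c ] ∃[ B ] (l ≡ A ++ c ∷ B × (∀ {b} → b ∈ B → NoN b Q) × ∃[ w ] (w ∈ Q × c ∼ w))
  last-attached Q [] = inj₁ λ ()
  last-attached Q (a ∷ l) with last-attached Q l
  ... | inj₂ (A , c , B , e , f , g) = inj₂ (a ∷ A , c , B , cong (a ∷_) e , f , g)
  ... | inj₁ f with first a Q
  ... | inj₁ g = inj₁ λ { (here refl) → g ; (there i) → f i }
  ... | inj₂ (A , w , B , e , _ , aw) = inj₂ ([] , a , l , refl , f , w , ∈-cast (sym e) (∈-++⁺ʳ A (here refl)) , aw)

  first-attached : ∀ Q l → (∀ {c} → c ∈ l → NoN c Q) ⊎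
    ∃[ A ] ∃[ c ] ∃[ B ] (l ≡ A ++ c ∷ B × (∀ {b} → b ∈ A → NoN b Q) × ∃[ w ] (w ∈ Q × c ∼ w))
  first-attached Q [] = inj₁ λ ()
  first-attached Q (a ∷ l) with first a Q
  ... | inj₂ (A , w , B , e , _ , aw) = inj₂ ([] , a , l , refl , (λ ()) , w , ∈-cast (sym e) (∈-++⁺ʳ A (here refl)) , aw)
  ... | inj₁ g with first-attached Q l
  ... | inj₁ f = inj₁ λ { (here refl) → g ; (there i) → f i }
  ... | inj₂ (A , c , B , e , f , h) = inj₂ (a ∷ A , c , B , cong (a ∷_) e , (λ { (here refl) → g ; (there i) → f i }) , h)

  -- A path `Q` of `u` and vertices attached to `S₁` or `S₂` joins the two interiors, and none of
  -- its vertices sees `L`. With `Z` its last attachment on `I₁ e₁` and `Y` its first on `s₂ I₂`, a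
  -- piece of it closes up with the arc through `e₁ L s₂`. That ring has the spokes `e₁`, `s₂` and
  -- `u` and misses `s₁` and `e₂`, so its spoke number is in the forbidden range.
  far : ∀ {s₁ I₁ e₁ L s₂ I₂ e₂ L′ u} → (S₁ : Sec s₁ I₁ e₁ (L ++ s₂ ∷ I₂ ++ e₂ ∷ L′)) (S₂ : Sec s₂ I₂ e₂ (L′ ++ s₁ ∷ I₁ ++ e₁ ∷ L)) →
    u ∉ C → x ∼ u → NoN u L → Touches S₁ u → Touches S₂ u → ⊥
  far {s₁} {I₁} {e₁} {L} {s₂} {I₂} {e₂} {L′} {u} S₁ S₂ u∉ xu nuL t₁ t₂
    with touch-trail S₁ t₁ | touch-trail S₂ t₂
  ... | p₁ , n₁ , y₁ , τ₁ , py₁ , y₁∈ | p₂ , n₂ , y₂ , τ₂ , py₂ , y₂∈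
    with induced-path (trail-++ (trail-map {Q′ = λ w → w ≡ u ⊎ Attached S₁ w ⊎ Attached S₂ w} [ inj₁ , (λ a → inj₂ (inj₁ a)) ]′ (trail-reverse τ₁))
                                (trail-map [ inj₁ , (λ a → inj₂ (inj₂ a)) ]′ τ₂))
  ... | Ql , ipQ , lastQ , inQ , _ with last-attached (p₁ ∷ Ql) (I₁ ++ e₁ ∷ []) | first-attached (p₁ ∷ Ql) (s₂ ∷ I₂)
  ... | inj₁ f | _ = f (∈-++⁺ˡ y₁∈) (here refl) (∼-sym py₁)
  ... | inj₂ _ | inj₁ f = f (there y₂∈) (∈-cast (sym (proj₂ (last-snoc lastQ))) (∈-++⁺ʳ (proj₁ (last-snoc lastQ)) (here refl))) (∼-sym py₂)
  ... | inj₂ (X , Z , E , eX , nE , c , c∈ , Zc) | inj₂ (D , Y , X′ , eX′ , nD , d , d∈ , Yd) =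
    no-thin-ring (Z ∷ N ++ Y ∷ []) P rest rotA ring x∉A thin three few′
    where
    Q = p₁ ∷ Ql
    N = E ++ L ++ D
    rest = X′ ++ e₂ ∷ L′ ++ s₁ ∷ X
    T : Trimmed Q Y Z
    T = trim ipQ d∈ Yd c∈ Zc
    open Trimmed T
    rotA : Rot C ((Z ∷ N ++ Y ∷ []) ++ rest)
    rotA = rot-trans (Sec.rot S₁) (subst₂ Rot
      (trans (same ((s₁ ◂ ⟨ X ⟩) ⊹ Z ◂ ⟨ E ⟩ ⊹ ⟨ L ⟩ ⊹ ⟨ D ⟩ ⊹ Y ◂ ⟨ X′ ⟩ ⊹ e₂ ◂ ⟨ L′ ⟩) (s₁ ◂ (⟨ X ⟩ ⊹ Z ◂ ⟨ E ⟩) ⊹ ⟨ L ⟩ ⊹ (⟨ D ⟩ ⊹ Y ◂ ⟨ X′ ⟩) ⊹ e₂ ◂ ⟨ L′ ⟩) refl)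
        (trans (cong₂ (λ k l → s₁ ∷ k ++ L ++ l ++ e₂ ∷ L′) (sym eX) (sym eX′)) (flat (s₁ ◂ (⟨ I₁ ⟩ ⊹ e₁ ◂ ⟨ [] ⟩) ⊹ ⟨ L ⟩ ⊹ s₂ ◂ ⟨ I₂ ⟩ ⊹ e₂ ◂ ⟨ L′ ⟩))))
      (same ((Z ◂ ⟨ E ⟩ ⊹ ⟨ L ⟩ ⊹ ⟨ D ⟩ ⊹ Y ◂ ⟨ X′ ⟩ ⊹ e₂ ◂ ⟨ L′ ⟩) ⊹ s₁ ◂ ⟨ X ⟩) ((Z ◂ (⟨ E ⟩ ⊹ ⟨ L ⟩ ⊹ ⟨ D ⟩) ⊹ Y ◂ ⟨ [] ⟩) ⊹ ⟨ X′ ⟩ ⊹ e₂ ◂ ⟨ L′ ⟩ ⊹ s₁ ◂ ⟨ X ⟩) refl)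
      (rot-swap (s₁ ∷ X)))
    k₁ : Cyc ((s₁ ∷ I₁ ++ e₁ ∷ []) ++ L ++ s₂ ∷ I₂ ++ e₂ ∷ L′)
    k₁ = subst Cyc (sym (flat ((s₁ ◂ ⟨ I₁ ⟩ ⊹ e₁ ◂ ⟨ [] ⟩) ⊹ ⟨ L ++ s₂ ∷ I₂ ++ e₂ ∷ L′ ⟩))) (rot-cyc (Sec.rot S₁) ringC)
    k₂ : Cyc ((s₂ ∷ I₂ ++ e₂ ∷ []) ++ L′ ++ s₁ ∷ I₁ ++ e₁ ∷ L)
    k₂ = subst Cyc (sym (flat ((s₂ ◂ ⟨ I₂ ⟩ ⊹ e₂ ◂ ⟨ [] ⟩) ⊹ ⟨ L′ ++ s₁ ∷ I₁ ++ e₁ ∷ L ⟩))) (rot-cyc (Sec.rot S₂) ringC)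
    apart₀ : ∀ A {B w} → Cyc (A ++ B) → w ∈ A → w ∈ B → ⊥
    apart₀ A k i j with ∈-∃++ i
    ... | A₁ , A₂ , refl = cyc-fresh (cyc-rot A₁ (subst Cyc (++-assoc A₁ _ _) k)) (∈-++⁺ˡ (∈-++⁺ʳ A₂ j))
    not₁ : ∀ {w} → w ∈ s₁ ∷ I₁ ++ e₁ ∷ [] → w ∈ L ++ s₂ ∷ I₂ ++ e₂ ∷ L′ → ⊥
    not₁ = apart₀ _ k₁
    not₂ : ∀ {w} → w ∈ s₂ ∷ I₂ ++ e₂ ∷ [] → w ∈ L′ ++ s₁ ∷ I₁ ++ e₁ ∷ L → ⊥
    not₂ = apart₀ _ k₂
    Z∈ : Z ∈ s₁ ∷ I₁ ++ e₁ ∷ []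
    Z∈ = there (∈-cast (sym eX) (∈-++⁺ʳ X (here refl)))
    Y∈ : Y ∈ s₂ ∷ I₂ ++ e₂ ∷ []
    Y∈ = ∈-++⁺ˡ (∈-cast (sym eX′) (∈-++⁺ʳ D (here refl)))
    L∈ : ∀ {w} → w ∈ L → w ∈ C
    L∈ i = rot-∈⁻ (Sec.rot S₁) (there (∈-++⁺ʳ I₁ (there (∈-++⁺ˡ i))))
    Z∈C : Z ∈ C
    Z∈C = rot-∈⁻ rotA (here refl)
    Y∈C : Y ∈ C
    Y∈C = rot-∈⁻ rotA (∈-++⁺ˡ (there (∈-++⁺ʳ N (here refl))))
    clear : ∀ {v w} → v ∈ Q → w ∈ N → ¬ v ∼ w
    clear v∈ w∈ vw with ∈-++⁻ E w∈
    ... | inj₁ i = nE i v∈ (∼-sym vw)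
    ... | inj₂ j with ∈-++⁻ L j
    ... | inj₂ i = nD i v∈ (∼-sym vw)
    ... | inj₁ i with inQ v∈
    ... | inj₁ refl = nuL i vw
    ... | inj₂ (inj₁ a) = not₁ (attached-in S₁ a (L∈ i) vw) (∈-++⁺ˡ i)
    ... | inj₂ (inj₂ a) = not₂ (attached-in S₂ a (L∈ i) vw) (∈-++⁺ʳ L′ (there (∈-++⁺ʳ I₁ (there i))))
    off-C : ∀ {v} → v ∈ Q → v ∉ C
    off-C v∈ with inQ v∈
    ... | inj₁ refl = u∉
    ... | inj₂ (inj₁ a) = proj₁ (proj₁ a)
    ... | inj₂ (inj₂ a) = proj₁ (proj₁ a)
    ring : Cyc ((Z ∷ N ++ Y ∷ []) ++ P)
    ring = close-ring N (cyc-arc (Z ∷ N ++ Y ∷ []) (∈-++⁺ʳ X′ (here refl)) (rot-cyc rotA ringC)) T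
      (λ { v∈ w∈ refl → off-C v∈ (rot-∈⁻ rotA (∈-++⁺ˡ w∈)) }) clear
    x∉A : x ∉ (Z ∷ N ++ Y ∷ []) ++ P
    x∉A i with ∈-++⁻ (Z ∷ N ++ Y ∷ []) i
    ... | inj₁ j = x∉C (rot-∈⁻ rotA (∈-++⁺ˡ j))
    ... | inj₂ j with inQ (sub j)
    ... | inj₁ q = ∼-irrefl xu q
    ... | inj₂ (inj₁ a) = proj₁ (proj₂ (proj₁ a)) refl
    ... | inj₂ (inj₂ a) = proj₁ (proj₂ (proj₁ a)) refl
    only-u : ∀ {w} → w ∈ P → x ∼ w → w ≡ u
    only-u w∈ xw with inQ (sub w∈)
    ... | inj₁ q = q
    ... | inj₂ (inj₁ a) = ⊥-elim (proj₂ (proj₂ (proj₁ a)) xw)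
    ... | inj₂ (inj₂ a) = ⊥-elim (proj₂ (proj₂ (proj₁ a)) xw)
    P≤1 : cnt x P ≤ 1
    P≤1 = cnt-only P ip only-u
    thin : Thin P
    thin a M b e = ≤-trans (≤-trans (subst (cnt x M ≤_) (sym (cnt-++ x M)) (m≤m+n _ _)) (cnt-∷≥ x a (M ++ b ∷ []))) (subst (λ l → cnt x l ≤ 1) e P≤1)
    q∈P : Trimmed.q T ∈ P
    q∈P = ∈-cast (sym eP₂) (∈-++⁺ʳ P₂ (here refl))
    p∈P : Trimmed.p T ∈ P
    p∈P = ∈-cast (sym eP₁) (here refl)
    -- Without `u` the path `P` avoids `C` and `N[x]`, so attachment to a sector spreads along it
    -- and carries `Z` into the second sector or `Y` into the first.
    u∈P : u ∈ P
    u∈P with u ∈? P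
    ... | yes i = i
    ... | no u∉P = ⊥-elim (contra (attached q∈P))
      where
      attached : ∀ {w} → w ∈ P → Attached S₁ w ⊎ Attached S₂ w
      attached w∈ with inQ (sub w∈)
      ... | inj₁ refl = ⊥-elim (u∉P w∈)
      ... | inj₂ a = a
      outP : ∀ {w} → w ∈ P → Out w
      outP w∈ = [ proj₁ , proj₁ ]′ (attached w∈)
      contra : Attached S₁ (Trimmed.q T) ⊎ Attached S₂ (Trimmed.q T) → ⊥
      contra (inj₂ a) = not₁ Z∈ (∈-++⁺ʳ L (∈-cast (++-assoc (s₂ ∷ I₂) (e₂ ∷ []) L′) (∈-++⁺ˡ (attached-in S₂ a Z∈C qb))))
      contra (inj₁ (_ , p′ , n , y , t , p′y , y∈)) with trail-in ip outP p∈P q∈P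
      ... | m , _ , t′ = not₁ (attached-in S₁ (outP p∈P , p′ , m + n , y , trail-++ t′ t , p′y , y∈) Y∈C pa)
            (∈-++⁺ʳ L (∈-cast (++-assoc (s₂ ∷ I₂) (e₂ ∷ []) L′) (∈-++⁺ˡ Y∈)))
    e₁∈ : e₁ ∈ Z ∷ E
    e₁∈ with ∈-tails I₁ X eX
    ... | inj₁ ()
    ... | inj₂ i = i
    s₂∈ : ∀ D → s₂ ∷ I₂ ≡ D ++ Y ∷ X′ → s₂ ∈ D ++ Y ∷ []
    s₂∈ [] e = here (∷-injectiveˡ e)
    s₂∈ (_ ∷ D) e = here (∷-injectiveˡ e)
    cntA : cnt x (Z ∷ N ++ Y ∷ []) ≡ cnt x (Z ∷ E) + (cnt x L + cnt x (D ++ Y ∷ []))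
    cntA = trans (cong (cnt x) (same (Z ◂ (⟨ E ⟩ ⊹ ⟨ L ⟩ ⊹ ⟨ D ⟩) ⊹ Y ◂ ⟨ [] ⟩) ((Z ◂ ⟨ E ⟩) ⊹ ⟨ L ⟩ ⊹ ⟨ D ⟩ ⊹ Y ◂ ⟨ [] ⟩) refl))
      (trans (cnt-++ x (Z ∷ E)) (cong (cnt x (Z ∷ E) +_) (cnt-++ x L)))
    2≤A : 2 ≤ cnt x (Z ∷ N ++ Y ∷ [])
    2≤A = subst (2 ≤_) (sym cntA) (+-mono-≤ (has-spoke (Z ∷ E) e₁∈ (Sec.xe S₁))
      (≤-trans (has-spoke (D ++ Y ∷ []) (s₂∈ D eX′) (Sec.xs S₂)) (m≤n+m _ (cnt x L))))
    2≤rest : 2 ≤ cnt x rest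
    2≤rest = subst (2 ≤_) (sym (trans (cong (cnt x) (sym (++-assoc X′ (e₂ ∷ L′) (s₁ ∷ X)))) (cnt-++ x (X′ ++ e₂ ∷ L′))))
      (+-mono-≤ (has-spoke (X′ ++ e₂ ∷ L′) (∈-++⁺ʳ X′ (here refl)) (Sec.xe S₂)) (has-spoke (s₁ ∷ X) (here refl) (Sec.xs S₁)))
    cntAP : cnt x ((Z ∷ N ++ Y ∷ []) ++ P) ≡ cnt x (Z ∷ N ++ Y ∷ []) + cnt x P
    cntAP = cnt-++ x (Z ∷ N ++ Y ∷ [])
    three : 3 ≤ cnt x ((Z ∷ N ++ Y ∷ []) ++ P)
    three = subst (3 ≤_) (sym cntAP) (+-mono-≤ 2≤A (has-spoke P u∈P xu))
    few′ : cnt x ((Z ∷ N ++ Y ∷ []) ++ P) < cnt x C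
    few′ = subst₂ _<_ (sym cntAP) (sym (trans (cnt-rot x rotA) (cnt-++ x (Z ∷ N ++ Y ∷ []))))
      (+-monoʳ-< (cnt x (Z ∷ N ++ Y ∷ [])) (≤-trans (s≤s P≤1) 2≤rest))

  common : ∀ (A B : List (V G)) → (∃[ v ] (v ∈ A × v ∈ B)) ⊎ (∀ {v} → v ∈ A → v ∉ B)
  common [] B = inj₂ λ ()
  common (a ∷ A) B with a ∈? B | common A B
  ... | yes a∈ | _ = inj₁ (a , here refl , a∈)
  ... | no _ | inj₁ (v , i , j) = inj₁ (v , there i , j)
  ... | no a∉ | inj₂ f = inj₂ λ { (here refl) → a∉ ; (there i) → f i }

  -- A vertex `u` on `C` lies in both sectors. For `u` off `C` and disjoint sectors, the spokes `s₁`
  -- and `s₂` separate the arcs `L` and `L′` left between them, so properness keeps `u` from having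
  -- neighbours in both, and `far` applies on one side.
  touching-sectors : ∀ {s₁ I₁ e₁ R₁ s₂ I₂ e₂ R₂ u} → (S₁ : Sec s₁ I₁ e₁ R₁) (S₂ : Sec s₂ I₂ e₂ R₂) → x ∼ u →
    Touches S₁ u → Touches S₂ u → ∃[ v ] (v ∈ s₁ ∷ I₁ ++ e₁ ∷ [] × v ∈ s₂ ∷ I₂ ++ e₂ ∷ [])
  touching-sectors {s₁} {I₁} {e₁} {R₁} {s₂} {I₂} {e₂} {R₂} {u} S₁ S₂ xu t₁ t₂ with u ∈? C
  ... | yes u∈ = u , touch-on-ring S₁ u∈ t₁ , touch-on-ring S₂ u∈ t₂
  ... | no u∉ with common (s₁ ∷ I₁ ++ e₁ ∷ []) (s₂ ∷ I₂ ++ e₂ ∷ [])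
  ... | inj₁ c = c
  ... | inj₂ disjoint with ∈-++⁻ (s₁ ∷ I₁ ++ e₁ ∷ []) (∈-cast (sym (flat ((s₁ ◂ ⟨ I₁ ⟩ ⊹ e₁ ◂ ⟨ [] ⟩) ⊹ ⟨ R₁ ⟩)))
                             (rot-∈ (Sec.rot S₁) (rot-∈⁻ (Sec.rot S₂) (here refl))))
  ... | inj₁ i = ⊥-elim (disjoint i (here refl))
  ... | inj₂ i with ∈-∃++ i
  ... | L , T , refl with split-before T I₂ (same-head (rot-trans (Sec.rot S₁)
            (rot-trans (subst (λ l → Rot l (s₂ ∷ T ++ s₁ ∷ I₁ ++ e₁ ∷ L)) (flat ((s₁ ◂ ⟨ I₁ ⟩ ⊹ e₁ ◂ ⟨ L ⟩) ⊹ s₂ ◂ ⟨ T ⟩)) (rot-swap (s₁ ∷ I₁ ++ e₁ ∷ L))) done))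
          (Sec.rot S₂)) (λ j → disjoint (here refl) (there j))
  ... | L′ , refl , refl with first u L | first u L′
  ... | inj₁ f | _ = ⊥-elim (far S₁ S₂ u∉ xu f t₁ t₂)
  ... | inj₂ _ | inj₁ f = ⊥-elim (far S₂ S₁ u∉ xu f t₂ t₁)
  ... | inj₂ (L₁ , a , L₂ , refl , _ , ua) | inj₂ (M₁ , b , M₂ , refl , _ , ub)
    with pair u∉ (λ e → ∼-irrefl xu (sym e)) (rot-trans (Sec.rot S₁) (subst₂ Rot
           (same ((s₁ ◂ ⟨ I₁ ⟩ ⊹ e₁ ◂ ⟨ L₁ ⟩) ⊹ a ◂ ⟨ L₂ ⟩ ⊹ s₂ ◂ ⟨ I₂ ⟩ ⊹ e₂ ◂ ⟨ M₁ ⟩ ⊹ b ◂ ⟨ M₂ ⟩)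
                 (s₁ ◂ ⟨ I₁ ⟩ ⊹ e₁ ◂ (⟨ L₁ ⟩ ⊹ a ◂ ⟨ L₂ ⟩) ⊹ s₂ ◂ ⟨ I₂ ⟩ ⊹ e₂ ◂ ⟨ M₁ ⟩ ⊹ b ◂ ⟨ M₂ ⟩) refl)
           (same ((a ◂ ⟨ L₂ ⟩ ⊹ s₂ ◂ ⟨ I₂ ⟩ ⊹ e₂ ◂ ⟨ M₁ ⟩ ⊹ b ◂ ⟨ M₂ ⟩) ⊹ s₁ ◂ ⟨ I₁ ⟩ ⊹ e₁ ◂ ⟨ L₁ ⟩)
                 (a ◂ (⟨ L₂ ⟩ ⊹ s₂ ◂ ⟨ I₂ ⟩ ⊹ e₂ ◂ ⟨ M₁ ⟩) ⊹ b ◂ ⟨ M₂ ⟩ ⊹ s₁ ◂ ⟨ I₁ ⟩ ⊹ e₁ ◂ ⟨ L₁ ⟩) refl)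
           (rot-swap (s₁ ∷ I₁ ++ e₁ ∷ L₁)))) ua ub
  ... | inj₁ f = ⊥-elim (f (∈-++⁺ʳ L₂ (here refl)) (Sec.xs S₂))
  ... | inj₂ f = ⊥-elim (f (∈-++⁺ʳ M₂ (here refl)) (Sec.xs S₁))

-- Translation of the results on rings to the given wheel.

module Main (G : Graph) (isk : ISK4-free G) (dia : Diamond-free G) (bow : Bowtie-free G) (prf : Prism-free G)
  (W : Wheel G) (proper : Proper G W)
  (least : ∀ (W′ : Wheel G) → Wheel.center W′ ≡ Wheel.center W → Proper G W′ → numSpokes G W ≤ numSpokes G W′) where
  open Paths G
  open Wheel W
  open Unroll G W
  open Roll G using (proper-wheel)

  rim : Rim G center ring
  rim = record
    { ringC = ring-cyc
    ; x∉C = λ i → let (t , e) = ring-∈ i in center∉C t (sym e)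
    ; spokes = subst (3 ≤_) (count center) 3spokes
    ; pair = proper-pair proper
    ; few = proper-count proper
    ; least = λ k l x∉ t good → let (W′ , c , pr , n) = proper-wheel k l x∉ t good in
        subst₂ _≤_ (count center) n (least W′ c pr) }

  same-head : ∀ {z X Y} → Rot ring (z ∷ X) → Rot ring (z ∷ Y) → X ≡ Y
  same-head r r′ with seg-rot r 0 refl | seg-rot r′ 0 refl
  ... | j , e | j′ , e′ = ∷-injectiveʳ (trans e (trans (seg-cong j j′ K
        (F-shift j j′ (trans (sym (∷-injectiveˡ e)) (∷-injectiveˡ e′)))) (sym e′)))

  open Components G isk dia bow prf rim same-head

  module _ (S : Sector G W) where
    open Sector S

    private
      a : ℕ
      a = toℕ start

    interior after : List (V G)
    interior = seg (suc a) (d ∸ 1)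
    after = seg (suc (a + d)) (k ∸ d)

    from to : V G
    from = F a
    to = F (a + d)

    private
      d≡ : suc (d ∸ 1) ≡ d
      d≡ = m+[n∸m]≡n 1≤d

      in-interior : ∀ {w} → w ∈ interior → InInterior G W S w
      in-interior w∈ with ∈-seg (suc a) (d ∸ 1) w∈
      ... | t , l , h , refl = t ∸ a , m<n⇒0<n∸m l ,
            +-cancelˡ-< a (t ∸ a) d (subst₂ _<_ (sym t≡) (trans (sym (+-suc a (d ∸ 1))) (cong (a +_) d≡)) h) , cong F (sym t≡)
        where
        t≡ : a + (t ∸ a) ≡ t
        t≡ = m+[n∸m]≡n (<⇒≤ l)

    interior-∈ : ∀ {w} → InInterior G W S w → w ∈ interior
    interior-∈ (t , 1≤t , t<d , refl) = seg-∈ (suc a) (d ∸ 1) (a + t)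
      (subst (_≤ a + t) (+-comm a 1) (+-monoʳ-≤ a 1≤t))
      (subst (a + t <_) (trans (cong (a +_) (sym d≡)) (+-suc a (d ∸ 1))) (+-monoʳ-< a t<d))

    closed-∈ : ∀ {w} → w ∈ from ∷ interior ++ to ∷ [] → InSec G W S w
    closed-∈ (here refl) = 0 , z≤n , cong F (sym (+-identityʳ a))
    closed-∈ (there i) with ∈-++⁻ interior i
    ... | inj₁ j = let (t , _ , t<d , e) = in-interior j in t , <⇒≤ t<d , e
    ... | inj₂ (here refl) = d , ≤-refl , refl

    sec : Sec from interior to after
    sec = record
      { rot = subst (Rot ring) shape (rot-seg a)
      ; xs = subst (center ∼_) (sym (F-toℕ start)) spoke-start
      ; xe = spoke-end
      ; nI = λ i xw → let (t , 1≤t , t<d , e) = in-interior i in no-spoke t 1≤t t<d (subst (center ∼_) e xw) }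
      where
      shape : seg a K ≡ from ∷ interior ++ to ∷ after
      shape = trans (cong (seg a) (sym (trans (+-suc d (k ∸ d)) (cong suc (m+[n∸m]≡n d≤k)))))
        (trans (seg-++ a d) (cong (_++ seg (a + d) (suc (k ∸ d))) (cong (seg a) (sym d≡))))

    inner-point : HasInterior G W S → ∃[ v ] InInterior G W S v
    inner-point two = F (a + 1) , 1 , ≤-refl , two , refl

  same-start : ∀ (S₁ S₂ : Sector G W) → from S₁ ≡ from S₂ → Sector.start S₁ ≡ Sector.start S₂
  same-start S₁ S₂ e = cyc-inj (trans (sym (F-toℕ (Sector.start S₁))) (trans e (F-toℕ (Sector.start S₂))))

  -- A point of the second interior is in the component of the first and on `C`, hence in the first
  -- interior; sectors with a common interior point have the same start.
  part-i : PartI G W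
  part-i r _ S₁ S₂ h₁ h₂ r₁ r₂ with inner-point S₁ h₁ | inner-point S₂ h₂
  ... | v , v∈ | w , w∈ = same-start S₁ S₂ (same-interior (sec S₁) (sec S₂)
        (common-component (sec S₁) (r₁ v v∈) (interior-∈ S₁ v∈) (r₂ w w∈) (rot-∈⁻ (Sec.rot (sec S₂)) (there (∈-++⁺ˡ (interior-∈ S₂ w∈)))))
        (interior-∈ S₂ w∈))

  part-ii : PartII G W
  part-ii u xu = (λ S₁ S₂ S₃ h₁ h₂ h₃ d₁ d₂ d₃ →
      [ (λ e → inj₁ (same-start S₁ S₂ e)) , [ (λ e → inj₂ (inj₁ (same-start S₁ S₃ e))) , (λ e → inj₂ (inj₂ (same-start S₂ S₃ e))) ]′ ]′
        (three-sectors (sec S₁) (sec S₂) (sec S₃) (meet S₁ S₂ h₁ h₂ d₁ d₂) (meet S₁ S₃ h₁ h₃ d₁ d₃) (meet S₂ S₃ h₂ h₃ d₂ d₃))) ,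
    λ S₁ S₂ h₁ h₂ d₁ d₂ → let (v , i , j) = shared S₁ S₂ h₁ h₂ d₁ d₂ in v , closed-∈ S₁ i , closed-∈ S₂ j
    where
    InD : Sector G W → Set
    InD S = ∀ v → InInterior G W S v → Reach G (λ w → N[_] G center w × w ≢ u) u v
    reached : ∀ S → HasInterior G W S → InD S → Touches (sec S) u
    reached S h f with inner-point S h
    ... | v , v∈ = touches (sec S) xu (f v v∈) (interior-∈ S v∈)
    shared : ∀ S₁ S₂ → HasInterior G W S₁ → HasInterior G W S₂ → InD S₁ → InD S₂ →
      ∃[ v ] (v ∈ from S₁ ∷ interior S₁ ++ to S₁ ∷ [] × v ∈ from S₂ ∷ interior S₂ ++ to S₂ ∷ [])
    shared S₁ S₂ h₁ h₂ d₁ d₂ = touching-sectors (sec S₁) (sec S₂) xu (reached S₁ h₁ d₁) (reached S₂ h₂ d₂)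
    meet : ∀ S₁ S₂ → HasInterior G W S₁ → HasInterior G W S₂ → InD S₁ → InD S₂ → from S₁ ≡ from S₂ ⊎ to S₁ ≡ from S₂ ⊎ to S₂ ≡ from S₁
    meet S₁ S₂ h₁ h₂ d₁ d₂ = let (_ , i , j) = shared S₁ S₂ h₁ h₂ d₁ d₂ in meeting (sec S₁) (sec S₂) i j

theorem3p16 : (G : Graph) →
    ISK4-free G → Diamond-free G → Bowtie-free G → Prism-free G → K33-free G →
    (x : V G) → IsCenterOfProperWheel G x →
    (W : Wheel G) → Wheel.center W ≡ x → Proper G W →
    (∀ (W' : Wheel G) → Wheel.center W' ≡ x → Proper G W' →
       numSpokes G W ≤ numSpokes G W') →
    PartI G W × PartII G W
theorem3p16 G isk dia bow prf _ x _ W refl proper least = part-i , part-ii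
  where open Main G isk dia bow prf W proper least
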